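{- Let $1\le k\le n$ and let $\lambda=(\lambda_1,\dots,\lambda_k)$ be a partition with at most $k$ parts (padded with zeros). Then $$B^{(n)}_k\,S_\lambda[X^{tq}]=\det\Big(S_{\lambda_r-r+c+1}[X^{tq}]-t^{k-c}\,S_{\lambda_r-r+c+1}[X^{tq}+X^t]\Big)_{r,c=1}^{k}.$$
   Context: Plethystic notation: for a rational function $E$ in $x_1,\dots,x_n,q,t$, $p_i[E]$ replaces each of $x_1,\dots,x_n,q,t$ by its $i$-th power; $f[E]$ for a symmetric function $f$ is defined via power sums. $S_j$ is the complete homogeneous symmetric function ($S_j=0$ for $j<0$), $S_\lambda[E]=\det(S_{\lambda_r-r+c}[E])_{r,c=1}^k$. $X=x_1+\cdots+x_n$, $X^{tq}=X(t-1)/(q-1)$, $X^t=X(t-1)$. For alphabets $A,B$, $R(A,B)=\prod_{a\in A,b\in B}(a-b)$. For a set $I$ of indices, $X_I=\sum_{i\in I}x_i$, $X_I^c=\sum_{i\in\{1,\dots,n\}\setminus I}x_i$, $x^I=\prod_{i\in I}x_i$. $\Theta_l$ replaces $x_l$ by $qx_l$. For $J\subseteq I$ and $l\ge0$, the Macdonald operator in the variables $\{x_i:i\in I\}$ is $M^{(I)}_l=t^{\binom l2}\sum_{J\subseteq I,|J|=l}\prod_{i\in J,j\in I\setminus J}(tx_i-x_j)\prod_{j\in J}\Theta_j$ ($M_0^{(I)}=\mathrm{id}$). The creation operator on symmetric functions of $x_1,\dots,x_n$ is $$B^{(n)}_k=\sum_{I\subseteq\{1,\dots,n\},|I|=k}\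 \sum_{l=0}^k(-t)^l\,x^I\,\frac{R(X_I,X_I^c/t)}{R(X_I,X_I^c)}\,M^{(I)}_l .$$
   Formalization: The Macdonald operator is taken with its standard denominators (tx_i-x_j)/(x_i-x_j); without them the claim fails (n=k=2, λ=(0,0)). The identity is stated at all rational x_i (distinct), q, t where defined (q^m≠1, t≠0), which implies the identity of rational functions. -}

module Defs where

open import Data.Bool using (Bool; true; false; if_then_else_; _∧_; not)
open import Data.Nat as ℕ using (ℕ; zero; suc; _≡ᵇ_; _∸_)
open import Data.Integer as ℤ using (ℤ; +_; -[1+_])
open import Data.Fin using (Fin; zero; suc; toℕ; punchIn)
open import Data.Fin.Subset using (Subset; Side; inside; outside; ∣_∣)
open import Data.Vec using (Vec; []; _∷_; lookup)
open import Data.List using (List; []; _∷_; _++_; map; foldr; allFin; filterᵇ)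
open import Data.Rational using (ℚ; 0ℚ; 1ℚ; _+_; _*_; _-_; -_; 1/_; ≢-nonZero)
open import Data.Rational.Properties using (_≟_)
open import Relation.Nullary using (yes; no)

ℕ→ℚ : ℕ → ℚ
ℕ→ℚ zero    = 0ℚ
ℕ→ℚ (suc m) = 1ℚ + ℕ→ℚ m

_^ℚ_ : ℚ → ℕ → ℚ
a ^ℚ zero  = 1ℚ
a ^ℚ suc m = a * (a ^ℚ m)

-- total inverse (value 0 at 0); the theorem's hypotheses guarantee that
-- it is only ever applied to nonzero arguments.
inv : ℚ → ℚ
inv p with p ≟ 0ℚ
... | yes _ = 0ℚ
... | no ne = 1/_ p {{≢-nonZero ne}}

sumL : List ℚ → ℚ
sumL = foldr _+_ 0ℚ

prodL : List ℚ → ℚ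
prodL = foldr _*_ 1ℚ

Σ[_]_ : (m : ℕ) → (Fin m → ℚ) → ℚ
Σ[ m ] f = sumL (map f (allFin m))

Π[_]_ : (m : ℕ) → (Fin m → ℚ) → ℚ
Π[ m ] f = prodL (map f (allFin m))

choose2 : ℕ → ℕ
choose2 zero    = zero
choose2 (suc l) = l ℕ.+ choose2 l

isIn : ∀ {n} → Subset n → Fin n → Bool
isIn S i with lookup S i
... | inside  = true
... | outside = false

subsets : ∀ n → List (Subset n)
subsets zero    = [] ∷ []
subsets (suc n) = map (outside ∷_) (subsets n) ++ map (inside ∷_) (subsets n)

subsetsOfSize : ∀ n → ℕ → List (Subset n)
subsetsOfSize n k = filterᵇ (λ S → ∣ S ∣ ≡ᵇ k) (subsets n)

_⊆ᵇ_ : ∀ {n} → Subset n → Subset n → Bool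
[]      ⊆ᵇ []      = true
(outside ∷ J) ⊆ᵇ (_ ∷ I)       = J ⊆ᵇ I
(inside  ∷ J) ⊆ᵇ (inside ∷ I)  = J ⊆ᵇ I
(inside  ∷ J) ⊆ᵇ (outside ∷ I) = false

subsetsOfSizeIn : ∀ {n} → Subset n → ℕ → List (Subset n)
subsetsOfSizeIn {n} I l = filterᵇ (λ J → J ⊆ᵇ I) (subsetsOfSize n l)

ΣS : ∀ {n} → List (Subset n) → (Subset n → ℚ) → ℚ
ΣS L f = sumL (map f L)

ΠΠ : ∀ {n} → (Fin n → Bool) → (Fin n → Bool) → (Fin n → Fin n → ℚ) → ℚ
ΠΠ {n} A B g =
  Π[ n ] (λ i → if A i then Π[ n ] (λ j → if B j then g i j else 1ℚ) else 1ℚ)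

Pt : ℕ → Set
Pt n = Fin n → ℚ

Fun : ℕ → Set
Fun n = Pt n → ℚ

ΘS : ∀ {n} → ℚ → Subset n → Pt n → Pt n
ΘS q J x i = if isIn J i then q * x i else x i

-- Macdonald operator M^{(I)}_l in the variables {x_i : i ∈ I}
--   M_l = t^{C(l,2)} Σ_{J ⊆ I, |J| = l} Π_{i∈J, j∈I∖J} (t x_i - x_j)/(x_i - x_j) Π_{j∈J} Θ_j
-- (standard Macdonald operator)
M : ∀ {n} (q t : ℚ) → Subset n → ℕ → Fun n → Fun n
M q t I zero    F x = F x
M q t I (suc l') F x =
  (t ^ℚ choose2 l) *
  ΣS (subsetsOfSizeIn I l) (λ J →
      ΠΠ (isIn J) (λ j → isIn I j ∧ not (isIn J j)) (λ i j → (t * x i - x j) * inv (x i - x j))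
      * F (ΘS q J x))
  where l = suc l'

xPow : ∀ {n} → Subset n → Pt n → ℚ
xPow {n} I x = Π[ n ] (λ i → if isIn I i then x i else 1ℚ)

RIct : ∀ {n} → ℚ → Subset n → Pt n → ℚ
RIct t I x = ΠΠ (isIn I) (λ j → not (isIn I j)) (λ i j → x i - x j * inv t)

RIc : ∀ {n} → Subset n → Pt n → ℚ
RIc I x = ΠΠ (isIn I) (λ j → not (isIn I j)) (λ i j → x i - x j)

B : ∀ n (q t : ℚ) → ℕ → Fun n → Fun n
B n q t k F x =
  ΣS (subsetsOfSize n k) (λ I →
    sumL (map (λ (l : Fin (suc k)) →
        ((- t) ^ℚ toℕ l) * xPow I x * RIct t I x * inv (RIc I x)
        * M q t I (toℕ l) F x)
      (allFin (suc k))))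

-- Plethystic complete homogeneous functions.
-- An "alphabet" E is given by its power sums  pw i = p_i[E]  (i ≥ 1; pw 0 is
-- never used).  S_j[E] = h_j[E] is expressed through power sums by the Newton
-- identity   j h_j = Σ_{i=1}^j p_i h_{j-i},   h_0 = 1.

dot : (ℕ → ℚ) → ℕ → List ℚ → ℚ
dot pw s []      = 0ℚ
dot pw s (h ∷ L) = pw s * h + dot pw (suc s) L

hList : (ℕ → ℚ) → ℕ → List ℚ
hList pw zero    = 1ℚ ∷ []
hList pw (suc j) = (inv (ℕ→ℚ (suc j)) * dot pw 1 L) ∷ L
  where L = hList pw j

headℚ : List ℚ → ℚ
headℚ []      = 0ℚ
headℚ (h ∷ _) = h

S : (ℕ → ℚ) → ℤ → ℚ
S pw (+ j)     = headℚ (hList pw j)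
S pw -[1+ _ ]  = 0ℚ

pX : ∀ {n} → Pt n → ℕ → ℚ
pX {n} x i = Σ[ n ] (λ m → x m ^ℚ i)

-- p_i[X^{tq}] = p_i[X (t-1)/(q-1)] = p_i(x) (t^i - 1)/(q^i - 1)
pXtq : ∀ {n} → ℚ → ℚ → Pt n → ℕ → ℚ
pXtq q t x i = pX x i * (t ^ℚ i - 1ℚ) * inv (q ^ℚ i - 1ℚ)

pXtqXt : ∀ {n} → ℚ → ℚ → Pt n → ℕ → ℚ
pXtqXt q t x i = pXtq q t x i + pX x i * (t ^ℚ i - 1ℚ)

det : ∀ k → (Fin k → Fin k → ℚ) → ℚ
det zero    A = 1ℚ
det (suc k) A =
  Σ[ suc k ] (λ c → ((- 1ℚ) ^ℚ toℕ c) * A zero c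
                   * det k (λ r c' → A (suc r) (punchIn c c')))

-- the integer  λ_r - r + c + e  (r, c 1-based; here r, c : Fin k are 0-based,
-- which leaves the difference unchanged)
idx : ∀ {k} → (Fin k → ℕ) → Fin k → Fin k → ℕ → ℤ
idx lam r c e = (+ lam r) ℤ.- (+ toℕ r) ℤ.+ (+ toℕ c) ℤ.+ (+ e)

SλXtq : ∀ n k (q t : ℚ) → (Fin k → ℕ) → Fun n
SλXtq n k q t lam x = det k (λ r c → S (pXtq q t x) (idx lam r c 0))

RHS : ∀ n k (q t : ℚ) → (Fin k → ℕ) → Fun n
RHS n k q t lam x =
  det k (λ r c → S (pXtq q t x) (idx lam r c 1)
                 - (t ^ℚ (k ∸ suc (toℕ c))) * S (pXtqXt q t x) (idx lam r c 1))

IsPartition : ∀ {k} → (Fin k → ℕ) → Set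
IsPartition {k} lam = ∀ (i j : Fin k) → toℕ i ℕ.≤ toℕ j → lam j ℕ.≤ lam i

{-# OPTIONS --safe #-}
module Submission where

-- Let G be the sequence S[X^{tq} + tX]. Removing letters from an alphabet
-- multiplies the generating function by linear factors, so both sides become
-- values of a form in k linear functionals on polynomials in v (the moments
-- of the r-th one are shifts of G, and adding 1 to an index of S is
-- multiplication by v). By multilinearity it is enough to treat evaluations
-- at generic points v_1, ..., v_k. There the determinants are Vandermonde
-- determinants, and with V(x) = Π_r (v_r - x) the claim becomes
--
--   Σ_J (-s)^|J| t^C(|J|,2) x^J e_{k-|J|}(X_J^c) Π_{i∈J,j∉J} (t x_i - x_j)/(x_i - x_j) Π_{i∈J} V(x_i) Π_{j∉J} V(t x_j)
--     = Π_r v_r · Σ_K (-1)^|K| t^C(|K|,2) Π_{r∈K,p∉K} (v_r - t v_p)/(v_r - v_p) Π_{r∈K,i} (v_r - x_i) Π_{r∉K,i} (v_r - t x_i)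
--
-- with s t^n = t^{k+1}; the sum over I ⊇ J has been carried out by the
-- Hall–Littlewood formula for elementary symmetric functions. This identity
-- is strengthened by the vanishing of the left side when e_{k-|J|} is
-- replaced by e_{m-|J|}, m > k. The two statements together are proved by
-- induction on n, by interpolation in one x: at 0 they reduce to n - 1, and
-- at v_r to n - 1 and k - 1.

import Defs
open import Defs using (B; SλXtq; RHS; IsPartition; _^ℚ_)
open import Data.Bool using (Bool; true; false; if_then_else_; _∧_; not)
open import Data.Empty using (⊥-elim)
open import Data.Fin as Fin using (Fin; zero; suc; toℕ; inject₁; punchIn; punchOut)
import Data.Fin.Properties as Finₚ
open import Data.Fin.Subset using (Subset; inside; outside; ∣_∣; ⊥)
import Data.Integer as ℤ
import Data.Integer.Properties as ℤₚ
open import Data.Integer.Tactic.RingSolver using () renaming (solve-∀ to solveℤ-∀)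
open import Data.List using (List; []; _∷_; _++_; length; map; filterᵇ; tabulate)
import Data.List.Properties as Listₚ
open import Data.List.Membership.Propositional using (_∈_)
open import Data.List.Relation.Binary.Permutation.Propositional using (_↭_; refl; prep; swap; trans; ↭-sym; ↭⇒↭ₛ)
open import Data.List.Relation.Binary.Permutation.Propositional.Properties using (All-resp-↭; ↭-length)
import Data.List.Relation.Binary.Permutation.Setoid.Properties as ↭ₛ
open import Data.List.Relation.Unary.All as All using (All; []; _∷_)
import Data.List.Relation.Unary.All.Properties as Allₚ
open import Data.List.Relation.Unary.AllPairs as AllPairs using ([]; _∷_)
open import Data.List.Relation.Unary.Any using (here; there)
open import Data.List.Relation.Unary.Unique.Propositional using (Unique)
import Data.List.Relation.Unary.Unique.Propositional.Properties as Uniqueₚ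
open import Data.Maybe using (Maybe; just; nothing)
open import Data.Nat as ℕ using (ℕ; zero; suc; _≤_)
import Data.Nat.Properties as ℕₚ
open import Data.Product using (_×_; _,_; proj₁; proj₂; ∃-syntax)
open import Data.Rational as Q using (ℚ; 0ℚ; 1ℚ)
import Data.Rational.Properties as Qₚ
open import Data.Sum using (_⊎_; inj₁; inj₂)
open import Data.Unit using (⊤; tt)
open import Data.Vec as Vec using (Vec; []; _∷_; lookup; toList)
import Data.Vec.Properties as Vecₚ
open import Function using (_∘_)
open import Relation.Binary.PropositionalEquality as ≡ using (_≡_; _≢_; refl; sym; cong; cong₂; subst; module ≡-Reasoning)
open import Relation.Nullary using (Dec; yes; no; ¬_)
open import Tactic.RingSolver using (solve-∀)
open import Tactic.RingSolver.Core.AlmostCommutativeRing using (AlmostCommutativeRing; fromCommutativeRing)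

-- In the new one of n variables, the sum times its differences with the others has degree n + k at
-- first sight, and its top coefficient carries the factor s t^(n-1) - t^k. The condition s t^n =
-- t^(k+1) removes it, so that n + k nodes suffice: the other n - 1 variables, where residues
-- cancel, the k points v_r, and 0. The condition reproduces itself: at 0 a factor t^|J| turns s
-- into s t while n drops, and at v_r both n and k drop while s stays. Hence s is a free parameter.
-- The vanishing statement is forced by the nodes v_r. There e_m of the variables outside J, one of
-- them equal to v_r, splits into e_m and v_r e_(m-1) of the rest; against the remaining k - 1
-- points the former has one degree too many and has to disappear. The node 0 must differ from the
-- other variables; a variable equal to 0 is therefore made the interpolated one. Evaluations are
-- enough because a form in finitely many moments becomes a polynomial in v on the sequence v^a, and
-- is 0 once this polynomial vanishes at all but finitely many v.

ringℚ : AlmostCommutativeRing _ _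
ringℚ = fromCommutativeRing Qₚ.+-*-commutativeRing 0≟
  where
  0≟ : (p : ℚ) → Maybe (0ℚ ≡ p)
  0≟ p with 0ℚ Qₚ.≟ p
  ... | yes e = just e
  ... | no _  = nothing

-- Arithmetic and cancellation in the rationals

infixl 6 _+_ _-_
infixl 7 _*_
infix  8 -_

-- Opaque copies of the operations: the type checker then treats them as
-- injective, so that the arguments of ring identities can be inferred.
opaque
  _+_ _*_ _-_ : ℚ → ℚ → ℚ
  _+_ = Q._+_
  _*_ = Q._*_
  _-_ = Q._-_

  -_ : ℚ → ℚ
  -_ = Q.-_

  inv : ℚ → ℚ
  inv = Defs.inv

opaque
  unfolding _+_

  +-assoc : ∀ a b c → a + b + c ≡ a + (b + c)
  +-assoc = Qₚ.+-assoc
  +-comm : ∀ a b → a + b ≡ b + a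
  +-comm = Qₚ.+-comm
  +-idˡ : ∀ a → 0ℚ + a ≡ a
  +-idˡ = Qₚ.+-identityˡ
  +-idʳ : ∀ a → a + 0ℚ ≡ a
  +-idʳ = Qₚ.+-identityʳ
  *-assoc : ∀ a b c → a * b * c ≡ a * (b * c)
  *-assoc = Qₚ.*-assoc
  *-comm : ∀ a b → a * b ≡ b * a
  *-comm = Qₚ.*-comm
  *-idˡ : ∀ a → 1ℚ * a ≡ a
  *-idˡ = Qₚ.*-identityˡ
  *-idʳ : ∀ a → a * 1ℚ ≡ a
  *-idʳ = Qₚ.*-identityʳ
  *-zeroˡ : ∀ a → 0ℚ * a ≡ 0ℚ
  *-zeroˡ = Qₚ.*-zeroˡ
  *-zeroʳ : ∀ a → a * 0ℚ ≡ 0ℚ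
  *-zeroʳ = Qₚ.*-zeroʳ
  *-distribˡ : ∀ a b c → a * (b + c) ≡ a * b + a * c
  *-distribˡ = Qₚ.*-distribˡ-+
  *-distribʳ : ∀ a b c → (b + c) * a ≡ b * a + c * a
  *-distribʳ = Qₚ.*-distribʳ-+
  x-x : ∀ a → a - a ≡ 0ℚ
  x-x = Qₚ.+-inverseʳ

  *-interchange : ∀ a b c d → a * b * (c * d) ≡ a * c * (b * d)
  *-interchange = solve-∀ ringℚ
  +-interchange : ∀ a b c d → a + b + (c + d) ≡ a + c + (b + d)
  +-interchange = solve-∀ ringℚ
  swap-* : ∀ a b c → a * (b * c) ≡ b * (a * c)
  swap-* = solve-∀ ringℚ
  split-diff : ∀ a b → a ≡ b + (a - b)
  split-diff = solve-∀ ringℚ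

  inv-inverseʳ : ∀ {p} → p ≢ 0ℚ → p * inv p ≡ 1ℚ
  inv-inverseʳ {p} p≢0 with p Qₚ.≟ 0ℚ
  ... | yes e = ⊥-elim (p≢0 e)
  ... | no ne = Qₚ.*-inverseʳ p {{Q.≢-nonZero ne}}

*-congˡ : ∀ {a b c} → b ≡ c → a * b ≡ a * c
*-congˡ = cong (_ *_)

*-congʳ : ∀ {a b c} → b ≡ c → b * a ≡ c * a
*-congʳ = cong (_* _)

+-congˡ : ∀ {a b c} → b ≡ c → a + b ≡ a + c
+-congˡ = cong (_ +_)

+-congʳ : ∀ {a b c} → b ≡ c → b + a ≡ c + a
+-congʳ = cong (_+ _)

x-y≢0 : ∀ {a b} → a ≢ b → a - b ≢ 0ℚ
x-y≢0 {a} {b} a≢b e = a≢b (≡.trans (split-diff a b) (≡.trans (cong (b +_) e) (+-idʳ b)))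

x-y≡0 : ∀ {a b} → a - b ≡ 0ℚ → a ≡ b
x-y≡0 {a} {b} e = ≡.trans (split-diff a b) (≡.trans (cong (b +_) e) (+-idʳ b))

inv-inverseˡ : ∀ {p} → p ≢ 0ℚ → inv p * p ≡ 1ℚ
inv-inverseˡ p≢0 = ≡.trans (*-comm _ _) (inv-inverseʳ p≢0)

*-cancelˡ : ∀ {c a b} → c ≢ 0ℚ → c * a ≡ c * b → a ≡ b
*-cancelˡ {c} {a} {b} c≢0 e = begin
  a                ≡⟨ sym (*-idˡ a) ⟩
  1ℚ * a           ≡⟨ cong (_* a) (sym (inv-inverseˡ c≢0)) ⟩
  inv c * c * a    ≡⟨ *-assoc _ _ _ ⟩
  inv c * (c * a)  ≡⟨ cong (inv c *_) e ⟩
  inv c * (c * b)  ≡⟨ sym (*-assoc _ _ _) ⟩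
  inv c * c * b    ≡⟨ cong (_* b) (inv-inverseˡ c≢0) ⟩
  1ℚ * b           ≡⟨ *-idˡ b ⟩
  b                ∎
  where open ≡-Reasoning

*-≢0 : ∀ {a b} → a ≢ 0ℚ → b ≢ 0ℚ → a * b ≢ 0ℚ
*-≢0 {a} a≢0 b≢0 e = b≢0 (*-cancelˡ a≢0 (≡.trans e (sym (*-zeroʳ a))))

-- Polynomial functions

-- Lead d c f: f is a polynomial function of degree at most d whose
-- coefficient of z^d is c.
Lead : ℕ → ℚ → (ℚ → ℚ) → Set
Lead zero    c f = ∀ z → f z ≡ c
Lead (suc d) c f = ∃[ a ] ∃[ g ] Lead d c g × (∀ z → f z ≡ a + z * g z)

lead-cong : ∀ d {c c′ f g} → c ≡ c′ → (∀ z → f z ≡ g z) → Lead d c f → Lead d c′ g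
lead-cong zero    refl e l z = ≡.trans (sym (e z)) (l z)
lead-cong (suc d) refl e (a , h , l , p) = a , h , l , λ z → ≡.trans (sym (e z)) (p z)

opaque
  unfolding _+_

  lead-+ : ∀ d {c c′ f g} → Lead d c f → Lead d c′ g → Lead d (c + c′) (λ z → f z + g z)
  lead-+ zero    l l′ z = cong₂ _+_ (l z) (l′ z)
  lead-+ (suc d) (a , h , l , p) (a′ , h′ , l′ , p′) =
    a + a′ , _ , lead-+ d l l′ ,
    λ z → ≡.trans (cong₂ _+_ (p z) (p′ z)) (regroup a z (h z) a′ (h′ z))
    where
    regroup : ∀ a z h a′ h′ → (a + z * h) + (a′ + z * h′) ≡ (a + a′) + z * (h + h′)
    regroup = solve-∀ ringℚ

  lead-scale : ∀ d {c f} k → Lead d c f → Lead d (k * c) (λ z → k * f z)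
  lead-scale zero    k l z = cong (k *_) (l z)
  lead-scale (suc d) k (a , h , l , p) =
    k * a , _ , lead-scale d k l , λ z → ≡.trans (cong (k *_) (p z)) (regroup k a z (h z))
    where
    regroup : ∀ k a z h → k * (a + z * h) ≡ k * a + z * (k * h)
    regroup = solve-∀ ringℚ

  lead-raise : ∀ d {c f} → Lead d c f → Lead (suc d) 0ℚ f
  lead-raise zero    {c} l = c , (λ _ → 0ℚ) , (λ _ → refl) , λ z → ≡.trans (l z) (regroup c z)
    where
    regroup : ∀ c z → c ≡ c + z * 0ℚ
    regroup = solve-∀ ringℚ
  lead-raise (suc d) (a , h , l , p) = a , h , lead-raise d l , p

  lead-shift : ∀ d {c f} → Lead d c f → Lead (suc d) c (λ z → z * f z)
  lead-shift d {f = f} l = 0ℚ , f , l , λ z → sym (+-idˡ _)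

  -- Synthetic division by `z - a`. The quotient keeps the top coefficient, so `lead-roots` can
  -- divide repeatedly without losing the information that it is 0.
  lead-factor : ∀ d {c f} a → Lead (suc d) c f →
    ∃[ q ] Lead d c q × (∀ z → f z ≡ f a + (z - a) * q z)
  lead-factor zero {c} {f} a (b , h , l , p) = (λ _ → c) , (λ _ → refl) , λ z → begin
    f z                             ≡⟨ ≡.trans (p z) (cong (λ u → b + z * u) (l z)) ⟩
    b + z * c                       ≡⟨ regroup a b c z ⟩
    (b + a * c) + (z - a) * c       ≡⟨ cong (_+ (z - a) * c) (sym (≡.trans (p a) (cong (λ u → b + a * u) (l a)))) ⟩
    f a + (z - a) * c               ∎
    where
    open ≡-Reasoning
    regroup : ∀ a b c z → b + z * c ≡ (b + a * c) + (z - a) * c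
    regroup = solve-∀ ringℚ
  lead-factor (suc d) {c} {f} a (b , h , l , p) with lead-factor d a l
  ... | q , lq , e = (λ z → h a + z * q z) , (h a , q , lq , λ _ → refl) , λ z → begin
    f z                                             ≡⟨ ≡.trans (p z) (cong (λ u → b + z * u) (e z)) ⟩
    b + z * (h a + (z - a) * q z)                   ≡⟨ regroup a b (h a) (q z) z ⟩
    (b + a * h a) + (z - a) * (h a + z * q z)       ≡⟨ cong (_+ (z - a) * (h a + z * q z)) (sym (p a)) ⟩
    f a + (z - a) * (h a + z * q z)                 ∎
    where
    open ≡-Reasoning
    regroup : ∀ a b h q z → b + z * (h + (z - a) * q) ≡ (b + a * h) + (z - a) * (h + z * q)
    regroup = solve-∀ ringℚ

lead-lin : ∀ a b → Lead 1 b (λ z → a + z * b)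
lead-lin a b = a , (λ _ → b) , (λ _ → refl) , λ _ → refl

lead-raises : ∀ e d {c f} → Lead d c f → Lead (suc e ℕ.+ d) 0ℚ f
lead-raises zero    d l = lead-raise d l
lead-raises (suc e) d l = lead-raise (suc e ℕ.+ d) (lead-raises e d l)

lead-* : ∀ d e {c c′ f g} → Lead d c f → Lead e c′ g → Lead (d ℕ.+ e) (c * c′) (λ z → f z * g z)
lead-* zero    e {c} {g = g} l l′ = lead-cong e refl (λ z → cong (_* g z) (sym (l z))) (lead-scale e c l′)
lead-* (suc d) e {g = g} (a , h , l , p) l′ =
  lead-cong (suc d ℕ.+ e) (≡.trans (+-congʳ (*-zeroʳ a)) (+-idˡ _))
    (λ z → sym (≡.trans (cong (_* g z) (p z)) (≡.trans (*-distribʳ _ _ _) (cong (a * g z +_) (*-assoc _ _ _)))))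
    (lead-+ (suc d ℕ.+ e) (lead-scale (suc d ℕ.+ e) a (lead-raises d e l′))
                          (lead-shift (d ℕ.+ e) (lead-* d e l l′)))

-- Top coefficient 0 means degree strictly below the number of roots. Every interpolation ends here:
-- a cancellation of top coefficients does the work of one more node.
lead-roots : ∀ rs {f} → Lead (length rs) 0ℚ f → Unique rs → All (λ r → f r ≡ 0ℚ) rs → ∀ z → f z ≡ 0ℚ
lead-roots []       l _ _ = l
lead-roots (r ∷ rs) {f} l (r∉rs ∷ u) (fr≡0 ∷ frs≡0) z with lead-factor (length rs) r l
... | q , lq , e = begin
  f z                 ≡⟨ f≡ z ⟩
  (z - r) * q z       ≡⟨ cong ((z - r) *_) (lead-roots rs lq u (All.zipWith q≡0 (r∉rs , frs≡0)) z) ⟩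
  (z - r) * 0ℚ        ≡⟨ *-zeroʳ _ ⟩
  0ℚ                  ∎
  where
  open ≡-Reasoning
  f≡ : ∀ z → f z ≡ (z - r) * q z
  f≡ z = ≡.trans (e z) (≡.trans (+-congʳ fr≡0) (+-idˡ _))
  q≡0 : ∀ {r′} → r ≢ r′ × f r′ ≡ 0ℚ → q r′ ≡ 0ℚ
  q≡0 {r′} (r≢r′ , fr′) =
    *-cancelˡ (x-y≢0 (λ eq → r≢r′ (sym eq))) (≡.trans (sym (f≡ r′)) (≡.trans fr′ (sym (*-zeroʳ _))))

-- Products over lists and sums over splittings of a list

Πl : (ℚ → ℚ) → List ℚ → ℚ
Πl h []       = 1ℚ
Πl h (x ∷ xs) = h x * Πl h xs

Πl-cong : ∀ {h g} xs → All (λ x → h x ≡ g x) xs → Πl h xs ≡ Πl g xs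
Πl-cong []       []       = refl
Πl-cong (x ∷ xs) (e ∷ es) = cong₂ _*_ e (Πl-cong xs es)

Πl-cong′ : ∀ {h g} xs → (∀ x → h x ≡ g x) → Πl h xs ≡ Πl g xs
Πl-cong′ xs e = Πl-cong xs (All.universal e xs)

Πl-* : ∀ h g xs → Πl (λ x → h x * g x) xs ≡ Πl h xs * Πl g xs
Πl-* h g []       = sym (*-idˡ 1ℚ)
Πl-* h g (x ∷ xs) = ≡.trans (cong (h x * g x *_) (Πl-* h g xs)) (*-interchange _ _ _ _)

Πl-1 : ∀ xs → Πl (λ _ → 1ℚ) xs ≡ 1ℚ
Πl-1 []       = refl
Πl-1 (x ∷ xs) = ≡.trans (*-idˡ _) (Πl-1 xs)

Πl-≢0 : ∀ {h} xs → All (λ x → h x ≢ 0ℚ) xs → Πl h xs ≢ 0ℚ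
Πl-≢0 []       []       ()
Πl-≢0 (x ∷ xs) (n ∷ ns) = *-≢0 n (Πl-≢0 xs ns)

Πl-↭ : ∀ h {xs ys} → xs ↭ ys → Πl h xs ≡ Πl h ys
Πl-↭ h refl = refl
Πl-↭ h (prep x p) = cong (h x *_) (Πl-↭ h p)
Πl-↭ h (swap x y p) =
  ≡.trans (sym (*-assoc _ _ _)) (≡.trans (cong₂ _*_ (*-comm _ _) (Πl-↭ h p)) (*-assoc _ _ _))
Πl-↭ h (trans p q) = ≡.trans (Πl-↭ h p) (Πl-↭ h q)

lead-Πl : ∀ {c : ℚ → ℚ} {h : ℚ → ℚ → ℚ} xs → (∀ x → Lead 1 (c x) (h x)) → Lead (length xs) (Πl c xs) (λ z → Πl (λ x → h x z) xs)
lead-Πl []       l = λ _ → refl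
lead-Πl {h = h} (x ∷ xs) l = lead-* 1 (length xs) (l x) (lead-Πl {h = h} xs l)

Σsplit : List ℚ → (List ℚ → List ℚ → ℚ) → ℚ
Σsplit []       f = f [] []
Σsplit (x ∷ xs) f = Σsplit xs (λ J L → f (x ∷ J) L) + Σsplit xs (λ J L → f J (x ∷ L))

-- Records which pairs `Σsplit` visits, so that summands can be compared with knowledge of how the
-- parts make up the list.
data Split : List ℚ → List ℚ → List ℚ → Set where
  []    : Split [] [] []
  left  : ∀ {x J L xs} → Split J L xs → Split (x ∷ J) L (x ∷ xs)
  right : ∀ {x J L xs} → Split J L xs → Split J (x ∷ L) (x ∷ xs)

Split-All : ∀ {P : ℚ → Set} {J L xs} → Split J L xs → All P xs → All P J × All P L
Split-All []        []       = [] , []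
Split-All (left s)  (p ∷ ps) = let a , b = Split-All s ps in p ∷ a , b
Split-All (right s) (p ∷ ps) = let a , b = Split-All s ps in a , p ∷ b

Split-length : ∀ {J L xs} → Split J L xs → length J ℕ.+ length L ≡ length xs
Split-length []                = refl
Split-length (left s)          = cong suc (Split-length s)
Split-length (right {J = J} {L} s) = ≡.trans (ℕₚ.+-suc (length J) (length L)) (cong suc (Split-length s))

Split-Πl : ∀ h {J L xs} → Split J L xs → Πl h xs ≡ Πl h J * Πl h L
Split-Πl h []        = sym (*-idˡ 1ℚ)
Split-Πl h (left s)  = ≡.trans (cong (h _ *_) (Split-Πl h s)) (sym (*-assoc _ _ _))
Split-Πl h (right {x} {J} {L} {xs} s) = begin
  h x * Πl h xs             ≡⟨ cong (h x *_) (Split-Πl h s) ⟩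
  h x * (Πl h J * Πl h L)   ≡⟨ sym (*-assoc _ _ _) ⟩
  h x * Πl h J * Πl h L     ≡⟨ cong (_* Πl h L) (*-comm _ _) ⟩
  Πl h J * h x * Πl h L     ≡⟨ *-assoc _ _ _ ⟩
  Πl h J * (h x * Πl h L)   ∎
  where open ≡-Reasoning

Σsplit-cong : ∀ xs {f g} → (∀ {J L} → Split J L xs → f J L ≡ g J L) → Σsplit xs f ≡ Σsplit xs g
Σsplit-cong []       e = e []
Σsplit-cong (x ∷ xs) e = cong₂ _+_ (Σsplit-cong xs (λ s → e (left s))) (Σsplit-cong xs (λ s → e (right s)))

Σsplit-+ : ∀ xs f g → Σsplit xs (λ J L → f J L + g J L) ≡ Σsplit xs f + Σsplit xs g
Σsplit-+ []       f g = refl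
Σsplit-+ (x ∷ xs) f g = ≡.trans (cong₂ _+_ (Σsplit-+ xs _ _) (Σsplit-+ xs _ _)) (+-interchange _ _ _ _)

Σsplit-* : ∀ xs c f → Σsplit xs (λ J L → c * f J L) ≡ c * Σsplit xs f
Σsplit-* []       c f = refl
Σsplit-* (x ∷ xs) c f = ≡.trans (cong₂ _+_ (Σsplit-* xs c _) (Σsplit-* xs c _)) (sym (*-distribˡ _ _ _))

Σsplit-0 : ∀ xs → Σsplit xs (λ _ _ → 0ℚ) ≡ 0ℚ
Σsplit-0 []       = refl
Σsplit-0 (x ∷ xs) = ≡.trans (cong₂ _+_ (Σsplit-0 xs) (Σsplit-0 xs)) (+-idˡ 0ℚ)

lead-Σsplit : ∀ xs d {c : List ℚ → List ℚ → ℚ} {f : List ℚ → List ℚ → ℚ → ℚ} → (∀ {J L} → Split J L xs → Lead d (c J L) (f J L)) →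
  Lead d (Σsplit xs c) (λ z → Σsplit xs (λ J L → f J L z))
lead-Σsplit []       d l = l []
lead-Σsplit (x ∷ xs) d {c} {f} l =
  lead-+ d (lead-Σsplit xs d {f = λ J L → f (x ∷ J) L} (λ s → l (left s)))
           (lead-Σsplit xs d {f = λ J L → f J (x ∷ L)} (λ s → l (right s)))

-- Splitting a permuted list gives the same parts in other orders; for such `f` the sum over
-- splittings does not see the order of the list.
Symmetric₂ : (List ℚ → List ℚ → ℚ) → Set
Symmetric₂ f = ∀ {J J′ L L′} → J ↭ J′ → L ↭ L′ → f J L ≡ f J′ L′

Σsplit-↭ : ∀ {f} → Symmetric₂ f → ∀ {xs ys} → xs ↭ ys → Σsplit xs f ≡ Σsplit ys f
Σsplit-↭ σ refl = refl
Σsplit-↭ σ (prep x p) = cong₂ _+_ (Σsplit-↭ (λ p q → σ (prep x p) q) p) (Σsplit-↭ (λ p q → σ p (prep x q)) p)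
Σsplit-↭ {f} σ {x ∷ y ∷ xs} {_ ∷ _ ∷ ys} (swap .x .y p) = ≡.trans (+-interchange _ _ _ _) (cong₂ _+_
  (cong₂ _+_ (≡.trans (Σsplit-cong xs {g = λ J L → f (y ∷ x ∷ J) L} (λ _ → σ (swap x y refl) refl)) (Σsplit-↭ (λ p q → σ (prep y (prep x p)) q) p))
             (Σsplit-↭ (λ p q → σ (prep y p) (prep x q)) p))
  (cong₂ _+_ (Σsplit-↭ (λ p q → σ (prep x p) (prep y q)) p)
             (≡.trans (Σsplit-cong xs {g = λ J L → f J (y ∷ x ∷ L)} (λ _ → σ refl (swap x y refl))) (Σsplit-↭ (λ p q → σ p (prep y (prep x q))) p))))
Σsplit-↭ σ (trans p q) = ≡.trans (Σsplit-↭ σ p) (Σsplit-↭ σ q)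

-- Sums over splittings with weights Π (a i - b j) / (i - j)

T : ℚ → ℚ → List ℚ → List ℚ → ℚ
T a b J L = Πl (λ i → Πl (λ j → (a * i - b * j) * inv (i - j)) L) J

T-consʳ : ∀ a b J z L → T a b J (z ∷ L) ≡ Πl (λ i → (a * i - b * z) * inv (i - z)) J * T a b J L
T-consʳ a b J z L = Πl-* _ _ J

T-↭ : ∀ a b → Symmetric₂ (T a b)
T-↭ a b {J} p q = ≡.trans (Πl-cong′ J (λ i → Πl-↭ _ q)) (Πl-↭ _ p)

∈⇒↭∷ : ∀ {c : ℚ} {xs} → c ∈ xs → ∃[ ys ] xs ↭ c ∷ ys
∈⇒↭∷ (here {xs = xs} refl) = xs , refl
∈⇒↭∷ (there {x = x} c∈xs) = let ys , p = ∈⇒↭∷ c∈xs in x ∷ ys , trans (prep x p) (swap x _ refl)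

Unique-resp-↭ : ∀ {xs ys : List ℚ} → xs ↭ ys → Unique xs → Unique ys
Unique-resp-↭ p = ↭ₛ.Unique-resp-↭ (≡.setoid ℚ) (↭⇒↭ₛ p)

-- What remains of the factors of `T` that involve `z`, after multiplication by all `z - x`, when
-- `z` joins `J`. With both pairs of arguments exchanged it serves for `z` joining `L`.
cross : ℚ → ℚ → ℚ → List ℚ → List ℚ → ℚ
cross a b z J L = Πl (λ j → a * z - b * j) L * Πl (λ i → z - i) J

-- The sum over splittings of `z ∷ xs` with the denominators involving `z` cleared. It is a genuine
-- polynomial in `z`, also where `z` is one of the `xs` and the default value of `inv` would spoil
-- the sum.
numer : (List ℚ → List ℚ → ℚ) → ℚ → ℚ → List ℚ → ℚ → ℚ
numer w a b xs z = Σsplit xs (λ J L →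
  T a b J L * (w (z ∷ J) L * cross a b z J L + w J (z ∷ L) * cross b a z L J))

cross-↭ : ∀ a b z → Symmetric₂ (cross a b z)
cross-↭ a b z p q = cong₂ _*_ (Πl-↭ _ q) (Πl-↭ _ p)

numer-↭ : ∀ {w} a b z → Symmetric₂ w → ∀ {xs ys} → xs ↭ ys → numer w a b xs z ≡ numer w a b ys z
numer-↭ a b z σ = Σsplit-↭ (λ p q → cong₂ _*_ (T-↭ a b p q)
  (cong₂ _+_ (cong₂ _*_ (σ (prep z p) q) (cross-↭ a b z p q)) (cong₂ _*_ (σ p (prep z q)) (cross-↭ b a z q p))))

opaque
  unfolding _+_

  clear-sign : ∀ a b z i v → (a * i - b * z) * v * (z - i) ≡ (b * z - a * i) * (v * (i - z))
  clear-sign = solve-∀ ringℚ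
  cross-regroupˡ : ∀ p t r s → (p * t) * (r * s) ≡ t * ((p * s) * r)
  cross-regroupˡ = solve-∀ ringℚ
  cross-regroupʳ : ∀ p t r s → (p * t) * (r * s) ≡ t * ((p * r) * s)
  cross-regroupʳ = solve-∀ ringℚ
  expand₂ : ∀ t u c v d → t * (u * c + v * d) ≡ u * (t * c) + v * (t * d)
  expand₂ = solve-∀ ringℚ
  collect₂ : ∀ u p t v s → u * (t * p) + v * (s * p) ≡ p * (u * t + v * s)
  collect₂ = solve-∀ ringℚ
  residueˡ : ∀ p t v x′ c r′ x d s r → (p * t) * (v * (x′ * ((c - c) * r′)) + x * ((d * s) * r)) ≡ x * (d * (t * (s * (p * r))))
  residueˡ = solve-∀ ringℚ
  residueʳ : ∀ p t x d q r v y′ c r′ → (p * t) * (x * ((d * q) * r) + v * (y′ * ((c - c) * r′))) ≡ x * (d * (t * (q * (p * r))))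
  residueʳ = solve-∀ ringℚ
  residues-cancel : ∀ x d e t s q → x * ((d - e) * (t * (s * q))) + x * ((e - d) * (t * (q * s))) ≡ 0ℚ
  residues-cancel = solve-∀ ringℚ

clearˡ : ∀ a b z L → All (z ≢_) L →
  Πl (λ j → (a * z - b * j) * inv (z - j)) L * Πl (λ j → z - j) L ≡ Πl (λ j → a * z - b * j) L
clearˡ a b z L z∉L = ≡.trans (sym (Πl-* _ _ L)) (Πl-cong L (All.map (λ n →
  ≡.trans (*-assoc _ _ _) (≡.trans (*-congˡ (inv-inverseˡ (x-y≢0 n))) (*-idʳ _))) z∉L))

clearʳ : ∀ a b z J → All (z ≢_) J →
  Πl (λ i → (a * i - b * z) * inv (i - z)) J * Πl (λ i → z - i) J ≡ Πl (λ i → b * z - a * i) J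
clearʳ a b z J z∉J = ≡.trans (sym (Πl-* _ _ J)) (Πl-cong J (All.map (λ n →
  ≡.trans (clear-sign a b z _ _) (≡.trans (*-congˡ (inv-inverseˡ (x-y≢0 (λ e → n (sym e))))) (*-idʳ _))) z∉J))

T-cross-left : ∀ a b z J L → All (z ≢_) L →
  T a b (z ∷ J) L * (Πl (λ i → z - i) J * Πl (λ j → z - j) L) ≡ T a b J L * cross a b z J L
T-cross-left a b z J L z∉L =
  ≡.trans (cross-regroupˡ _ _ _ _) (cong (λ u → T a b J L * (u * Πl (λ i → z - i) J)) (clearˡ a b z L z∉L))

T-cross-right : ∀ a b z J L → All (z ≢_) J →
  T a b J (z ∷ L) * (Πl (λ i → z - i) J * Πl (λ j → z - j) L) ≡ T a b J L * cross b a z L J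
T-cross-right a b z J L z∉J = ≡.trans (*-congʳ (T-consʳ a b J z L))
  (≡.trans (cross-regroupʳ _ _ _ _) (cong (λ u → T a b J L * (u * Πl (λ j → z - j) L)) (clearʳ a b z J z∉J)))

numer-Σsplit : ∀ w a b xs z → All (z ≢_) xs →
  numer w a b xs z ≡ Πl (λ x → z - x) xs * Σsplit (z ∷ xs) (λ J L → w J L * T a b J L)
numer-Σsplit w a b xs z z∉xs = begin
  numer w a b xs z
    ≡⟨ Σsplit-cong xs (λ {J} {L} s → term J L s) ⟩
  Σsplit xs (λ J L → Πl (λ x → z - x) xs * (w (z ∷ J) L * T a b (z ∷ J) L + w J (z ∷ L) * T a b J (z ∷ L)))
    ≡⟨ Σsplit-* xs _ _ ⟩
  Πl (λ x → z - x) xs * Σsplit xs (λ J L → w (z ∷ J) L * T a b (z ∷ J) L + w J (z ∷ L) * T a b J (z ∷ L))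
    ≡⟨ cong (Πl (λ x → z - x) xs *_) (Σsplit-+ xs _ _) ⟩
  Πl (λ x → z - x) xs * Σsplit (z ∷ xs) (λ J L → w J L * T a b J L)
    ∎
  where
  open ≡-Reasoning
  term : ∀ J L → Split J L xs →
    T a b J L * (w (z ∷ J) L * cross a b z J L + w J (z ∷ L) * cross b a z L J) ≡
    Πl (λ x → z - x) xs * (w (z ∷ J) L * T a b (z ∷ J) L + w J (z ∷ L) * T a b J (z ∷ L))
  term J L s with Split-All s z∉xs
  ... | z∉J , z∉L = begin
    T a b J L * (w (z ∷ J) L * cross a b z J L + w J (z ∷ L) * cross b a z L J)
      ≡⟨ expand₂ _ _ _ _ _ ⟩
    w (z ∷ J) L * (T a b J L * cross a b z J L) + w J (z ∷ L) * (T a b J L * cross b a z L J)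
      ≡⟨ cong₂ (λ u v → w (z ∷ J) L * u + w J (z ∷ L) * v) (sym (T-cross-left a b z J L z∉L)) (sym (T-cross-right a b z J L z∉J)) ⟩
    w (z ∷ J) L * (T a b (z ∷ J) L * P) + w J (z ∷ L) * (T a b J (z ∷ L) * P)
      ≡⟨ collect₂ _ _ _ _ _ ⟩
    P * (w (z ∷ J) L * T a b (z ∷ J) L + w J (z ∷ L) * T a b J (z ∷ L))
      ≡⟨ *-congʳ (sym (Split-Πl (λ x → z - x) s)) ⟩
    Πl (λ x → z - x) xs * (w (z ∷ J) L * T a b (z ∷ J) L + w J (z ∷ L) * T a b J (z ∷ L)) ∎
    where
    P : ℚ
    P = Πl (λ i → z - i) J * Πl (λ j → z - j) L

-- The residue at z = c: the terms with z and c on different sides cancel in pairs.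
numer-root : ∀ {w} a b c ys → Symmetric₂ w → All (c ≢_) ys → numer w a b (c ∷ ys) c ≡ 0ℚ
numer-root {w} a b c ys σ c∉ys =
  ≡.trans (sym (Σsplit-+ ys _ _)) (≡.trans (Σsplit-cong ys (λ {J} {L} s → term J L s)) (Σsplit-0 ys))
  where
  open ≡-Reasoning
  term : ∀ J L → Split J L ys →
      T a b (c ∷ J) L * (w (c ∷ c ∷ J) L * cross a b c (c ∷ J) L + w (c ∷ J) (c ∷ L) * cross b a c L (c ∷ J))
    + T a b J (c ∷ L) * (w (c ∷ J) (c ∷ L) * cross a b c J (c ∷ L) + w J (c ∷ c ∷ L) * cross b a c (c ∷ L) J)
    ≡ 0ℚ
  term J L s with Split-All s c∉ys
  ... | c∉J , c∉L = ≡.trans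
    (cong₂ _+_
      (≡.trans (residueˡ _ _ _ _ _ _ _ _ _ _) (cong (λ u → X * ((b * c - a * c) * (T a b J L * (Πl (λ j → b * c - a * j) J * u)))) (clearˡ a b c L c∉L)))
      (≡.trans (*-congʳ (T-consʳ a b J c L))
        (≡.trans (residueʳ _ _ _ _ _ _ _ _ _ _) (cong (λ u → X * ((a * c - b * c) * (T a b J L * (Πl (λ j → a * c - b * j) L * u)))) (clearʳ a b c J c∉J)))))
    (residues-cancel X _ _ _ _ _)
    where
    X : ℚ
    X = w (c ∷ J) (c ∷ L)

unique-++-cons : ∀ rs {xs : List ℚ} → Unique (rs ++ xs) → Unique xs
unique-++-cons []       u       = u
unique-++-cons (r ∷ rs) (_ ∷ u) = unique-++-cons rs u

-- The `xs` are nodes for free: there both sides vanish, the numerator by cancellation of residues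
-- and the product through one of its factors. Only the extra nodes `rs` need evaluations, and the
-- degree bound asks for exactly these.
interpolation : ∀ {w} a b xs rs (R : ℚ → ℚ) → Symmetric₂ w →
  Lead (length rs ℕ.+ length xs) 0ℚ (λ z → numer w a b xs z - Πl (λ x → z - x) xs * R z) →
  All (λ r → numer w a b xs r ≡ Πl (λ x → r - x) xs * R r) rs →
  Unique (rs ++ xs) → ∀ z → All (z ≢_) xs →
  Σsplit (z ∷ xs) (λ J L → w J L * T a b J L) ≡ R z
interpolation {w} a b xs rs R σ l eqs u z z∉xs =
  *-cancelˡ (Πl-≢0 xs (All.map x-y≢0 z∉xs))
    (≡.trans (sym (numer-Σsplit w a b xs z z∉xs))
      (x-y≡0 (lead-roots (rs ++ xs) (subst (λ d → Lead d 0ℚ _) (sym (Listₚ.length-++ rs)) l) u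
        (Allₚ.++⁺ (All.map (λ e → ≡.trans (cong (_- _) e) (x-x _)) eqs)
                  (All.tabulate (λ c∈xs → ≡.trans (cong₂ _-_ (numer≡0 c∈xs) (Π≡0 c∈xs)) (x-x 0ℚ)))) z)))
  where
  numer≡0 : ∀ {c} → c ∈ xs → numer w a b xs c ≡ 0ℚ
  numer≡0 {c} c∈xs with ∈⇒↭∷ c∈xs
  ... | ys , p with Unique-resp-↭ p (unique-++-cons rs u)
  ... | c∉ys ∷ _ = ≡.trans (numer-↭ a b c σ p) (numer-root a b c ys σ c∉ys)
  Π≡0 : ∀ {c} → c ∈ xs → Πl (λ x → c - x) xs * R c ≡ 0ℚ
  Π≡0 {c} c∈xs with ∈⇒↭∷ c∈xs
  ... | ys , p = ≡.trans (cong (_* R c) (≡.trans (Πl-↭ _ p) (≡.trans (*-congʳ (x-x c)) (*-zeroˡ _)))) (*-zeroˡ _)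

nonzero-induction : (C : List ℚ → Set) → C [] →
  (∀ z xs → Unique (z ∷ xs) → All (0ℚ ≢_) xs → C xs → C (z ∷ xs)) →
  ∀ xs → Unique xs → All (0ℚ ≢_) xs → C xs
nonzero-induction C base step []       _        _         = base
nonzero-induction C base step (x ∷ xs) (x∉ ∷ u) (_ ∷ 0∉) =
  step x xs (x∉ ∷ u) 0∉ (nonzero-induction C base step xs u 0∉)

-- Moving a zero to the front by a permutation, an induction over lists of
-- distinct numbers may assume that the tail is free of zeros.
distinct-induction : (C : List ℚ → Set) → (∀ {xs ys} → xs ↭ ys → C xs → C ys) → C [] →
  (∀ z xs → Unique (z ∷ xs) → All (0ℚ ≢_) xs → C xs → C (z ∷ xs)) →
  ∀ xs → Unique xs → C xs
distinct-induction C resp base step xs u with 0ℚ ∈? xs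
  where open import Data.List.Membership.DecPropositional Qₚ._≟_ using (_∈?_)
... | no 0∉xs = nonzero-induction C base step xs u (All.tabulate (λ {x} x∈xs e → 0∉xs (subst (_∈ xs) (sym e) x∈xs)))
... | yes 0∈xs with ∈⇒↭∷ 0∈xs
... | ys , p with Unique-resp-↭ p u
... | 0∉ys ∷ uys = resp (↭-sym p) (step 0ℚ ys (0∉ys ∷ uys) 0∉ys (nonzero-induction C base step ys uys 0∉ys))

-- Elementary symmetric functions

-- Coefficients after multiplying a generating function by `y`.
pre : (ℕ → ℚ) → ℕ → ℚ
pre f zero    = 0ℚ
pre f (suc m) = f m

pre-cong : ∀ {f g} → (∀ m → f m ≡ g m) → ∀ m → pre f m ≡ pre g m
pre-cong e zero    = refl
pre-cong e (suc m) = e m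

esym : List ℚ → ℕ → ℚ
esym []       zero    = 1ℚ
esym []       (suc m) = 0ℚ
esym (x ∷ xs) m       = esym xs m + x * pre (esym xs) m

-- E J L m is the coefficient of y^m in Π_{x∈J} (y x) · Π_{x∈L} (1 + y x).
E : List ℚ → List ℚ → ℕ → ℚ
E []      L m = esym L m
E (x ∷ J) L m = x * pre (E J L) m

opaque
  unfolding _+_

  swap-pre : ∀ x y f m → x * pre (λ n → y * pre f n) m ≡ y * pre (λ n → x * pre f n) m
  swap-pre x y f zero    = ≡.trans (*-zeroʳ x) (sym (*-zeroʳ y))
  swap-pre x y f (suc m) = swap-* x y (pre f m)

  esym-swap : ∀ x y xs m → esym (x ∷ y ∷ xs) m ≡ esym (y ∷ x ∷ xs) m
  esym-swap x y xs zero    = comm₀ (esym xs 0) x y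
    where
    comm₀ : ∀ e x y → e + y * 0ℚ + x * 0ℚ ≡ e + x * 0ℚ + y * 0ℚ
    comm₀ = solve-∀ ringℚ
  esym-swap x y xs (suc m) = comm₁ (esym xs (suc m)) (esym xs m) (pre (esym xs) m) x y
    where
    comm₁ : ∀ e f g x y → e + y * f + x * (f + y * g) ≡ e + x * f + y * (f + x * g)
    comm₁ = solve-∀ ringℚ

  E-consʳ-0 : ∀ x z → x * 0ℚ ≡ x * 0ℚ + z * 0ℚ
  E-consʳ-0 = solve-∀ ringℚ
  E-consʳ-suc : ∀ x z e f → x * (e + z * f) ≡ x * e + z * (x * f)
  E-consʳ-suc = solve-∀ ringℚ

esym-prep : ∀ x xs ys → (∀ m → esym xs m ≡ esym ys m) → ∀ m → esym (x ∷ xs) m ≡ esym (x ∷ ys) m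
esym-prep x _ _ e m = cong₂ (λ u v → u + x * v) (e m) (pre-cong e m)

esym-↭ : ∀ {xs ys} → xs ↭ ys → ∀ m → esym xs m ≡ esym ys m
esym-↭ refl         m = refl
esym-↭ {_ ∷ xs} {_ ∷ ys} (prep x p) m = esym-prep x xs ys (esym-↭ p) m
esym-↭ {x ∷ y ∷ xs} {_ ∷ _ ∷ ys} (swap .x .y p) m =
  ≡.trans (esym-swap x y xs m) (esym-prep y (x ∷ xs) (x ∷ ys) (esym-prep x xs ys (esym-↭ p)) m)
esym-↭ (trans p q)  m = ≡.trans (esym-↭ p m) (esym-↭ q m)

E-consʳ : ∀ J z L m → E J (z ∷ L) m ≡ E J L m + z * pre (E J L) m
E-consʳ []      z L m       = refl
E-consʳ (x ∷ J) z L zero    = E-consʳ-0 x z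
E-consʳ (x ∷ J) z L (suc m) = ≡.trans (*-congˡ (E-consʳ J z L m)) (E-consʳ-suc _ _ _ _)

E-congʳ : ∀ J {L L′} → L ↭ L′ → ∀ m → E J L m ≡ E J L′ m
E-congʳ []      q m = esym-↭ q m
E-congʳ (x ∷ J) q m = *-congˡ (pre-cong (E-congʳ J q) m)

E-congˡ : ∀ {J J′} L → J ↭ J′ → ∀ m → E J L m ≡ E J′ L m
E-congˡ L refl        m = refl
E-congˡ L (prep x p)  m = *-congˡ (pre-cong (E-congˡ L p) m)
E-congˡ L (swap x y p) m = ≡.trans (*-congˡ (pre-cong (λ n → *-congˡ (pre-cong (E-congˡ L p) n)) m)) (swap-pre x y _ m)
E-congˡ L (trans p q) m = ≡.trans (E-congˡ L p m) (E-congˡ L q m)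

E-↭ : ∀ m → Symmetric₂ (λ J L → E J L m)
E-↭ m {J} {J′} {L} p q = ≡.trans (E-congˡ L p m) (E-congʳ J′ q m)

-- Degrees of the interpolated polynomials

Split-swap : ∀ {J L xs} → Split J L xs → Split L J xs
Split-swap []        = []
Split-swap (left s)  = right (Split-swap s)
Split-swap (right s) = left (Split-swap s)

opaque
  unfolding _+_

  lead-ℓ : ∀ a c → Lead 1 a (λ z → a * z - c)
  lead-ℓ a c = lead-cong 1 refl (λ z → arrange a c z) (lead-lin (- c) a)
    where
    arrange : ∀ a c z → - c + z * a ≡ a * z - c
    arrange = solve-∀ ringℚ

  lead-z- : ∀ x → Lead 1 1ℚ (λ z → z - x)
  lead-z- x = lead-cong 1 refl (λ z → arrange x z) (lead-lin (- x) 1ℚ)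
    where
    arrange : ∀ x z → - x + z * 1ℚ ≡ z - x
    arrange = solve-∀ ringℚ

  lead-- : ∀ d {c c′ f g} → Lead d c f → Lead d c′ g → Lead d (c - c′) (λ z → f z - g z)
  lead-- d {c} {c′} {f} {g} l l′ = lead-cong d (minus c c′) (λ z → minus (f z) (g z)) (lead-+ d l (lead-scale d (- 1ℚ) l′))
    where
    minus : ∀ a b → a + - 1ℚ * b ≡ a - b
    minus = solve-∀ ringℚ

lead-cross : ∀ a b {J L xs} → Split J L xs → Lead (length xs) (Πl (λ _ → a) L) (λ z → cross a b z J L)
lead-cross a b {J} {L} s = subst (λ d → Lead d (Πl (λ _ → a) L) (λ z → cross a b z J L))
  (≡.trans (ℕₚ.+-comm (length L) (length J)) (Split-length s))
  (lead-cong (length L ℕ.+ length J) (≡.trans (*-congˡ (Πl-1 J)) (*-idʳ _)) (λ _ → refl)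
    (lead-* (length L) (length J) (lead-Πl {h = λ j z → a * z - b * j} L (λ j → lead-ℓ a (b * j)))
            (lead-Πl {h = λ i z → z - i} J lead-z-)))

lead-Πz- : ∀ xs → Lead (length xs) 1ℚ (λ z → Πl (λ x → z - x) xs)
lead-Πz- xs = lead-cong (length xs) (Πl-1 xs) (λ _ → refl) (lead-Πl {h = λ x z → z - x} xs lead-z-)

opaque
  unfolding _+_

  pull-t : ∀ t j → 1ℚ * 0ℚ - t * j ≡ t * (0ℚ - j)
  pull-t = solve-∀ ringℚ
  drop-s : ∀ s i → s * 0ℚ - 1ℚ * i ≡ 0ℚ - i
  drop-s = solve-∀ ringℚ
  *-regroup : ∀ p q r → p * q * r ≡ p * (r * q)
  *-regroup = solve-∀ ringℚ
  HL-lead : ∀ t p → t * (p * 1ℚ + 0ℚ) ≡ p * t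
  HL-lead = solve-∀ ringℚ
  HL-root : ∀ t p c e d → t * ((0ℚ * p) * c + e * d) ≡ d * (e * t)
  HL-root = solve-∀ ringℚ
  x+0y : ∀ x y → x ≡ x + 0ℚ * y
  x+0y = solve-∀ ringℚ

cross-0ˡ : ∀ t J L → cross 1ℚ t 0ℚ J L ≡ Πl (λ _ → t) L * (Πl (λ i → 0ℚ - i) J * Πl (λ j → 0ℚ - j) L)
cross-0ˡ t J L = ≡.trans (*-congʳ (≡.trans (Πl-cong′ L (pull-t t)) (Πl-* (λ _ → t) _ L))) (*-regroup _ _ _)

cross-0ʳ : ∀ s J L → cross s 1ℚ 0ℚ L J ≡ Πl (λ i → 0ℚ - i) J * Πl (λ j → 0ℚ - j) L
cross-0ʳ s J L = *-congʳ (Πl-cong′ J (drop-s s))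

-- Both sides are compared as polynomials in the new variable. The top coefficients agree by the
-- statement for `m - 1` and the values at 0 by the statement for `m`, whence the quantifier over
-- `m` inside `C`.
hall-littlewood : ∀ s xs → Unique xs → ∀ m →
  Σsplit xs (λ K L → E K [] m * T 1ℚ s K L) ≡ esym xs m
hall-littlewood s = distinct-induction C resp base step
  where
  C : List ℚ → Set
  C xs = ∀ m → Σsplit xs (λ K L → E K [] m * T 1ℚ s K L) ≡ esym xs m
  w-↭ : ∀ m → Symmetric₂ (λ K _ → E K [] m)
  w-↭ m p _ = E-↭ m p refl
  resp : ∀ {xs ys} → xs ↭ ys → C xs → C ys
  resp p c m = ≡.trans (Σsplit-↭ (λ p q → cong₂ _*_ (w-↭ m p q) (T-↭ 1ℚ s p q)) (↭-sym p)) (≡.trans (c m) (esym-↭ p m))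
  base : C []
  base m = *-idʳ _
  step : ∀ z xs → Unique (z ∷ xs) → All (0ℚ ≢_) xs → C xs → C (z ∷ xs)
  step z xs (z∉ ∷ u) 0∉ ih m = interpolation 1ℚ s xs (0ℚ ∷ []) R (w-↭ m)
    (lead-cong (suc (length xs)) (≡.trans (cong₂ _-_ top (*-idʳ _)) (x-x _)) (λ _ → refl)
      (lead-- (suc (length xs)) lead-numer
        (lead-cong (suc (length xs)) refl (λ _ → *-comm _ _) (lead-* 1 (length xs) (lead-lin (esym xs m) (pre (esym xs) m)) (lead-Πz- xs)))))
    (root ∷ []) (0∉ ∷ u) z z∉
    where
    R : ℚ → ℚ
    R z = esym xs m + z * pre (esym xs) m
    lead-numer : Lead (suc (length xs)) (Σsplit xs (λ J L → T 1ℚ s J L * (pre (E J []) m * 1ℚ + 0ℚ)))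
                      (numer (λ K _ → E K [] m) 1ℚ s xs)
    lead-numer = lead-Σsplit xs (suc (length xs)) (λ {J} {L} sp → lead-scale (suc (length xs)) (T 1ℚ s J L)
      (lead-+ (suc (length xs))
        (lead-cong (suc (length xs)) (*-congˡ (Πl-1 L)) (λ _ → sym (*-assoc _ _ _))
          (lead-shift (length xs) (lead-scale (length xs) (pre (E J []) m) (lead-cross 1ℚ s sp))))
        (lead-raise (length xs) (lead-scale (length xs) (E J [] m) (lead-cross s 1ℚ (Split-swap sp))))))
    top : Σsplit xs (λ J L → T 1ℚ s J L * (pre (E J []) m * 1ℚ + 0ℚ)) ≡ pre (esym xs) m
    top = ≡.trans (Σsplit-cong xs (λ _ → HL-lead _ _)) (pre-ih m)
      where
      pre-ih : ∀ m → Σsplit xs (λ J L → pre (E J []) m * T 1ℚ s J L) ≡ pre (esym xs) m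
      pre-ih zero    = ≡.trans (Σsplit-cong xs (λ _ → *-zeroˡ _)) (Σsplit-0 xs)
      pre-ih (suc m) = ih m
    -- A 0 in the first part annihilates `E`, so only splittings with 0 in the second part survive.
    root : numer (λ K _ → E K [] m) 1ℚ s xs 0ℚ ≡ Πl (λ x → 0ℚ - x) xs * R 0ℚ
    root = ≡.trans
      (Σsplit-cong xs (λ {J} {L} sp → ≡.trans (HL-root _ _ _ _ _)
        (*-congʳ (≡.trans (cross-0ʳ s J L) (sym (Split-Πl (λ x → 0ℚ - x) sp))))))
      (≡.trans (Σsplit-* xs _ _) (*-congˡ (≡.trans (ih m) (x+0y _ _))))

-- κ s t J = (-s)^l t^(l choose 2) for l = |J|
κ : ℚ → ℚ → List ℚ → ℚ
κ s t []      = 1ℚ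
κ s t (_ ∷ J) = - s * Πl (λ _ → t) J * κ s t J

κ-↭ : ∀ s t {J J′} → J ↭ J′ → κ s t J ≡ κ s t J′
κ-↭ s t refl         = refl
κ-↭ s t (prep x p)   = cong₂ (λ u v → - s * u * v) (Πl-↭ _ p) (κ-↭ s t p)
κ-↭ s t (swap x y p) = cong₂ (λ u v → - s * (t * u) * (- s * u * v)) (Πl-↭ _ p) (κ-↭ s t p)
κ-↭ s t (trans p q)  = ≡.trans (κ-↭ s t p) (κ-↭ s t q)

opaque
  unfolding _+_

  Q-root : ∀ x tJ k tL Π → x * ((- 1ℚ * tJ * k) * (tL * Π) + k * Π) ≡ ((1ℚ - tJ * tL) * Π) * (k * x)
  Q-root = solve-∀ ringℚ
  Q-empty : ∀ p → ((1ℚ - 1ℚ) * p) * (1ℚ * 1ℚ) ≡ 0ℚ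
  Q-empty = solve-∀ ringℚ

-- The t-binomial sum Σ (-1)^l t^(l choose 2) [N choose l] = Π (1 - t^i) over i < N, whose factor
-- for i = 0 is 0. Evaluation at 0 peels off the factors from the largest i on; the empty list
-- leaves 1 - 1.
alternating-sum≡0 : ∀ t v vs → Unique (v ∷ vs) → All (0ℚ ≢_) (v ∷ vs) →
  Σsplit (v ∷ vs) (λ K L → κ 1ℚ t K * T 1ℚ t K L) ≡ 0ℚ
alternating-sum≡0 t v vs (v∉ ∷ u) (_ ∷ 0∉) = interpolation 1ℚ t vs (0ℚ ∷ []) (λ _ → 0ℚ) (λ p _ → κ-↭ 1ℚ t p)
  (lead-cong (suc (length vs)) (≡.trans (cong₂ _-_ (≡.trans (Σsplit-cong vs (λ _ → ≡.trans (*-congˡ (+-idˡ 0ℚ)) (*-zeroʳ _))) (Σsplit-0 vs)) refl) (x-x 0ℚ)) (λ _ → refl)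
    (lead-- (suc (length vs)) lead-numer
      (lead-raise (length vs) (lead-cong (length vs) refl (λ _ → *-comm _ _) (lead-scale (length vs) 0ℚ (lead-Πz- vs))))))
  (root vs u 0∉ ∷ []) (0∉ ∷ u) v v∉
  where
  -- Every summand has degree at most `length vs`, so the next coefficient is 0 without cancellation
  -- and 0 is the only extra node.
  lead-numer : Lead (suc (length vs)) (Σsplit vs (λ J L → T 1ℚ t J L * (0ℚ + 0ℚ))) (numer (λ K _ → κ 1ℚ t K) 1ℚ t vs)
  lead-numer = lead-Σsplit vs (suc (length vs)) (λ {J} {L} sp → lead-scale (suc (length vs)) (T 1ℚ t J L)
    (lead-+ (suc (length vs))
      (lead-raise (length vs) (lead-scale (length vs) _ (lead-cross 1ℚ t sp)))
      (lead-raise (length vs) (lead-scale (length vs) _ (lead-cross t 1ℚ (Split-swap sp))))))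
  root : ∀ vs → Unique vs → All (0ℚ ≢_) vs → numer (λ K _ → κ 1ℚ t K) 1ℚ t vs 0ℚ ≡ Πl (λ x → 0ℚ - x) vs * 0ℚ
  root vs u 0∉ = ≡.trans
    (Σsplit-cong vs (λ {J} {L} sp → ≡.trans (*-congˡ (cong₂ (λ a b → (- 1ℚ * Πl (λ _ → t) J * κ 1ℚ t J) * a + κ 1ℚ t J * b) (cross-0ˡ t J L) (cross-0ʳ t J L)))
      (≡.trans (Q-root _ _ _ _ _) (*-congʳ (cong₂ (λ a b → (1ℚ - a) * b) (sym (Split-Πl (λ _ → t) sp)) (sym (Split-Πl (λ x → 0ℚ - x) sp)))))))
    (≡.trans (Σsplit-* vs _ _) (≡.trans (vanish vs u 0∉) (sym (*-zeroʳ _))))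
    where
    vanish : ∀ vs → Unique vs → All (0ℚ ≢_) vs →
      ((1ℚ - Πl (λ _ → t) vs) * Πl (λ x → 0ℚ - x) vs) * Σsplit vs (λ K L → κ 1ℚ t K * T 1ℚ t K L) ≡ 0ℚ
    vanish []       _ _ = Q-empty _
    vanish (v ∷ vs) u n = ≡.trans (*-congˡ (alternating-sum≡0 t v vs u n)) (*-zeroʳ _)

-- The identity in n variables x and k variables v

V : List ℚ → ℚ → ℚ
V vs x = Πl (λ v → v - x) vs

X : List ℚ → ℚ → ℚ
X xs v = Πl (λ x → v - x) xs

X∅ : ℚ → List ℚ → ℚ → ℚ
X∅ t xs v = Πl (λ x → v - t * x) xs

weight : ℚ → ℚ → List ℚ → ℕ → List ℚ → List ℚ → ℚ
weight s t vs m J L = κ s t J * E J L m * (Πl (V vs) J * Πl (λ x → V vs (t * x)) L)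

lhs-sum : ℚ → ℚ → List ℚ → ℕ → List ℚ → ℚ
lhs-sum s t vs m xs = Σsplit xs (λ J L → weight s t vs m J L * T t 1ℚ J L)

dual-weight : ℚ → List ℚ → List ℚ → List ℚ → ℚ
dual-weight t xs K L = κ 1ℚ t K * (Πl (X xs) K * Πl (X∅ t xs) L)

rhs-sum : ℚ → List ℚ → List ℚ → ℚ
rhs-sum t xs vs = Πl (λ v → v) vs * Σsplit vs (λ K L → dual-weight t xs K L * T 1ℚ t K L)

-- The value of lhs-sum for m = |vs| + p.
target : ℚ → ℕ → List ℚ → List ℚ → ℚ
target t zero    xs vs = rhs-sum t xs vs
target t (suc p) xs vs = 0ℚ

weight-↭ : ∀ s t vs m → Symmetric₂ (weight s t vs m)
weight-↭ s t vs m p q = cong₂ _*_ (cong₂ _*_ (κ-↭ s t p) (E-↭ m p q)) (cong₂ _*_ (Πl-↭ _ p) (Πl-↭ _ q))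

weight-vs-↭ : ∀ s t {vs ws} m J L → vs ↭ ws → weight s t vs m J L ≡ weight s t ws m J L
weight-vs-↭ s t m J L p = *-congˡ (cong₂ _*_ (Πl-cong′ J (λ _ → Πl-↭ _ p)) (Πl-cong′ L (λ _ → Πl-↭ _ p)))

lhs-sum-↭ : ∀ s t vs m {xs ys} → xs ↭ ys → lhs-sum s t vs m xs ≡ lhs-sum s t vs m ys
lhs-sum-↭ s t vs m = Σsplit-↭ (λ p q → cong₂ _*_ (weight-↭ s t vs m p q) (T-↭ t 1ℚ p q))

target-xs-↭ : ∀ t p {xs ys} vs → xs ↭ ys → target t p xs vs ≡ target t p ys vs
target-xs-↭ t zero    vs q = *-congˡ (Σsplit-cong vs (λ {K} {L} _ →
  *-congʳ (*-congˡ (cong₂ _*_ (Πl-cong′ K (λ _ → Πl-↭ _ q)) (Πl-cong′ L (λ _ → Πl-↭ _ q))))))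
target-xs-↭ t (suc p) vs q = refl

target-vs-↭ : ∀ t p xs {vs ws} → vs ↭ ws → target t p xs vs ≡ target t p xs ws
target-vs-↭ t zero    xs q = cong₂ _*_ (Πl-↭ _ q) (Σsplit-↭ (λ p q →
  cong₂ _*_ (cong₂ _*_ (κ-↭ 1ℚ t p) (cong₂ _*_ (Πl-↭ _ p) (Πl-↭ _ q))) (T-↭ 1ℚ t p q)) q)
target-vs-↭ t (suc p) xs q = refl

opaque
  unfolding _+_

  κ-step : ∀ s t P k → - s * P * k * (t * P) ≡ - (s * t) * P * (k * P)
  κ-step = solve-∀ ringℚ
  base₁ : 1ℚ * 1ℚ * (1ℚ * 1ℚ) * 1ℚ ≡ 1ℚ * ((1ℚ * (1ℚ * 1ℚ)) * 1ℚ)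
  base₁ = refl
  base₀ : 1ℚ * 0ℚ * (1ℚ * 1ℚ) * 1ℚ ≡ 0ℚ
  base₀ = refl
  unit-weight : ∀ k x → k * (1ℚ * 1ℚ) * x ≡ k * x
  unit-weight = solve-∀ ringℚ

  lead-arrangeˡ : ∀ s tJ k z p VJ VL Vz c →
    z * ((- s * tJ * k * p * (VJ * VL)) * (Vz * c)) ≡ (- s * tJ * k) * (z * p) * ((Vz * VJ) * VL) * c
  lead-arrangeˡ = solve-∀ ringℚ
  lead-arrangeʳ : ∀ k e VJ VL Vz c → e * ((k * (VJ * VL)) * (Vz * c)) ≡ k * e * (VJ * (Vz * VL)) * c
  lead-arrangeʳ = solve-∀ ringℚ
  lead-cancel : ∀ T s tJ k p VJ VL n tL →
    T * ((- s * tJ * k * p * (VJ * VL)) * (n * tL) + p * ((k * (VJ * VL)) * ((n * (s * (tJ * tL))) * 1ℚ))) ≡ 0ℚ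
  lead-cancel = solve-∀ ringℚ
  -1*t : ∀ t → - t ≡ - 1ℚ * t
  -1*t = solve-∀ ringℚ

  root-0 : ∀ T k′ p VJ VL V0 c k e v tJ LJ →
    T * (k′ * (0ℚ * p) * ((V0 * VJ) * VL) * c + k * (e + 0ℚ * p) * (VJ * (v * VL)) * (tJ * LJ))
    ≡ (LJ * v) * ((k * tJ) * e * (VJ * VL) * T)
  root-0 = solve-∀ ringℚ
  root-v : ∀ T k′ e′ v V′ VJ VL c k e p VtJ′ VtL′ W RJ RL SJ SL →
    T * (k′ * e′ * ((((v - v) * V′) * VJ) * VL) * c + k * (e + v * p) * ((SJ * VtJ′) * (W * (RL * VtL′))) * (RJ * SL))
    ≡ ((SJ * SL) * (W * (RJ * RL))) * (k * e * (VtJ′ * VtL′) * T + v * (k * p * (VtJ′ * VtL′) * T))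
  root-v = solve-∀ ringℚ
  rhs-0 : ∀ k vK XK vL XL T → k * ((vK * XK) * (vL * XL)) * T ≡ (vK * vL) * (k * (XK * XL) * T)
  rhs-0 = solve-∀ ringℚ
  rhs-vˡ : ∀ k v x XK XL T → k * ((((v - v) * x) * XK) * XL) * T ≡ 0ℚ
  rhs-vˡ = solve-∀ ringℚ
  rhs-vʳ : ∀ k SK XK c Xv SL XL P T →
    k * ((SK * XK) * ((c * Xv) * (SL * XL))) * (P * T) ≡ (c * ((P * SK) * SL) * Xv) * (k * (XK * XL) * T)
  rhs-vʳ = solve-∀ ringℚ
  rhs-v-final : ∀ v v′ W Xv S Π → Π * ((v * v′) * (0ℚ + (W * Xv) * S)) ≡ (Π * (W * Xv)) * (0ℚ + v * (v′ * S))
  rhs-v-final = solve-∀ ringℚ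
  lin : ∀ v a z → v + z * - a ≡ v - a * z
  lin = solve-∀ ringℚ
  v-0 : ∀ v → v - 0ℚ ≡ v
  v-0 = solve-∀ ringℚ
  v-t0 : ∀ t v → v - t * 0ℚ ≡ v
  v-t0 = solve-∀ ringℚ
  1*v-ti : ∀ t v i → 1ℚ * v - t * i ≡ v - t * i
  1*v-ti = solve-∀ ringℚ
  zero-final : ∀ Π v → Π * v * 0ℚ ≡ Π * 0ℚ
  zero-final = solve-∀ ringℚ
  zero-final′ : ∀ Π v → Π * (0ℚ + v * 0ℚ) ≡ 0ℚ
  zero-final′ = solve-∀ ringℚ

-- Evaluation at `z = 0` leaves a factor t^|J|; absorbing it turns `s` into `s * t`, which keeps the
-- constraint of `Claim` when one variable is lost.
κ-scale : ∀ s t J → κ s t J * Πl (λ _ → t) J ≡ κ (s * t) t J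
κ-scale s t []      = *-idˡ 1ℚ
κ-scale s t (x ∷ J) = ≡.trans (κ-step s t _ _) (*-congˡ (κ-scale s t J))

-- Together with distinctness of the `xs` and absence of 0 among them, this makes 0, the `vs` and
-- the `xs` distinct interpolation nodes.
Admissible : List ℚ → List ℚ → Set
Admissible vs xs = Unique vs × All (0ℚ ≢_) vs × All (λ v → All (v ≢_) xs) vs

-- `s`, the points and the excess are quantified because the step calls the hypothesis with `s * t`
-- at the node 0, and with one point fewer at a node `v`, there with excess `p + 1` as well as `p`.
Claim : ℚ → List ℚ → Set
Claim t xs = ∀ s vs p → s * Πl (λ _ → t) xs ≡ t * Πl (λ _ → t) vs → Admissible vs xs →
  lhs-sum s t vs (length vs ℕ.+ p) xs ≡ target t p xs vs

claim-resp : ∀ t {xs ys} → xs ↭ ys → Claim t xs → Claim t ys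
claim-resp t q c s vs p st (uv , 0∉ , d) =
  ≡.trans (lhs-sum-↭ s t vs _ (↭-sym q))
    (≡.trans (c s vs p (≡.trans (*-congˡ (Πl-↭ _ q)) st) (uv , 0∉ , All.map (All-resp-↭ (↭-sym q)) d))
      (target-xs-↭ t p vs q))

rhs-sum-[] : ∀ t vs → Σsplit vs (λ K L → dual-weight t [] K L * T 1ℚ t K L) ≡ Σsplit vs (λ K L → κ 1ℚ t K * T 1ℚ t K L)
rhs-sum-[] t vs = Σsplit-cong vs (λ {K} {L} _ →
  ≡.trans (*-congʳ (*-congˡ (cong₂ _*_ (Πl-1 K) (Πl-1 L)))) (unit-weight _ _))

-- Without variables only the empty splitting remains, and `E` is nonzero only in degree 0. For
-- nonempty `vs` and excess 0 the dual sum must therefore vanish by itself.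
claim-base : ∀ t → Claim t []
claim-base t s []       zero    st _ = base₁
claim-base t s []       (suc p) st _ = base₀
claim-base t s (v ∷ vs) (suc p) st _ = base₀
claim-base t s (v ∷ vs) zero    st (u , 0∉ , _) = ≡.trans base₀
  (sym (≡.trans (*-congˡ (≡.trans (rhs-sum-[] t (v ∷ vs)) (alternating-sum≡0 t v vs u 0∉))) (*-zeroʳ _)))

lead-V : ∀ a vs → Lead (length vs) (Πl (λ _ → - a) vs) (λ z → V vs (a * z))
lead-V a vs = lead-Πl {h = λ v z → v - a * z} vs (λ v → lead-cong 1 refl (λ z → lin v a z) (lead-lin v (- a)))

lead-V₁ : ∀ vs → Lead (length vs) (Πl (λ _ → - 1ℚ) vs) (λ z → V vs z)
lead-V₁ vs = lead-cong (length vs) refl (λ z → Πl-cong′ vs (λ v → cong (λ u → v - u) (*-idˡ z))) (lead-V 1ℚ vs)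

-- The bound k on the degree puts the product with the `z - x` one below the critical degree of the
-- numerator, so the coefficient itself can stay existential.
lead-target : ∀ t p xs vs → ∃[ c ] Lead (length vs) c (λ z → target t p (z ∷ xs) vs)
lead-target t (suc p) xs vs = _ , lead-cong (length vs) refl (λ _ → *-zeroˡ _) (lead-scale (length vs) 0ℚ (lead-V₁ vs))
lead-target t zero    xs vs = _ , lead-scale (length vs) (Πl (λ v → v) vs)
  (lead-Σsplit vs (length vs) {f = λ K L z → dual-weight t (z ∷ xs) K L * T 1ℚ t K L} (λ {K} {L} sp →
    lead-cong (length vs) refl (λ _ → *-comm _ _)
      (lead-scale (length vs) (T 1ℚ t K L)
        (lead-scale (length vs) (κ 1ℚ t K)
          (subst (λ d → Lead d (leading K L) (λ z → Πl (X (z ∷ xs)) K * Πl (X∅ t (z ∷ xs)) L)) (Split-length sp)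
            (lead-* (length K) (length L)
              (lead-Πl {h = λ v z → X (z ∷ xs) v} K (λ v → factor v 1ℚ (X xs v) (λ z → cong (λ u → v - u) (*-idˡ z))))
              (lead-Πl {h = λ v z → X∅ t (z ∷ xs) v} L (λ v → factor v t (X∅ t xs v) (λ _ → refl)))))))))
  where
  leading : List ℚ → List ℚ → ℚ
  leading K L = Πl (λ v → X xs v * - 1ℚ) K * Πl (λ v → X∅ t xs v * - t) L
  factor : ∀ v a c {g : ℚ → ℚ} → (∀ z → v - a * z ≡ g z) → Lead 1 (c * - a) (λ z → g z * c)
  factor v a c e = lead-cong 1 refl (λ z → ≡.trans (*-comm _ _) (*-congʳ (≡.trans (lin v a z) (e z)))) (lead-scale 1 c (lead-lin v (- a)))

module Step (t : ℚ) (t≢0 : t ≢ 0ℚ) (z : ℚ) (xs : List ℚ) (u : Unique (z ∷ xs)) (0∉xs : All (0ℚ ≢_) xs) (ih : Claim t xs)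
            (s : ℚ) (vs : List ℚ) (p : ℕ) (st : s * Πl (λ _ → t) (z ∷ xs) ≡ t * Πl (λ _ → t) vs) (adm : Admissible vs (z ∷ xs)) where

  k n d m : ℕ
  k = length vs
  n = length xs
  -- The number of nodes: 0, the k points of `vs` and the n entries of `xs`.
  d = suc (k ℕ.+ n)
  m = k ℕ.+ p

  st′ : s * Πl (λ _ → t) xs ≡ Πl (λ _ → t) vs
  st′ = *-cancelˡ t≢0 (≡.trans (sym (swap-* s t _)) st)

  N : ℚ → ℚ
  N = numer (weight s t vs m) t 1ℚ xs

  lead-N : Lead d (Σsplit xs (λ J L → T t 1ℚ J L *
      ((- s * Πl (λ _ → t) J * κ s t J * pre (E J L) m * (Πl (V vs) J * Πl (λ x → V vs (t * x)) L)) * (Πl (λ _ → - 1ℚ) vs * Πl (λ _ → t) L)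
      + pre (E J L) m * ((κ s t J * (Πl (V vs) J * Πl (λ x → V vs (t * x)) L)) * (Πl (λ _ → - t) vs * Πl (λ _ → 1ℚ) J))))) N
  lead-N = lead-Σsplit xs d (λ {J} {L} sp → lead-scale d (T t 1ℚ J L) (lead-+ d
    (lead-cong d refl (λ z → lead-arrangeˡ s _ _ z _ _ _ _ _)
      (lead-shift (k ℕ.+ n) (lead-scale (k ℕ.+ n) _ (lead-* k n (lead-V₁ vs) (lead-cross t 1ℚ sp)))))
    (lead-cong d refl (λ z → ≡.trans (lead-arrangeʳ _ _ _ _ _ _) (*-congʳ (*-congʳ (*-congˡ (sym (E-consʳ J z L m))))))
      (lead-* 1 (k ℕ.+ n) (lead-lin (E J L m) (pre (E J L) m))
        (lead-scale (k ℕ.+ n) _ (lead-* k n (lead-V t vs) (lead-cross 1ℚ t (Split-swap sp))))))))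

  -- Up to a common factor, the term with `z` in `J` contributes -s t^n to the top coefficient and
  -- the term with `z` in `L` contributes t^k. By `st′` they cancel for each splitting separately.
  lead-N≡0 : Lead d 0ℚ N
  lead-N≡0 = lead-cong d (≡.trans (Σsplit-cong xs (λ {J} {L} sp →
    ≡.trans (*-congˡ (+-congˡ (*-congˡ (*-congˡ (cong₂ _*_
        (≡.trans (Πl-cong′ vs (λ _ → -1*t t)) (≡.trans (Πl-* _ _ vs) (*-congˡ (≡.trans (sym st′) (*-congˡ (Split-Πl _ sp))))))
        (Πl-1 J))))))
      (lead-cancel _ _ _ _ _ _ _ _ _))) (Σsplit-0 xs)) (λ _ → refl) lead-N

  lead-diff : Lead d 0ℚ (λ z → N z - Πl (λ x → z - x) xs * target t p (z ∷ xs) vs)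
  lead-diff = lead-cong d (x-x 0ℚ) (λ _ → refl) (lead-- d lead-N≡0
    (lead-raise (k ℕ.+ n) (lead-cong (k ℕ.+ n) refl (λ _ → *-comm _ _) (lead-* k n (proj₂ (lead-target t p xs vs)) (lead-Πz- xs)))))

  -- With 0 in `J` the weight has the factor 0. With 0 in `L` the `cross` factor supplies t^|J|, and
  -- `V vs` at 0 is the product of the points, which is also what the variable 0 contributes to
  -- every dual term.
  root₀ : N 0ℚ ≡ Πl (λ x → 0ℚ - x) xs * target t p (0ℚ ∷ xs) vs
  root₀ = begin
    N 0ℚ
      ≡⟨ Σsplit-cong xs term ⟩
    Σsplit xs (λ J L → (Πl (λ x → 0ℚ - x) xs * Πl (λ v → v) vs) * (weight (s * t) t vs m J L * T t 1ℚ J L))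
      ≡⟨ Σsplit-* xs _ _ ⟩
    (Πl (λ x → 0ℚ - x) xs * Πl (λ v → v) vs) * lhs-sum (s * t) t vs m xs
      ≡⟨ *-congˡ (ih (s * t) vs p (≡.trans (*-assoc _ _ _) st) (proj₁ adm , proj₁ (proj₂ adm) , All.map All.tail (proj₂ (proj₂ adm)))) ⟩
    (Πl (λ x → 0ℚ - x) xs * Πl (λ v → v) vs) * target t p xs vs
      ≡⟨ target-0 p ⟩
    Πl (λ x → 0ℚ - x) xs * target t p (0ℚ ∷ xs) vs ∎
    where
    open ≡-Reasoning
    term : ∀ {J L} → Split J L xs →
      T t 1ℚ J L * (weight s t vs m (0ℚ ∷ J) L * cross t 1ℚ 0ℚ J L + weight s t vs m J (0ℚ ∷ L) * cross 1ℚ t 0ℚ L J)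
      ≡ (Πl (λ x → 0ℚ - x) xs * Πl (λ v → v) vs) * (weight (s * t) t vs m J L * T t 1ℚ J L)
    term {J} {L} sp = begin
      T t 1ℚ J L * (weight s t vs m (0ℚ ∷ J) L * cross t 1ℚ 0ℚ J L + weight s t vs m J (0ℚ ∷ L) * cross 1ℚ t 0ℚ L J)
        ≡⟨ *-congˡ (+-congˡ (cong₂ _*_
             (cong₂ _*_ (*-congˡ (E-consʳ J 0ℚ L m)) (*-congˡ (*-congʳ (Πl-cong′ vs (λ v → v-t0 t v)))))
             (cross-0ˡ t L J))) ⟩
      T t 1ℚ J L * (weight s t vs m (0ℚ ∷ J) L * cross t 1ℚ 0ℚ J L + κ s t J * (E J L m + 0ℚ * pre (E J L) m)
        * (Πl (V vs) J * (Πl (λ v → v) vs * Πl (λ x → V vs (t * x)) L)) * (Πl (λ _ → t) J * (Πl (λ x → 0ℚ - x) L * Πl (λ x → 0ℚ - x) J)))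
        ≡⟨ root-0 _ _ _ _ _ _ _ _ _ _ _ _ ⟩
      ((Πl (λ x → 0ℚ - x) L * Πl (λ x → 0ℚ - x) J) * Πl (λ v → v) vs)
        * ((κ s t J * Πl (λ _ → t) J) * E J L m * (Πl (V vs) J * Πl (λ x → V vs (t * x)) L) * T t 1ℚ J L)
        ≡⟨ cong₂ _*_ (*-congʳ (sym (Split-Πl (λ x → 0ℚ - x) (Split-swap sp)))) (*-congʳ (*-congʳ (*-congʳ (κ-scale s t J)))) ⟩
      (Πl (λ x → 0ℚ - x) xs * Πl (λ v → v) vs) * (weight (s * t) t vs m J L * T t 1ℚ J L) ∎
    target-0 : ∀ p → (Πl (λ x → 0ℚ - x) xs * Πl (λ v → v) vs) * target t p xs vs ≡ Πl (λ x → 0ℚ - x) xs * target t p (0ℚ ∷ xs) vs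
    target-0 (suc p) = zero-final _ _
    target-0 zero    = ≡.trans (*-assoc _ _ _) (*-congˡ (*-congˡ (sym (≡.trans (Σsplit-cong vs dual-term) (Σsplit-* vs _ _)))))
      where
      dual-term : ∀ {K L} → Split K L vs → dual-weight t (0ℚ ∷ xs) K L * T 1ℚ t K L ≡ Πl (λ v → v) vs * (dual-weight t xs K L * T 1ℚ t K L)
      dual-term {K} {L} sp = ≡.trans
        (cong (λ e → κ 1ℚ t K * e * T 1ℚ t K L) (cong₂ _*_
          (≡.trans (Πl-* _ _ K) (*-congʳ (Πl-cong′ K v-0))) (≡.trans (Πl-* _ _ L) (*-congʳ (Πl-cong′ L (v-t0 t))))))
        (≡.trans (rhs-0 _ _ _ _ _ _) (*-congʳ (sym (Split-Πl (λ v → v) sp))))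

  -- The factor `v - v` of `V (v ∷ vs) v` removes the terms with `v` in `J`. In the others
  -- `E J (v ∷ L)` splits in two: measured against the remaining points, one half has excess `p + 1`
  -- and vanishes by hypothesis, the other has excess `p`.
  rootᵥ′ : ∀ v vs p → Admissible (v ∷ vs) xs → s * Πl (λ _ → t) xs ≡ Πl (λ _ → t) (v ∷ vs) →
    numer (weight s t (v ∷ vs) (suc (length vs ℕ.+ p))) t 1ℚ xs v ≡ Πl (λ x → v - x) xs * target t p (v ∷ xs) (v ∷ vs)
  rootᵥ′ v vs p (v∉ ∷ uvs , _ ∷ 0∉ , v∉xs ∷ vs∉xs) st = begin
    numer (weight s t (v ∷ vs) (suc m′)) t 1ℚ xs v
      ≡⟨ Σsplit-cong xs term ⟩
    Σsplit xs (λ J L → C * (weight s t vs (suc m′) J L * T t 1ℚ J L + v * (weight s t vs m′ J L * T t 1ℚ J L)))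
      ≡⟨ ≡.trans (Σsplit-* xs _ _) (*-congˡ (≡.trans (Σsplit-+ xs _ _) (+-congˡ (Σsplit-* xs _ _)))) ⟩
    C * (lhs-sum s t vs (suc m′) xs + v * lhs-sum s t vs m′ xs)
      ≡⟨ *-congˡ (cong₂ (λ a b → a + v * b)
           (≡.trans (cong (λ l → lhs-sum s t vs l xs) (sym (ℕₚ.+-suc (length vs) p))) (ih s vs (suc p) st (uvs , 0∉ , vs∉xs)))
           (ih s vs p st (uvs , 0∉ , vs∉xs))) ⟩
    C * (0ℚ + v * target t p xs vs)
      ≡⟨ target-v p ⟩
    Πl (λ x → v - x) xs * target t p (v ∷ xs) (v ∷ vs) ∎
    where
    open ≡-Reasoning
    m′ : ℕ
    m′ = length vs ℕ.+ p
    C : ℚ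
    C = Πl (λ x → v - x) xs * (V (v ∷ vs) (t * v) * X∅ t xs v)
    term : ∀ {J L} → Split J L xs →
      T t 1ℚ J L * (weight s t (v ∷ vs) (suc m′) (v ∷ J) L * cross t 1ℚ v J L + weight s t (v ∷ vs) (suc m′) J (v ∷ L) * cross 1ℚ t v L J)
      ≡ C * (weight s t vs (suc m′) J L * T t 1ℚ J L + v * (weight s t vs m′ J L * T t 1ℚ J L))
    term {J} {L} sp = begin
      T t 1ℚ J L * (weight s t (v ∷ vs) (suc m′) (v ∷ J) L * cross t 1ℚ v J L + weight s t (v ∷ vs) (suc m′) J (v ∷ L) * cross 1ℚ t v L J)
        ≡⟨ cong (λ e → T t 1ℚ J L * (weight s t (v ∷ vs) (suc m′) (v ∷ J) L * cross t 1ℚ v J L + e)) (cong₂ _*_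
             (cong₂ (λ a b → κ s t J * a * b) (E-consʳ J v L (suc m′))
               (cong₂ (λ a b → a * (V (v ∷ vs) (t * v) * b)) (Πl-* _ _ J) (Πl-* _ _ L)))
             (*-congʳ (Πl-cong′ J (1*v-ti t v)))) ⟩
      T t 1ℚ J L * (weight s t (v ∷ vs) (suc m′) (v ∷ J) L * cross t 1ℚ v J L
        + κ s t J * (E J L (suc m′) + v * E J L m′)
          * ((Πl (λ x → v - x) J * Πl (V vs) J) * (V (v ∷ vs) (t * v) * (Πl (λ x → v - t * x) L * Πl (λ x → V vs (t * x)) L)))
          * (Πl (λ x → v - t * x) J * Πl (λ x → v - x) L))
        ≡⟨ root-v _ _ _ _ _ _ _ _ _ _ _ _ _ _ _ _ _ _ ⟩
      ((Πl (λ x → v - x) J * Πl (λ x → v - x) L) * (V (v ∷ vs) (t * v) * (Πl (λ x → v - t * x) J * Πl (λ x → v - t * x) L)))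
        * (weight s t vs (suc m′) J L * T t 1ℚ J L + v * (weight s t vs m′ J L * T t 1ℚ J L))
        ≡⟨ *-congʳ (cong₂ (λ a b → a * (V (v ∷ vs) (t * v) * b)) (sym (Split-Πl _ sp)) (sym (Split-Πl _ sp))) ⟩
      C * (weight s t vs (suc m′) J L * T t 1ℚ J L + v * (weight s t vs m′ J L * T t 1ℚ J L)) ∎
    -- Dual terms with the point `v` in `K` contain `v - v`. In those with `v` in `L`, the factors
    -- `r - v` of `X` cancel the denominators that `v` brings into `T`.
    dual-term : ∀ {K L} → Split K L vs →
      dual-weight t (v ∷ xs) K (v ∷ L) * T 1ℚ t K (v ∷ L) ≡ (V (v ∷ vs) (t * v) * X∅ t xs v) * (dual-weight t xs K L * T 1ℚ t K L)
    dual-term {K} {L} sp = begin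
      dual-weight t (v ∷ xs) K (v ∷ L) * T 1ℚ t K (v ∷ L)
        ≡⟨ cong₂ _*_ (cong₂ (λ a b → κ 1ℚ t K * (a * (X∅ t (v ∷ xs) v * b))) (Πl-* _ _ K) (Πl-* _ _ L)) (T-consʳ 1ℚ t K v L) ⟩
      κ 1ℚ t K * ((Πl (λ r → r - v) K * Πl (X xs) K) * (((v - t * v) * X∅ t xs v) * (Πl (λ r → r - t * v) L * Πl (X∅ t xs) L)))
        * (Πl (λ r → (1ℚ * r - t * v) * inv (r - v)) K * T 1ℚ t K L)
        ≡⟨ rhs-vʳ _ _ _ _ _ _ _ _ _ ⟩
      (((v - t * v) * ((Πl (λ r → (1ℚ * r - t * v) * inv (r - v)) K * Πl (λ r → r - v) K) * Πl (λ r → r - t * v) L)) * X∅ t xs v)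
        * (dual-weight t xs K L * T 1ℚ t K L)
        ≡⟨ *-congʳ (*-congʳ (*-congˡ (≡.trans (*-congʳ cancel) (sym (Split-Πl (λ r → r - t * v) sp))))) ⟩
      (V (v ∷ vs) (t * v) * X∅ t xs v) * (dual-weight t xs K L * T 1ℚ t K L) ∎
      where
      cancel : Πl (λ r → (1ℚ * r - t * v) * inv (r - v)) K * Πl (λ r → r - v) K ≡ Πl (λ r → r - t * v) K
      cancel = ≡.trans (sym (Πl-* _ _ K)) (Πl-cong K (All.map (λ {r} n → ≡.trans (*-assoc _ _ _)
        (≡.trans (*-congˡ (inv-inverseˡ (x-y≢0 (λ e → n (sym e))))) (≡.trans (*-idʳ _) (cong (_- t * v) (*-idˡ r)))))
        (proj₁ (Split-All sp v∉))))
    target-v : ∀ p → C * (0ℚ + v * target t p xs vs) ≡ Πl (λ x → v - x) xs * target t p (v ∷ xs) (v ∷ vs)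
    target-v (suc p) = ≡.trans (zero-final′ _ _) (sym (*-zeroʳ _))
    target-v zero    = sym (≡.trans
      (*-congˡ (*-congˡ (cong₂ _+_
        (≡.trans (Σsplit-cong vs (λ _ → rhs-vˡ _ _ _ _ _ _)) (Σsplit-0 vs))
        (≡.trans (Σsplit-cong vs dual-term) (Σsplit-* vs _ _)))))
      (rhs-v-final _ _ _ _ _ _))

  rootᵥ : ∀ {v} → v ∈ vs → N v ≡ Πl (λ x → v - x) xs * target t p (v ∷ xs) vs
  rootᵥ {v} v∈vs with ∈⇒↭∷ v∈vs
  ... | vs′ , q = begin
    N v
      ≡⟨ Σsplit-cong xs (λ {J} {L} _ → *-congˡ (cong₂ (λ a b → a * cross t 1ℚ v J L + b * cross 1ℚ t v L J)
           (weight-vs-↭ s t m (v ∷ J) L q) (weight-vs-↭ s t m J (v ∷ L) q))) ⟩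
    numer (weight s t (v ∷ vs′) m) t 1ℚ xs v
      ≡⟨ cong (λ l → numer (weight s t (v ∷ vs′) (l ℕ.+ p)) t 1ℚ xs v) (↭-length q) ⟩
    numer (weight s t (v ∷ vs′) (suc (length vs′ ℕ.+ p))) t 1ℚ xs v
      ≡⟨ rootᵥ′ v vs′ p (Unique-resp-↭ q (proj₁ adm) , All-resp-↭ q (proj₁ (proj₂ adm)) , All-resp-↭ q (All.map All.tail (proj₂ (proj₂ adm))))
           (≡.trans st′ (Πl-↭ _ q)) ⟩
    Πl (λ x → v - x) xs * target t p (v ∷ xs) (v ∷ vs′)
      ≡⟨ *-congˡ (target-vs-↭ t p (v ∷ xs) (↭-sym q)) ⟩
    Πl (λ x → v - x) xs * target t p (v ∷ xs) vs ∎
    where open ≡-Reasoning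

  conclusion : lhs-sum s t vs m (z ∷ xs) ≡ target t p (z ∷ xs) vs
  conclusion = interpolation t 1ℚ xs (0ℚ ∷ vs) (λ z → target t p (z ∷ xs) vs) (weight-↭ s t vs m) lead-diff
    (root₀ ∷ All.tabulate rootᵥ)
    (Allₚ.++⁺ (proj₁ (proj₂ adm)) 0∉xs ∷ Uniqueₚ.++⁺ (proj₁ adm) (AllPairs.tail u)
      (λ (v∈vs , v∈xs) → All.lookup (All.lookup (proj₂ (proj₂ adm)) v∈vs) (there v∈xs) refl))
    z (AllPairs.head u)

source-identity : ∀ t → t ≢ 0ℚ → ∀ xs → Unique xs → Claim t xs
source-identity t t≢0 = distinct-induction (Claim t) (claim-resp t) (claim-base t)
  (λ z xs u 0∉ ih s vs p st adm → Step.conclusion t t≢0 z xs u 0∉ ih s vs p st adm)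

-- Determinants

opaque
  Σf : ∀ m → (Fin m → ℚ) → ℚ
  Σf zero    f = 0ℚ
  Σf (suc m) f = f zero + Σf m (f ∘ suc)

  Σf-zero : ∀ f → Σf zero f ≡ 0ℚ
  Σf-zero f = refl

  Σf-suc : ∀ m f → Σf (suc m) f ≡ f zero + Σf m (f ∘ suc)
  Σf-suc m f = refl

  Σf-cong : ∀ m {f g} → (∀ i → f i ≡ g i) → Σf m f ≡ Σf m g
  Σf-cong zero    e = refl
  Σf-cong (suc m) e = cong₂ _+_ (e zero) (Σf-cong m (e ∘ suc))

  Σf-+ : ∀ m f g → Σf m (λ i → f i + g i) ≡ Σf m f + Σf m g
  Σf-+ zero    f g = sym (+-idˡ 0ℚ)
  Σf-+ (suc m) f g = ≡.trans (+-congˡ (Σf-+ m (f ∘ suc) (g ∘ suc))) (+-interchange _ _ _ _)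

  Σf-* : ∀ m c f → Σf m (λ i → c * f i) ≡ c * Σf m f
  Σf-* zero    c f = sym (*-zeroʳ c)
  Σf-* (suc m) c f = ≡.trans (+-congˡ (Σf-* m c (f ∘ suc))) (sym (*-distribˡ _ _ _))

  Σf-0 : ∀ m {f} → (∀ i → f i ≡ 0ℚ) → Σf m f ≡ 0ℚ
  Σf-0 zero    e = refl
  Σf-0 (suc m) e = ≡.trans (cong₂ _+_ (e zero) (Σf-0 m (e ∘ suc))) (+-idˡ 0ℚ)

  Σf-adjacent : ∀ m (j : Fin m) {f : Fin (suc m) → ℚ} → (∀ c → c ≢ inject₁ j → c ≢ suc j → f c ≡ 0ℚ) →
    f (inject₁ j) + f (suc j) ≡ 0ℚ → Σf (suc m) f ≡ 0ℚ
  Σf-adjacent (suc m) zero {f} z e = ≡.trans (sym (+-assoc _ _ _)) (≡.trans (cong₂ _+_ e (Σf-0 m (λ i → z (suc (suc i)) (λ ()) (λ ())))) (+-idˡ 0ℚ))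
  Σf-adjacent (suc m) (suc j) z e = ≡.trans (cong₂ _+_ (z zero (λ ()) (λ ()))
    (Σf-adjacent m j (λ c n n′ → z (suc c) (n ∘ Finₚ.suc-injective) (n′ ∘ Finₚ.suc-injective)) e)) (+-idˡ 0ℚ)

Πf : ∀ m → (Fin m → ℚ) → ℚ
Πf zero    f = 1ℚ
Πf (suc m) f = f zero * Πf m (f ∘ suc)

Πf-cong : ∀ m {f g} → (∀ i → f i ≡ g i) → Πf m f ≡ Πf m g
Πf-cong zero    e = refl
Πf-cong (suc m) e = cong₂ _*_ (e zero) (Πf-cong m (e ∘ suc))

Πf-* : ∀ m f g → Πf m (λ i → f i * g i) ≡ Πf m f * Πf m g
Πf-* zero    f g = sym (*-idˡ 1ℚ)
Πf-* (suc m) f g = ≡.trans (*-congˡ (Πf-* m _ _)) (*-interchange _ _ _ _)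

sgn : ∀ {m} → Fin m → ℚ
sgn zero    = 1ℚ
sgn (suc c) = - 1ℚ * sgn c

Matrix : ℕ → Set
Matrix k = Fin k → Fin k → ℚ

minor : ∀ {k} → Fin (suc k) → Matrix (suc k) → Matrix k
minor c A r c′ = A (suc r) (punchIn c c′)

opaque
  det : ∀ k → Matrix k → ℚ
  det zero    A = 1ℚ
  det (suc k) A = Σf (suc k) (λ c → sgn c * A zero c * det k (minor c A))

  det-zero : ∀ A → det zero A ≡ 1ℚ
  det-zero A = refl

  det-suc : ∀ k A → det (suc k) A ≡ Σf (suc k) (λ c → sgn c * A zero c * det k (minor c A))
  det-suc k A = refl

  det-cong : ∀ k {A B : Matrix k} → (∀ r c → A r c ≡ B r c) → det k A ≡ det k B
  det-cong zero    e = refl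
  det-cong (suc k) {A} {B} e = Σf-cong (suc k) (λ c →
    cong₂ _*_ (cong (sgn c *_) (e zero c)) (det-cong k (λ r c′ → e (suc r) (punchIn c c′))))

opaque
  unfolding _+_

  linear-here : ∀ s b c α d → s * (b + α * c) * d ≡ s * b * d + α * (s * c * d)
  linear-here = solve-∀ ringℚ
  linear-there : ∀ s a b c α → s * a * (b + α * c) ≡ s * a * b + α * (s * a * c)
  linear-there = solve-∀ ringℚ
  adjacent-cancel : ∀ s a d → s * a * d + - 1ℚ * s * a * d ≡ 0ℚ
  adjacent-cancel = solve-∀ ringℚ
  undo-column-op : ∀ a α b → a ≡ a - α * b + α * b
  undo-column-op = solve-∀ ringℚ
  +α0 : ∀ a α → a + α * 0ℚ ≡ a
  +α0 = solve-∀ ringℚ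
  row-scale : ∀ s d a e m → s * (d * a) * (e * m) ≡ (d * e) * (s * a * m)
  row-scale = solve-∀ ringℚ
  row-distrib : ∀ s a b m → s * (a + b) * m ≡ s * a * m + s * b * m
  row-distrib = solve-∀ ringℚ
  column-op : ∀ b α a m → (b - α * a) * m ≡ b * m - α * (a * m)
  column-op = solve-∀ ringℚ
  zero-term : ∀ s m → s * 0ℚ * m ≡ 0ℚ
  zero-term = solve-∀ ringℚ
  distribute : ∀ a b α a′ → a * (b - α * a′) ≡ a * b - a′ * (a * α)
  distribute = solve-∀ ringℚ

det-linear-column : ∀ k j {A B C : Matrix k} α → (∀ r → A r j ≡ B r j + α * C r j) →
  (∀ r c → c ≢ j → A r c ≡ B r c) → (∀ r c → c ≢ j → A r c ≡ C r c) → det k A ≡ det k B + α * det k C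
det-linear-column (suc k) j {A} {B} {C} α h hB hC =
  ≡.trans (det-suc k A) (≡.trans (Σf-cong (suc k) term) (≡.trans (Σf-+ (suc k) _ _)
    (cong₂ _+_ (sym (det-suc k B)) (≡.trans (Σf-* (suc k) α _) (*-congˡ (sym (det-suc k C)))))))
  where
  term : ∀ c → sgn c * A zero c * det k (minor c A) ≡ sgn c * B zero c * det k (minor c B) + α * (sgn c * C zero c * det k (minor c C))
  term c with c Finₚ.≟ j
  ... | yes refl = ≡.trans (*-congʳ (*-congˡ (h zero))) (≡.trans (linear-here _ _ _ _ _)
    (cong₂ (λ a b → sgn c * B zero c * a + α * (sgn c * C zero c * b))
      (det-cong k (λ r c′ → hB (suc r) (punchIn c c′) (Finₚ.punchInᵢ≢i c c′)))
      (det-cong k (λ r c′ → hC (suc r) (punchIn c c′) (Finₚ.punchInᵢ≢i c c′)))))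
  ... | no c≢j = ≡.trans (*-congˡ (det-linear-column k (punchOut c≢j) {minor c A} {minor c B} {minor c C} α
      (λ r → subst (λ d → A (suc r) d ≡ B (suc r) d + α * C (suc r) d) (sym (Finₚ.punchIn-punchOut c≢j)) (h (suc r)))
      (λ r c′ n → hB (suc r) _ (away c′ n)) (λ r c′ n → hC (suc r) _ (away c′ n))))
    (≡.trans (linear-there _ _ _ _ _) (cong₂ (λ a b → sgn c * a * det k (minor c B) + α * (sgn c * b * det k (minor c C))) (hB zero c c≢j) (hC zero c c≢j)))
    where
    away : ∀ c′ → c′ ≢ punchOut c≢j → punchIn c c′ ≢ j
    away c′ n e = n (Finₚ.punchIn-injective c c′ _ (≡.trans e (sym (Finₚ.punchIn-punchOut c≢j))))

punchIn-adjacent : ∀ {k} (c : Fin (suc (suc k))) (j : Fin (suc k)) → c ≢ inject₁ j → c ≢ suc j →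
  ∃[ j′ ] (punchIn c (inject₁ j′) ≡ inject₁ j × punchIn c (suc j′) ≡ suc j)
punchIn-adjacent zero zero n n′ = ⊥-elim (n refl)
punchIn-adjacent {suc k} zero (suc j) n n′ = j , refl , refl
punchIn-adjacent (suc zero) zero n n′ = ⊥-elim (n′ refl)
punchIn-adjacent {suc k} (suc (suc c)) zero n n′ = zero , refl , refl
punchIn-adjacent {suc k} (suc c) (suc j) n n′ =
  let j′ , e , e′ = punchIn-adjacent c j (n ∘ cong suc) (n′ ∘ cong suc) in suc j′ , cong suc e , cong suc e′

punchIn-neighbours : ∀ {k} (j : Fin (suc k)) (c : Fin (suc k)) →
  (punchIn (inject₁ j) c ≡ punchIn (suc j) c) ⊎ (punchIn (inject₁ j) c ≡ suc j × punchIn (suc j) c ≡ inject₁ j)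
punchIn-neighbours zero zero    = inj₂ (refl , refl)
punchIn-neighbours zero (suc c) = inj₁ refl
punchIn-neighbours {suc k} (suc j) zero = inj₁ refl
punchIn-neighbours {suc k} (suc j) (suc c) with punchIn-neighbours j c
... | inj₁ e        = inj₁ (cong suc e)
... | inj₂ (e , e′) = inj₂ (cong suc e , cong suc e′)

sgn-inject₁ : ∀ {m} (j : Fin m) → sgn (inject₁ j) ≡ sgn j
sgn-inject₁ zero    = refl
sgn-inject₁ (suc j) = *-congˡ (sgn-inject₁ j)

-- Restriction to adjacent columns suits the expansion along the first row: deleting another column
-- leaves the pair adjacent, and deleting either one of the pair gives the same minor with opposite
-- signs.
det-equal-columns : ∀ k (j : Fin k) {A : Matrix (suc k)} → (∀ r → A r (inject₁ j) ≡ A r (suc j)) → det (suc k) A ≡ 0ℚ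
det-equal-columns (suc k) j {A} h = ≡.trans (det-suc (suc k) A) (Σf-adjacent (suc k) j others pair)
  where
  others : ∀ c → c ≢ inject₁ j → c ≢ suc j → sgn c * A zero c * det (suc k) (minor c A) ≡ 0ℚ
  others c n n′ with punchIn-adjacent c j n n′
  ... | j′ , e , e′ = ≡.trans (*-congˡ (det-equal-columns k j′ {minor c A} (λ r →
    ≡.trans (cong (A (suc r)) e) (≡.trans (h (suc r)) (sym (cong (A (suc r)) e′)))))) (*-zeroʳ _)
  minors : ∀ r c → minor (suc j) A r c ≡ minor (inject₁ j) A r c
  minors r c with punchIn-neighbours j c
  ... | inj₁ e        = sym (cong (A (suc r)) e)
  ... | inj₂ (e , e′) = ≡.trans (cong (A (suc r)) e′) (≡.trans (h (suc r)) (sym (cong (A (suc r)) e)))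
  pair : sgn (inject₁ j) * A zero (inject₁ j) * det (suc k) (minor (inject₁ j) A) + sgn (suc j) * A zero (suc j) * det (suc k) (minor (suc j) A) ≡ 0ℚ
  pair = ≡.trans (+-congˡ (cong₂ _*_ (cong₂ _*_ (*-congˡ (sym (sgn-inject₁ j))) (sym (h zero))) (det-cong (suc k) minors))) (adjacent-cancel _ _ _)

-- Column operations

select : ∀ {P : Set} → Dec P → ℚ → ℚ → ℚ
select (yes _) a b = a
select (no _)  a b = b

select-yes : ∀ {P : Set} (d : Dec P) {a b} → P → select d a b ≡ a
select-yes (yes _) p = refl
select-yes (no n)  p = ⊥-elim (n p)

select-no : ∀ {P : Set} (d : Dec P) {a b} → ¬ P → select d a b ≡ b
select-no (yes p) n = ⊥-elim (n p)
select-no (no _)  n = refl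

select-irr : ∀ {P R : Set} (d : Dec P) (e : Dec R) {a b} → (P → R) → (R → P) → select d a b ≡ select e a b
select-irr (yes p) e f g = sym (select-yes e (f p))
select-irr (no n)  e f g = sym (select-no e (n ∘ g))

module _ {k : ℕ} (A : Matrix (suc k)) (α : ℚ) where

  -- Only the columns beyond the i-th have been modified.
  partial : ℕ → Matrix (suc k)
  partial i r zero    = A r zero
  partial i r (suc c) = select (i ℕ.≤? toℕ c) (A r (suc c) - α * A r (inject₁ c)) (A r (suc c))

  partial-before : ∀ i r (c : Fin k) → toℕ c ≡ i → partial (suc i) r (inject₁ c) ≡ A r (inject₁ c)
  partial-before i r zero    e = refl
  partial-before (suc i) r (suc c) e = select-no (suc (suc i) ℕ.≤? toℕ (inject₁ c))
    (λ le → ℕₚ.<⇒≱ (ℕ.s≤s (ℕₚ.≤-reflexive (≡.trans (Finₚ.toℕ-inject₁ c) (ℕₚ.suc-injective e)))) (ℕₚ.≤-trans (ℕₚ.n≤1+n _) le))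

  -- Columns are restored from the left, so the left neighbour is already the original one when its
  -- multiple is added back. The correction is a determinant with two equal adjacent columns.
  det-column-step : ∀ (j : Fin k) → det (suc k) (partial (toℕ j)) ≡ det (suc k) (partial (suc (toℕ j)))
  det-column-step j = sym (≡.trans
    (det-linear-column (suc k) (suc j) {partial (suc i)} {partial i} {C} α changed (λ r c n → away r c n) (λ r c n → sym (other r c n)))
    (≡.trans (+-congˡ (*-congˡ (det-equal-columns k j {C} (λ r → ≡.trans (other r (inject₁ j) (λ e → ℕₚ.1+n≢n (sym (≡.trans (sym (Finₚ.toℕ-inject₁ j)) (cong toℕ e)))))
      (≡.trans (partial-before i r j refl) (sym (same r))))))) (+α0 _ _)))
    where
    i : ℕ
    i = toℕ j
    C : Matrix (suc k)
    C r c = select (c Finₚ.≟ suc j) (A r (inject₁ j)) (partial (suc i) r c)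
    same : ∀ r → C r (suc j) ≡ A r (inject₁ j)
    same r = select-yes (suc j Finₚ.≟ suc j) refl
    other : ∀ r c → c ≢ suc j → C r c ≡ partial (suc i) r c
    other r c n = select-no (c Finₚ.≟ suc j) n
    changed : ∀ r → partial (suc i) r (suc j) ≡ partial i r (suc j) + α * C r (suc j)
    changed r = ≡.trans (select-no (suc i ℕ.≤? toℕ j) (ℕₚ.<⇒≱ ℕₚ.≤-refl)) (≡.trans (undo-column-op _ α (A r (inject₁ j)))
      (cong₂ (λ a b → a + α * b) (sym (select-yes (i ℕ.≤? toℕ j) ℕₚ.≤-refl)) (sym (same r))))
    away : ∀ r c → c ≢ suc j → partial (suc i) r c ≡ partial i r c
    away r zero    n = refl
    away r (suc c) n = select-irr (suc i ℕ.≤? toℕ c) (i ℕ.≤? toℕ c) (ℕₚ.≤-trans (ℕₚ.n≤1+n i))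
      (λ le → ℕₚ.≤∧≢⇒< le (λ e → n (cong suc (Finₚ.toℕ-injective (sym e)))))

  det-column-op : ∀ {B : Matrix (suc k)} → (∀ r → B r zero ≡ A r zero) →
    (∀ r c → B r (suc c) ≡ A r (suc c) - α * A r (inject₁ c)) → det (suc k) B ≡ det (suc k) A
  det-column-op {B} h₀ h₁ = ≡.trans (det-cong (suc k) start) (≡.trans (steps k ℕₚ.≤-refl) (det-cong (suc k) finish))
    where
    start : ∀ r c → B r c ≡ partial 0 r c
    start r zero    = h₀ r
    start r (suc c) = ≡.trans (h₁ r c) (sym (select-yes (0 ℕ.≤? toℕ c) {b = A r (suc c)} ℕ.z≤n))
    finish : ∀ r c → partial k r c ≡ A r c
    finish r zero    = refl
    finish r (suc c) = select-no (k ℕ.≤? toℕ c) (ℕₚ.<⇒≱ (Finₚ.toℕ<n c))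
    steps : ∀ i → i ℕ.≤ k → det (suc k) (partial 0) ≡ det (suc k) (partial i)
    steps zero    le = refl
    steps (suc i) le = ≡.trans (steps i (ℕₚ.<⇒≤ le))
      (subst (λ l → det (suc k) (partial l) ≡ det (suc k) (partial (suc l))) (Finₚ.toℕ-fromℕ< le) (det-column-step (Fin.fromℕ< le)))

det-scale-rows : ∀ k d (A : Matrix k) → det k (λ r c → d r * A r c) ≡ Πf k d * det k A
det-scale-rows zero    d A = ≡.trans (det-zero _) (≡.trans (sym (*-idˡ 1ℚ)) (*-congˡ (sym (det-zero A))))
det-scale-rows (suc k) d A = ≡.trans (det-suc k _) (≡.trans
  (Σf-cong (suc k) (λ c → ≡.trans (*-congˡ (det-scale-rows k (d ∘ suc) (minor c A))) (row-scale (sgn c) _ _ _ _)))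
  (≡.trans (Σf-* (suc k) _ _) (*-congˡ (sym (det-suc k A)))))

-- Sums over subsets and multilinear expansion of determinants

Σsub : ∀ n → (Subset n → ℚ) → ℚ
Σsub zero    f = f []
Σsub (suc n) f = Σsub n (λ S → f (outside ∷ S)) + Σsub n (λ S → f (inside ∷ S))

Σsub-cong : ∀ n {f g} → (∀ S → f S ≡ g S) → Σsub n f ≡ Σsub n g
Σsub-cong zero    e = e []
Σsub-cong (suc n) e = cong₂ _+_ (Σsub-cong n (λ S → e (outside ∷ S))) (Σsub-cong n (λ S → e (inside ∷ S)))

Σsub-+ : ∀ n f g → Σsub n (λ S → f S + g S) ≡ Σsub n f + Σsub n g
Σsub-+ zero    f g = refl
Σsub-+ (suc n) f g = ≡.trans (cong₂ _+_ (Σsub-+ n _ _) (Σsub-+ n _ _)) (+-interchange _ _ _ _)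

Σsub-* : ∀ n c f → Σsub n (λ S → c * f S) ≡ c * Σsub n f
Σsub-* zero    c f = refl
Σsub-* (suc n) c f = ≡.trans (cong₂ _+_ (Σsub-* n c _) (Σsub-* n c _)) (sym (*-distribˡ _ _ _))

Σsub-0 : ∀ n → Σsub n (λ _ → 0ℚ) ≡ 0ℚ
Σsub-0 zero    = refl
Σsub-0 (suc n) = ≡.trans (cong₂ _+_ (Σsub-0 n) (Σsub-0 n)) (+-idˡ 0ℚ)

Σsub-Σf : ∀ n m (f : Subset n → Fin m → ℚ) → Σsub n (λ S → Σf m (f S)) ≡ Σf m (λ i → Σsub n (λ S → f S i))
Σsub-Σf n zero    f = ≡.trans (Σsub-cong n (λ S → Σf-zero (f S))) (≡.trans (Σsub-0 n) (sym (Σf-zero _)))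
Σsub-Σf n (suc m) f = ≡.trans (Σsub-cong n (λ S → Σf-suc m (f S)))
  (≡.trans (Σsub-+ n _ _) (≡.trans (+-congˡ (Σsub-Σf n m (λ S i → f S (suc i)))) (sym (Σf-suc m _))))

choose : ∀ {k} {X : Set} → Subset k → (Fin k → X) → (Fin k → X) → Fin k → X
choose S F G r = if lookup S r then G r else F r

choose-map : ∀ {k} {X Y : Set} (h : X → Y) (S : Subset k) (F G : Fin k → X) r →
  choose S (h ∘ F) (h ∘ G) r ≡ h (choose S F G r)
choose-map h S F G r with lookup S r
... | outside = refl
... | inside  = refl

det-multilinear : ∀ k (F G : Matrix k) → det k (λ r c → F r c + G r c) ≡ Σsub k (λ S → det k (choose S F G))
det-multilinear zero    F G = ≡.trans (det-zero _) (sym (det-zero _))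
det-multilinear (suc k) F G = begin
  det (suc k) (λ r c → F r c + G r c)
    ≡⟨ det-suc k _ ⟩
  Σf (suc k) (λ c → sgn c * (F zero c + G zero c) * det k (λ r c′ → minor c F r c′ + minor c G r c′))
    ≡⟨ Σf-cong (suc k) (λ c → ≡.trans (*-congˡ (det-multilinear k (minor c F) (minor c G))) (sym (Σsub-* k _ _))) ⟩
  Σf (suc k) (λ c → Σsub k (λ S → sgn c * (F zero c + G zero c) * det k (choose S (minor c F) (minor c G))))
    ≡⟨ Σf-cong (suc k) (λ c → Σsub-cong k (λ S → ≡.trans
         (*-congˡ (det-cong k (λ r c′ → cong (λ h → h c′) (choose-map (λ h c′ → h (punchIn c c′)) S (F ∘ suc) (G ∘ suc) r))))
         (row-distrib (sgn c) (F zero c) (G zero c) _))) ⟩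
  Σf (suc k) (λ c → Σsub k (λ S → row F (outside ∷ S) c + row G (inside ∷ S) c))
    ≡⟨ ≡.trans (sym (Σsub-Σf k (suc k) _)) (≡.trans (Σsub-cong k (λ S → Σf-+ (suc k) _ _)) (≡.trans (Σsub-+ k _ _)
         (cong₂ _+_ (Σsub-cong k (λ S → sym (det-suc k _))) (Σsub-cong k (λ S → sym (det-suc k _)))))) ⟩
  Σsub (suc k) (λ S → det (suc k) (choose S F G)) ∎
  where
  open ≡-Reasoning
  row : Matrix (suc k) → Subset (suc k) → Fin (suc k) → ℚ
  row H S c = sgn c * H zero c * det k (minor c (choose S F G))

-- Homogeneous Vandermonde determinant

pow : ℚ → ℕ → ℚ
pow a zero    = 1ℚ
pow a (suc n) = a * pow a n

Πl-const : ∀ t J → Πl (λ _ → t) J ≡ pow t (length J)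
Πl-const t []      = refl
Πl-const t (x ∷ J) = *-congˡ (Πl-const t J)

-- mon k a b c = a^(k-1-c) b^c
mon : ∀ k → ℚ → ℚ → Fin k → ℚ
mon (suc k) a b zero    = pow a k
mon (suc k) a b (suc c) = b * mon k a b c

mon-inject₁ : ∀ k a b c → mon (suc k) a b (inject₁ c) ≡ a * mon k a b c
mon-inject₁ (suc k) a b zero    = refl
mon-inject₁ (suc k) a b (suc c) = ≡.trans (*-congˡ (mon-inject₁ k a b c)) (swap-* _ _ _)

vandermonde : ∀ k → (Fin k → ℚ) → (Fin k → ℚ) → ℚ
vandermonde zero    a b = 1ℚ
vandermonde (suc k) a b = Πf k (λ s → a zero * b (suc s) - a (suc s) * b zero) * vandermonde k (a ∘ suc) (b ∘ suc)

pow-Πf : ∀ a k d → pow a k * Πf k d ≡ Πf k (λ s → a * d s)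
pow-Πf a zero    d = *-idˡ 1ℚ
pow-Πf a (suc k) d = ≡.trans (*-interchange _ _ _ _) (*-congˡ (pow-Πf a k (d ∘ suc)))

-- Subtracting b₀/a₀ times each column from the next clears the first row behind its corner
-- a₀^(k-1), which then turns every factor b_s - (b₀/a₀) a_s into a₀ b_s - a_s b₀. The homogeneous
-- form is used with rows that mix a = 1 and a = t.
det-vandermonde : ∀ k (a b : Fin k → ℚ) → (∀ r → a r ≢ 0ℚ) → det k (λ r c → mon k (a r) (b r) c) ≡ vandermonde k a b
det-vandermonde zero    a b a≢0 = det-zero _
det-vandermonde (suc k) a b a≢0 = begin
  det (suc k) (λ r c → mon (suc k) (a r) (b r) c)
    ≡⟨ sym (det-column-op (λ r c → mon (suc k) (a r) (b r) c) α {reduced} (λ r → refl) (λ r c → ≡.trans (column-op _ _ _ _) (cong (λ u → b r * mon k (a r) (b r) c - α * u) (sym (mon-inject₁ k (a r) (b r) c))))) ⟩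
  det (suc k) reduced
    ≡⟨ ≡.trans (det-suc k reduced) (≡.trans (Σf-suc k _) (≡.trans (+-congˡ (Σf-0 k (λ c → ≡.trans (*-congʳ (cong (sgn (suc c) *_) (≡.trans (*-congʳ b₀-αa₀) (*-zeroˡ _)))) (zero-term _ _)))) (+-idʳ _))) ⟩
  1ℚ * pow (a zero) k * det k (λ r c → (b (suc r) - α * a (suc r)) * mon k (a (suc r)) (b (suc r)) c)
    ≡⟨ cong₂ _*_ (*-idˡ _) (≡.trans (det-scale-rows k _ _) (*-congˡ (det-vandermonde k (a ∘ suc) (b ∘ suc) (a≢0 ∘ suc)))) ⟩
  pow (a zero) k * (Πf k (λ r → b (suc r) - α * a (suc r)) * vandermonde k (a ∘ suc) (b ∘ suc))
    ≡⟨ ≡.trans (sym (*-assoc _ _ _)) (*-congʳ (≡.trans (pow-Πf (a zero) k _) (Πf-cong k (λ s →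
         ≡.trans (distribute _ _ _ _) (cong (λ u → a zero * b (suc s) - a (suc s) * u) a₀α))))) ⟩
  vandermonde (suc k) a b ∎
  where
  open ≡-Reasoning
  α : ℚ
  α = b zero * inv (a zero)
  a₀α : a zero * α ≡ b zero
  a₀α = ≡.trans (swap-* _ _ _) (≡.trans (*-congˡ (inv-inverseʳ (a≢0 zero))) (*-idʳ _))
  b₀-αa₀ : b zero - α * a zero ≡ 0ℚ
  b₀-αa₀ = ≡.trans (cong (λ u → b zero - u) (≡.trans (*-comm _ _) a₀α)) (x-x _)
  reduced : Matrix (suc k)
  reduced r zero    = pow (a r) k
  reduced r (suc c) = (b r - α * a r) * mon k (a r) (b r) c

-- Rows mixing two Vandermonde matrices

members : ∀ {n} {X : Set} → Subset n → Vec X n → List X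
members []            []       = []
members (inside  ∷ S) (x ∷ xs) = x ∷ members S xs
members (outside ∷ S) (x ∷ xs) = members S xs

nonmembers : ∀ {n} {X : Set} → Subset n → Vec X n → List X
nonmembers []            []       = []
nonmembers (inside  ∷ S) (x ∷ xs) = nonmembers S xs
nonmembers (outside ∷ S) (x ∷ xs) = x ∷ nonmembers S xs

Split-subset : ∀ {n} (S : Subset n) (xs : Vec ℚ n) → Split (members S xs) (nonmembers S xs) (toList xs)
Split-subset []            []       = []
Split-subset (inside  ∷ S) (x ∷ xs) = left (Split-subset S xs)
Split-subset (outside ∷ S) (x ∷ xs) = right (Split-subset S xs)

Σsub-Σsplit : ∀ {n} (xs : Vec ℚ n) f → Σsub n (λ S → f (members S xs) (nonmembers S xs)) ≡ Σsplit (toList xs) f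
Σsub-Σsplit []       f = refl
Σsub-Σsplit (x ∷ xs) f = ≡.trans (+-comm _ _)
  (cong₂ _+_ (Σsub-Σsplit xs (λ J L → f (x ∷ J) L)) (Σsub-Σsplit xs (λ J L → f J (x ∷ L))))

-- The ordinary Vandermonde product, the common factor of both sides at generic points.
W : List ℚ → ℚ
W []       = 1ℚ
W (v ∷ vs) = Πl (λ w → w - v) vs * W vs

opaque
  unfolding _+_

  pull-row : ∀ t w v → t * w - t * v ≡ t * (w - v)
  pull-row = solve-∀ ringℚ
  flip-row : ∀ t w v i → (1ℚ * v - t * w) * i * (w - v) ≡ (t * w - 1ℚ * v) * (i * (v - w))
  flip-row = solve-∀ ringℚ
  keep-row : ∀ t w v i → (1ℚ * w - t * v) * i * (w - v) ≡ (1ℚ * w - t * v) * (i * (w - v))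
  keep-row = solve-∀ ringℚ
  trivial-row : ∀ w v → 1ℚ * w - 1ℚ * v ≡ w - v
  trivial-row = solve-∀ ringℚ
  row-in : ∀ q C tK DK R DL V → (- q * C) * (((tK * DK) * (R * DL)) * V) ≡ (- 1ℚ * tK * q * R) * ((DK * DL) * (C * V))
  row-in = solve-∀ ringℚ
  row-in′ : ∀ tK q R D W κ QK PL T → (- 1ℚ * tK * q * R) * (D * (W * (κ * (QK * PL) * T))) ≡ (D * W) * ((- 1ℚ * tK * κ) * ((q * QK) * PL) * (R * T))
  row-in′ = solve-∀ ringℚ
  row-out : ∀ p C R DK DL V → (p * C) * (((R * DK) * DL) * V) ≡ (p * R) * ((DK * DL) * (C * V))
  row-out = solve-∀ ringℚ
  row-out′ : ∀ p R D W κ QK PL T → (p * R) * (D * (W * (κ * (QK * PL) * T))) ≡ (D * W) * (κ * (QK * (p * PL)) * (R * T))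
  row-out′ = solve-∀ ringℚ
  power-step : ∀ v z P Q → (v * P) * Q - z * (P * Q) ≡ P * ((v - z) * Q)
  power-step = solve-∀ ringℚ
  horner : ∀ c v e → c * 1ℚ + v * e ≡ c + v * e
  horner = solve-∀ ringℚ
  ev-+ʳ : ∀ c c′ g e e′ → (c * g + e) + (c′ * g + e′) ≡ (c + c′) * g + (e + e′)
  ev-+ʳ = solve-∀ ringℚ
  ev-*ʳ : ∀ k c g e → k * (c * g + e) ≡ (k * c) * g + k * e
  ev-*ʳ = solve-∀ ringℚ
  ev-head : ∀ g → g ≡ 1ℚ * g + 0ℚ
  ev-head = solve-∀ ringℚ
  ev-tail : ∀ g e → e ≡ 0ℚ * g + e
  ev-tail = solve-∀ ringℚ
  minus : ∀ a b → a + - 1ℚ * b ≡ a - b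
  minus = solve-∀ ringℚ
  zero-ev : ∀ g → 0ℚ * g + 0ℚ ≡ 0ℚ
  zero-ev = solve-∀ ringℚ

  <-fresh : ∀ b → b Q.< b + 1ℚ
  <-fresh b = subst (Q._< b Q.+ 1ℚ) (Qₚ.+-identityʳ b) (Qₚ.+-monoʳ-< b {0ℚ} {1ℚ} (Q.*<* (ℤ.+<+ (ℕ.s≤s ℕ.z≤n))))

Πf-choose : ∀ {k} t α v (S : Subset k) (vs : Vec ℚ k) →
  Πf k (λ s → α * lookup vs s - choose S (λ _ → 1ℚ) (λ _ → t) s * v) ≡
  Πl (λ w → α * w - t * v) (members S vs) * Πl (λ w → α * w - 1ℚ * v) (nonmembers S vs)
Πf-choose t α v []            []       = sym (*-idˡ 1ℚ)
Πf-choose t α v (inside  ∷ S) (w ∷ vs) = ≡.trans (*-congˡ (Πf-choose t α v S vs)) (sym (*-assoc _ _ _))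
Πf-choose t α v (outside ∷ S) (w ∷ vs) = ≡.trans (*-congˡ (Πf-choose t α v S vs)) (swap-* _ _ _)

module _ (t : ℚ) (t≢0 : t ≢ 0ℚ) (p q : ℚ → ℚ) where

  mixed-weight : List ℚ → List ℚ → ℚ
  mixed-weight K L = κ 1ℚ t K * (Πl q K * Πl p L) * T 1ℚ t K L

  -- Pair by pair: two points with a = t give t (w - v), whence t^(|K| choose 2); a mixed pair gives
  -- w - v times its factor in `T 1ℚ t`; two points with a = 1 give w - v. The signs of `κ` come
  -- from the scalars `- q`.
  mixed-term : ∀ {k} (S : Subset k) (vs : Vec ℚ k) → Unique (toList vs) →
    Πf k (choose S (p ∘ lookup vs) (λ r → - q (lookup vs r))) * vandermonde k (choose S (λ _ → 1ℚ) (λ _ → t)) (lookup vs)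
    ≡ W (toList vs) * mixed-weight (members S vs) (nonmembers S vs)
  mixed-term [] [] u = base₁′
    where
    opaque
      unfolding _+_
      base₁′ : 1ℚ * 1ℚ ≡ 1ℚ * (1ℚ * (1ℚ * 1ℚ) * 1ℚ)
      base₁′ = refl
  mixed-term (inside ∷ S) (v ∷ vs) (v∉ ∷ u) = ≡.trans
    (*-congˡ (*-congʳ (≡.trans (Πf-choose t t v S vs) (cong₂ _*_
      (≡.trans (Πl-cong′ K (λ w → pull-row t w v)) (Πl-* (λ _ → t) (λ w → w - v) K))
      (sym (≡.trans (sym (Πl-* _ (λ w → w - v) L)) (Πl-cong L (All.map (λ n → ≡.trans (flip-row t _ v _) (≡.trans (*-congˡ (inv-inverseˡ (x-y≢0 n))) (*-idʳ _)))
        (proj₂ (Split-All (Split-subset S vs) v∉))))))))))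
    (≡.trans (row-in _ _ _ _ _ _ _)
      (≡.trans (*-congˡ (cong₂ _*_ (sym (Split-Πl (λ w → w - v) (Split-subset S vs))) (mixed-term S vs u)))
        (row-in′ _ _ _ _ _ _ _ _ _)))
    where
    K L : List ℚ
    K = members S vs
    L = nonmembers S vs
  mixed-term (outside ∷ S) (v ∷ vs) (v∉ ∷ u) = ≡.trans
    (*-congˡ (*-congʳ (≡.trans (Πf-choose t 1ℚ v S vs) (cong₂ _*_
      (sym (≡.trans (sym (Πl-* _ (λ w → w - v) K)) (Πl-cong K (All.map (λ n → ≡.trans (keep-row t _ v _) (≡.trans (*-congˡ (inv-inverseˡ (x-y≢0 (λ e → n (sym e))))) (*-idʳ _)))
        (proj₁ (Split-All (Split-subset S vs) v∉))))))
      (Πl-cong′ L (λ w → trivial-row w v))))))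
    (≡.trans (row-out _ _ _ _ _ _)
      (≡.trans (*-congˡ (cong₂ _*_ (sym (Split-Πl (λ w → w - v) (Split-subset S vs))) (mixed-term S vs u)))
        (≡.trans (row-out′ _ _ _ _ _ _ _ _) (*-congˡ (*-congˡ (sym (T-consʳ 1ℚ t K v L)))))))
    where
    K L : List ℚ
    K = members S vs
    L = nonmembers S vs

  det-mixed : ∀ {k} (vs : Vec ℚ k) → Unique (toList vs) →
    det k (λ r c → p (lookup vs r) * mon k 1ℚ (lookup vs r) c + - q (lookup vs r) * mon k t (lookup vs r) c)
    ≡ W (toList vs) * Σsplit (toList vs) mixed-weight
  det-mixed {k} vs u = ≡.trans (det-multilinear k _ _) (≡.trans (Σsub-cong k term)
    (≡.trans (Σsub-* k _ _) (*-congˡ (Σsub-Σsplit vs mixed-weight))))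
    where
    F G : Matrix k
    F r c = p (lookup vs r) * mon k 1ℚ (lookup vs r) c
    G r c = - q (lookup vs r) * mon k t (lookup vs r) c
    rows : ∀ S r c → choose S F G r c ≡
      choose S (p ∘ lookup vs) (λ r → - q (lookup vs r)) r * mon k (choose S (λ _ → 1ℚ) (λ _ → t) r) (lookup vs r) c
    rows S r c with lookup S r
    ... | inside  = refl
    ... | outside = refl
    nonzero : ∀ S r → choose {k} S (λ _ → 1ℚ) (λ _ → t) r ≢ 0ℚ
    nonzero S r with lookup S r
    ... | inside  = t≢0
    ... | outside = λ ()
    term : ∀ S → det k (choose S F G) ≡ W (toList vs) * mixed-weight (members S vs) (nonmembers S vs)
    term S = ≡.trans (det-cong k (rows S)) (≡.trans (det-scale-rows k _ _)
      (≡.trans (*-congˡ (det-vandermonde k _ (lookup vs) (nonzero S))) (mixed-term S vs u)))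

-- Linear functionals on polynomials, given by their moments γ

-- apply γ zs is the value at Π_{z∈zs} (v - z) of the functional v^a ↦ γ a.
apply : (ℕ → ℚ) → List ℚ → ℚ
apply γ []       = γ 0
apply γ (z ∷ zs) = apply (γ ∘ suc) zs - z * apply γ zs

apply-cong : ∀ {γ δ} zs → (∀ a → γ a ≡ δ a) → apply γ zs ≡ apply δ zs
apply-cong []       e = e 0
apply-cong (z ∷ zs) e = cong₂ (λ a b → a - z * b) (apply-cong zs (e ∘ suc)) (apply-cong zs e)

apply-pow : ∀ v c zs → apply (λ a → pow v (c ℕ.+ a)) zs ≡ pow v c * Πl (λ z → v - z) zs
apply-pow v c []       = ≡.trans (cong (pow v) (ℕₚ.+-identityʳ c)) (sym (*-idʳ _))
apply-pow v c (z ∷ zs) = ≡.trans (cong₂ (λ a b → a - z * b)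
  (≡.trans (apply-cong zs (λ a → cong (pow v) (ℕₚ.+-suc c a))) (apply-pow v (suc c) zs)) (apply-pow v c zs)) (power-step _ _ _ _)

-- A polynomial, constant term first, paired with a sequence of moments; at `pow v` this is its
-- value at `v`.
ev : List ℚ → (ℕ → ℚ) → ℚ
ev []      γ = 0ℚ
ev (c ∷ p) γ = c * γ 0 + ev p (γ ∘ suc)

-- Linearity with finitely many coefficients, which makes the value at `pow v` a polynomial in `v`;
-- additivity and homogeneity alone would not.
Linear : ((ℕ → ℚ) → ℚ) → Set
Linear Λ = ∃[ p ] (∀ γ → Λ γ ≡ ev p γ)

linear-cong : ∀ {Λ M} → (∀ γ → M γ ≡ Λ γ) → Linear Λ → Linear M
linear-cong e (p , h) = p , λ γ → ≡.trans (e γ) (h γ)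

linear-+ : ∀ {Λ M} → Linear Λ → Linear M → Linear (λ γ → Λ γ + M γ)
linear-+ (p , h) (q , g) = add p q , λ γ → ≡.trans (cong₂ _+_ (h γ) (g γ)) (ev-add p q γ)
  where
  add : List ℚ → List ℚ → List ℚ
  add []      q        = q
  add (c ∷ p) []       = c ∷ p
  add (c ∷ p) (c′ ∷ q) = c + c′ ∷ add p q
  ev-add : ∀ p q γ → ev p γ + ev q γ ≡ ev (add p q) γ
  ev-add []      q        γ = +-idˡ _
  ev-add (c ∷ p) []       γ = +-idʳ _
  ev-add (c ∷ p) (c′ ∷ q) γ = ≡.trans (ev-+ʳ _ _ _ _ _) (+-congˡ (ev-add p q (γ ∘ suc)))

linear-* : ∀ {Λ} k → Linear Λ → Linear (λ γ → k * Λ γ)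
linear-* k (p , h) = scale p , λ γ → ≡.trans (*-congˡ (h γ)) (ev-scale p γ)
  where
  scale : List ℚ → List ℚ
  scale []      = []
  scale (c ∷ p) = k * c ∷ scale p
  ev-scale : ∀ p γ → k * ev p γ ≡ ev (scale p) γ
  ev-scale []      γ = *-zeroʳ k
  ev-scale (c ∷ p) γ = ≡.trans (ev-*ʳ _ _ _ _) (+-congˡ (ev-scale p (γ ∘ suc)))

linear-shift : ∀ {Λ} n → Linear Λ → Linear (λ γ → Λ (λ a → γ (n ℕ.+ a)))
linear-shift zero    l = l
linear-shift (suc n) l with linear-shift n l
... | p , h = 0ℚ ∷ p , λ γ → ≡.trans (h (γ ∘ suc)) (ev-tail _ _)

linear-apply : ∀ zs → Linear (λ γ → apply γ zs)
linear-apply []       = 1ℚ ∷ [] , λ γ → ev-head _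
linear-apply (z ∷ zs) = linear-- (linear-shift 1 (linear-apply zs)) (linear-* z (linear-apply zs))
  where
  linear-- : ∀ {Λ M} → Linear Λ → Linear M → Linear (λ γ → Λ γ - M γ)
  linear-- l m = linear-cong (λ γ → sym (minus _ _)) (linear-+ l (linear-* (- 1ℚ) m))

opaque
  unfolding _+_

  pull-factor : ∀ d v g e → d * (v * g) + v * e ≡ v * (d * g + e)
  pull-factor = solve-∀ ringℚ
  scalar-first : ∀ s a d → s * a * d ≡ (s * d) * a
  scalar-first = solve-∀ ringℚ
  entry-arrange : ∀ v P A Q τ → (v * P) * A - τ * ((v * P) * Q) ≡ (v * A) * P + - (v * Q) * (τ * P)
  entry-arrange = solve-∀ ringℚ
  weight-arrange : ∀ k e T V W → (k * e * T) * (V * W) ≡ W * (k * e * V * T)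
  weight-arrange = solve-∀ ringℚ

ev-pow : ∀ c p v → ev (c ∷ p) (pow v) ≡ c + v * ev p (pow v)
ev-pow c p v = ≡.trans (+-congˡ (pull p (pow v))) (horner _ _ _)
  where
  pull : ∀ p γ → ev p (λ a → v * γ a) ≡ v * ev p γ
  pull []      γ = sym (*-zeroʳ v)
  pull (d ∷ p) γ = ≡.trans (+-congˡ (pull p (γ ∘ suc))) (pull-factor _ _ _ _)

lead-ev : ∀ p → Lead (length p) 0ℚ (λ v → ev p (pow v))
lead-ev []      = λ _ → refl
lead-ev (c ∷ p) = c , _ , lead-ev p , ev-pow c p

fresh : ∀ bad → ∃[ r ] All (Q._< r) bad
fresh []        = 0ℚ , []
fresh (b ∷ bad) = let r , r> = fresh bad in
  (b + 1ℚ) Q.⊔ r , Qₚ.<-≤-trans (<-fresh b) (Qₚ.p≤p⊔q (b + 1ℚ) r) ∷ All.map (λ lt → Qₚ.<-≤-trans lt (Qₚ.p≤q⊔p (b + 1ℚ) r)) r>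

fresh-list : ∀ n bad → ∃[ rs ] (length rs ≡ n × Unique rs × All (λ r → All (r ≢_) bad) rs)
fresh-list zero    bad = [] , refl , [] , []
fresh-list (suc n) bad =
  let rs , e , u , h = fresh-list n bad
      r , r>         = fresh (rs ++ bad)
      r∉             = All.map (λ lt e → Qₚ.<⇒≢ lt (sym e)) r>
  in r ∷ rs , cong suc e , Allₚ.++⁻ˡ rs r∉ ∷ u , Allₚ.++⁻ʳ rs r∉ ∷ h

-- Enough points outside `bad` force the polynomial to vanish everywhere. Its value at 0 is the
-- constant coefficient; the remainder is divided by `v`, so the recursive call excludes the point
-- 0.
ev-vanishes : ∀ p bad → (∀ v → All (v ≢_) bad → ev p (pow v) ≡ 0ℚ) → ∀ γ → ev p γ ≡ 0ℚ
ev-vanishes []      bad h γ = refl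
ev-vanishes (c ∷ p) bad h γ = ≡.trans (cong₂ (λ a b → a * γ 0 + b) c≡0 (ev-vanishes p (0ℚ ∷ []) tail≡0 (γ ∘ suc))) (zero-ev _)
  where
  everywhere : ∀ v → ev (c ∷ p) (pow v) ≡ 0ℚ
  everywhere = let rs , e , u , r∉ = fresh-list (suc (length p)) bad in
    lead-roots rs (subst (λ d → Lead d 0ℚ (λ v → ev (c ∷ p) (pow v))) (sym e) (lead-ev (c ∷ p))) u (All.map (h _) r∉)
  c≡0 : c ≡ 0ℚ
  c≡0 = ≡.trans (x+0y _ _) (≡.trans (sym (ev-pow c p 0ℚ)) (everywhere 0ℚ))
  tail≡0 : ∀ v → All (v ≢_) (0ℚ ∷ []) → ev p (pow v) ≡ 0ℚ
  tail≡0 v (v≢0 ∷ []) = *-cancelˡ v≢0 (≡.trans (sym (+-idˡ _))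
    (≡.trans (cong (λ a → a + v * ev p (pow v)) (sym c≡0)) (≡.trans (sym (ev-pow c p v)) (≡.trans (everywhere v) (sym (*-zeroʳ v))))))

-- Multilinear forms and their values at generic points

linear-0 : Linear (λ _ → 0ℚ)
linear-0 = [] , λ _ → refl

linear-Σf : ∀ m {Λ : Fin m → (ℕ → ℚ) → ℚ} → (∀ i → Linear (Λ i)) → Linear (λ γ → Σf m (λ i → Λ i γ))
linear-Σf zero    l = linear-cong (λ _ → Σf-zero _) linear-0
linear-Σf (suc m) l = linear-cong (λ _ → Σf-suc m _) (linear-+ (l zero) (linear-Σf m (l ∘ suc)))

Multilinear : ∀ k → (Vec (ℕ → ℚ) k → ℚ) → Set
Multilinear zero    F = ⊤
Multilinear (suc k) F = (∀ γs → Linear (λ γ → F (γ ∷ γs))) × (∀ γ → Multilinear k (λ γs → F (γ ∷ γs)))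

multilinear-cong : ∀ k {F G} → (∀ γs → G γs ≡ F γs) → Multilinear k F → Multilinear k G
multilinear-cong zero    e _       = tt
multilinear-cong (suc k) e (l , m) = (λ γs → linear-cong (λ γ → e (γ ∷ γs)) (l γs)) , (λ γ → multilinear-cong k (λ γs → e (γ ∷ γs)) (m γ))

multilinear-0 : ∀ k → Multilinear k (λ _ → 0ℚ)
multilinear-0 zero    = tt
multilinear-0 (suc k) = (λ _ → linear-0) , (λ _ → multilinear-0 k)

multilinear-+ : ∀ k {F G} → Multilinear k F → Multilinear k G → Multilinear k (λ γs → F γs + G γs)
multilinear-+ zero    _       _         = tt
multilinear-+ (suc k) (l , m) (l′ , m′) = (λ γs → linear-+ (l γs) (l′ γs)) , (λ γ → multilinear-+ k (m γ) (m′ γ))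

multilinear-* : ∀ k c {F} → Multilinear k F → Multilinear k (λ γs → c * F γs)
multilinear-* zero    c _       = tt
multilinear-* (suc k) c (l , m) = (λ γs → linear-* c (l γs)) , (λ γ → multilinear-* k c (m γ))

multilinear-Σf : ∀ k m {F : Fin m → Vec (ℕ → ℚ) k → ℚ} → (∀ i → Multilinear k (F i)) → Multilinear k (λ γs → Σf m (λ i → F i γs))
multilinear-Σf k zero    l = multilinear-cong k (λ _ → Σf-zero _) (multilinear-0 k)
multilinear-Σf k (suc m) l = multilinear-cong k (λ _ → Σf-suc m _) (multilinear-+ k (l zero) (multilinear-Σf k m (l ∘ suc)))

multilinear-Σsplit : ∀ k xs {F : List ℚ → List ℚ → Vec (ℕ → ℚ) k → ℚ} → (∀ J L → Multilinear k (F J L)) →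
  Multilinear k (λ γs → Σsplit xs (λ J L → F J L γs))
multilinear-Σsplit k []       l = l [] []
multilinear-Σsplit k (x ∷ xs) {F} l = multilinear-+ k
  (multilinear-Σsplit k xs {λ J L → F (x ∷ J) L} (λ J L → l (x ∷ J) L)) (multilinear-Σsplit k xs {λ J L → F J (x ∷ L)} (λ J L → l J (x ∷ L)))

multilinear-det : ∀ k {Λ : Fin k → (ℕ → ℚ) → ℚ} → (∀ c → Linear (Λ c)) →
  Multilinear k (λ γs → det k (λ r c → Λ c (lookup γs r)))
multilinear-det zero    l = tt
multilinear-det (suc k) {Λ} l =
  (λ γs → linear-cong (λ γ → det-suc k _) (linear-Σf (suc k) (λ c →
     linear-cong (λ γ → scalar-first (sgn c) _ _) (linear-* (sgn c * det k (λ r c′ → Λ (punchIn c c′) (lookup γs r))) (l c))))) ,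
  (λ γ → multilinear-cong k (λ γs → det-suc k _) (multilinear-Σf k (suc k) (λ c →
     multilinear-* k (sgn c * Λ c γ) (multilinear-det k (l ∘ punchIn c)))))

-- The functionals are treated one at a time. While one varies, the evaluation points of the others
-- are excluded along with `bad`, which keeps all points distinct.
density : ∀ k {F} → Multilinear k F → ∀ bad →
  (∀ vs → Unique (toList vs) → All (λ v → All (v ≢_) bad) (toList vs) → F (Vec.map pow vs) ≡ 0ℚ) →
  ∀ γs → F γs ≡ 0ℚ
density zero    _       bad h []       = h [] [] []
density (suc k) {F} (l , m) bad h (γ ∷ γs) = density k (m γ) bad generic γs
  where
  generic : ∀ vs → Unique (toList vs) → All (λ v → All (v ≢_) bad) (toList vs) → F (γ ∷ Vec.map pow vs) ≡ 0ℚ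
  generic vs u h′ with l (Vec.map pow vs)
  ... | p , e = ≡.trans (e γ) (ev-vanishes p (toList vs ++ bad)
    (λ v v∉ → ≡.trans (sym (e (pow v))) (h (v ∷ vs) (Allₚ.++⁻ˡ (toList vs) v∉ ∷ u) (Allₚ.++⁻ʳ (toList vs) v∉ ∷ h′))) γ)

-- The identity for arbitrary functionals in place of evaluations

shift : ℕ → (ℕ → ℚ) → ℕ → ℚ
shift c γ a = γ (c ℕ.+ a)

-- The letters whose removal from X^{tq} + tX leaves the image of X^{tq} under the q-shift of the
-- variables in `J`; that shift adds (t - 1) X_J to X^{tq}.
roots : ℚ → List ℚ → List ℚ → List ℚ
roots t J L = J ++ map (t *_) L

Πl-++ : ∀ h J L → Πl h (J ++ L) ≡ Πl h J * Πl h L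
Πl-++ h []      L = sym (*-idˡ _)
Πl-++ h (x ∷ J) L = ≡.trans (*-congˡ (Πl-++ h J L)) (sym (*-assoc _ _ _))

Πl-map : ∀ h g L → Πl h (map g L) ≡ Πl (h ∘ g) L
Πl-map h g []      = refl
Πl-map h g (x ∷ L) = *-congˡ (Πl-map h g L)

Πl-roots : ∀ h t J L → Πl h (roots t J L) ≡ Πl h J * Πl (λ x → h (t * x)) L
Πl-roots h t J L = ≡.trans (Πl-++ h J (map (t *_) L)) (*-congˡ (Πl-map h (t *_) L))

Πf-lookup : ∀ {k} (h : ℚ → ℚ) (vs : Vec ℚ k) → Πf k (λ r → h (lookup vs r)) ≡ Πl h (toList vs)
Πf-lookup h []       = refl
Πf-lookup h (v ∷ vs) = *-congˡ (Πf-lookup h vs)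

Πl-swap : ∀ (h : ℚ → ℚ → ℚ) xs ys → Πl (λ x → Πl (h x) ys) xs ≡ Πl (λ y → Πl (λ x → h x y) xs) ys
Πl-swap h []       ys = sym (Πl-1 ys)
Πl-swap h (x ∷ xs) ys = ≡.trans (*-congˡ (Πl-swap h xs ys)) (sym (Πl-* _ _ ys))

mon-1 : ∀ k v c → mon k 1ℚ v c ≡ pow v (toℕ c)
mon-1 (suc k) v zero    = pow-1 k
  where
  pow-1 : ∀ n → pow 1ℚ n ≡ 1ℚ
  pow-1 zero    = refl
  pow-1 (suc n) = ≡.trans (*-idˡ _) (pow-1 n)
mon-1 (suc k) v (suc c) = *-congˡ (mon-1 k v c)

mon-t : ∀ k t v c → mon k t v c ≡ pow t (k ℕ.∸ suc (toℕ c)) * pow v (toℕ c)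
mon-t (suc k) t v zero    = sym (*-idʳ _)
mon-t (suc k) t v (suc c) = ≡.trans (*-congˡ (mon-t k t v c)) (swap-* _ _ _)

vandermonde-1 : ∀ {k} (vs : Vec ℚ k) → vandermonde k (λ _ → 1ℚ) (lookup vs) ≡ W (toList vs)
vandermonde-1 []       = refl
vandermonde-1 (v ∷ vs) = cong₂ _*_
  (≡.trans (Πf-cong _ (λ s → trivial-row (lookup vs s) v)) (Πf-lookup (λ w → w - v) vs)) (vandermonde-1 vs)

lhs-det : ∀ {k} → ℚ → Vec (ℕ → ℚ) k → List ℚ → List ℚ → ℚ
lhs-det {k} t γs J L = det k (λ r c → apply (shift (toℕ c) (lookup γs r)) (roots t J L))

-- Removing tX leaves X^{tq}, and removing X leaves X^{tq} + X^t; the `suc` in the shift is the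
-- extra 1 in the indices of the right-hand determinant.
rhs-entry : ∀ {k} → ℚ → List ℚ → Fin k → (ℕ → ℚ) → ℚ
rhs-entry {k} t xs c γ = apply (shift (suc (toℕ c)) γ) (map (t *_) xs) - pow t (k ℕ.∸ suc (toℕ c)) * apply (shift (suc (toℕ c)) γ) xs

module _ {k : ℕ} (t : ℚ) (t≢0 : t ≢ 0ℚ) (s : ℚ) (xs : List ℚ) (u : Unique xs)
         (st : s * Πl (λ _ → t) xs ≡ t * pow t k) where

  lhs-det-sum : Vec (ℕ → ℚ) k → ℚ
  lhs-det-sum γs = Σsplit xs (λ J L → (κ s t J * E J L k * T t 1ℚ J L) * lhs-det t γs J L)

  lookup-pow : ∀ vs r → lookup (Vec.map pow vs) r ≡ pow (lookup {n = k} vs r)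
  lookup-pow vs r = Vecₚ.lookup-map r pow vs

  lhs-det-pow : ∀ vs J L → lhs-det t (Vec.map pow vs) J L ≡ (Πl (V (toList vs)) J * Πl (λ x → V (toList vs) (t * x)) L) * W (toList vs)
  lhs-det-pow vs J L = begin
    lhs-det t (Vec.map pow vs) J L
      ≡⟨ det-cong k (λ r c → ≡.trans (cong (λ γ → apply (shift (toℕ c) γ) (roots t J L)) (lookup-pow vs r))
           (≡.trans (apply-pow (lookup vs r) (toℕ c) (roots t J L)) (≡.trans (*-comm _ _) (*-congˡ (sym (mon-1 k (lookup vs r) c)))))) ⟩
    det k (λ r c → Πl (λ z → lookup vs r - z) (roots t J L) * mon k 1ℚ (lookup vs r) c)
      ≡⟨ det-scale-rows k _ _ ⟩
    Πf k (λ r → Πl (λ z → lookup vs r - z) (roots t J L)) * det k (λ r c → mon k 1ℚ (lookup vs r) c)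
      ≡⟨ cong₂ _*_
           (≡.trans (Πf-lookup (λ v → Πl (λ z → v - z) (roots t J L)) vs) (≡.trans (Πl-swap (λ v z → v - z) (toList vs) (roots t J L)) (Πl-roots (V (toList vs)) t J L)))
           (≡.trans (det-vandermonde k (λ _ → 1ℚ) (lookup vs) (λ _ ())) (vandermonde-1 vs)) ⟩
    (Πl (V (toList vs)) J * Πl (λ x → V (toList vs) (t * x)) L) * W (toList vs) ∎
    where open ≡-Reasoning

  rhs-det-pow : ∀ vs → Unique (toList vs) → det k (λ r c → rhs-entry t xs c (lookup (Vec.map pow vs) r)) ≡ rhs-sum t xs (toList vs) * W (toList vs)
  rhs-det-pow vs uv = begin
    det k (λ r c → rhs-entry t xs c (lookup (Vec.map pow vs) r))
      ≡⟨ det-cong k (λ r c → ≡.trans (cong (rhs-entry t xs c) (lookup-pow vs r)) (entry (lookup vs r) c)) ⟩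
    det k (λ r c → p (lookup vs r) * mon k 1ℚ (lookup vs r) c + - q (lookup vs r) * mon k t (lookup vs r) c)
      ≡⟨ det-mixed t t≢0 p q vs uv ⟩
    W (toList vs) * Σsplit (toList vs) (mixed-weight t t≢0 p q)
      ≡⟨ *-congˡ (≡.trans (Σsplit-cong (toList vs) term) (Σsplit-* (toList vs) _ _)) ⟩
    W (toList vs) * rhs-sum t xs (toList vs)
      ≡⟨ *-comm _ _ ⟩
    rhs-sum t xs (toList vs) * W (toList vs) ∎
    where
    open ≡-Reasoning
    p q : ℚ → ℚ
    p v = v * X∅ t xs v
    q v = v * X xs v
    entry : ∀ v c → rhs-entry t xs c (pow v) ≡ p v * mon k 1ℚ v c + - q v * mon k t v c
    entry v c = ≡.trans (cong₂ (λ a b → a - pow t (k ℕ.∸ suc (toℕ c)) * b)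
        (≡.trans (apply-pow v (suc (toℕ c)) (map (t *_) xs)) (*-congˡ (Πl-map _ (t *_) xs)))
        (apply-pow v (suc (toℕ c)) xs))
      (≡.trans (entry-arrange _ _ _ _ _) (cong₂ (λ a b → p v * a + - q v * b) (sym (mon-1 k v c)) (sym (mon-t k t v c))))
    term : ∀ {K L} → Split K L (toList vs) → mixed-weight t t≢0 p q K L ≡ Πl (λ v → v) (toList vs) * (dual-weight t xs K L * T 1ℚ t K L)
    term {K} {L} sp = ≡.trans (*-congʳ (*-congˡ (cong₂ _*_ (Πl-* _ _ K) (Πl-* _ _ L))))
      (≡.trans (rhs-0 _ _ _ _ _ _) (*-congʳ (sym (Split-Πl (λ v → v) sp))))

  -- At distinct nonzero points off `xs`, both sides are the Vandermonde product times the two sides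
  -- of `source-identity` with excess 0.
  functional-identity : ∀ γs → lhs-det-sum γs ≡ det k (λ r c → rhs-entry t xs c (lookup γs r))
  functional-identity γs = x-y≡0 (≡.trans (sym (minus _ _)) (density k multilinear (0ℚ ∷ xs) generic γs))
    where
    multilinear : Multilinear k (λ γs → lhs-det-sum γs + - 1ℚ * det k (λ r c → rhs-entry t xs c (lookup γs r)))
    multilinear = multilinear-+ k
      (multilinear-Σsplit k xs (λ J L → multilinear-* k (κ s t J * E J L k * T t 1ℚ J L) (multilinear-det k (λ c → linear-shift (toℕ c) (linear-apply (roots t J L))))))
      (multilinear-* k (- 1ℚ) (multilinear-det k (λ c → linear-cong (λ γ → sym (minus _ _))
        (linear-+ (linear-shift (suc (toℕ c)) (linear-apply (map (t *_) xs)))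
                  (linear-* (- 1ℚ) (linear-* (pow t (k ℕ.∸ suc (toℕ c))) (linear-shift (suc (toℕ c)) (linear-apply xs))))))))
    generic : ∀ vs → Unique (toList vs) → All (λ v → All (v ≢_) (0ℚ ∷ xs)) (toList vs) →
      lhs-det-sum (Vec.map pow vs) + - 1ℚ * det k (λ r c → rhs-entry t xs c (lookup (Vec.map pow vs) r)) ≡ 0ℚ
    generic vs uv v∉ = ≡.trans (minus _ _) (≡.trans (cong₂ _-_ lhs (rhs-det-pow vs uv)) (x-x _))
      where
      open ≡-Reasoning
      pow-length : ∀ vs → pow t k ≡ Πl (λ _ → t) (toList {n = k} vs)
      pow-length vs = ≡.trans (cong (pow t) (sym (Vecₚ.length-toList vs))) (sym (Πl-const t (toList vs)))
      lhs : lhs-det-sum (Vec.map pow vs) ≡ rhs-sum t xs (toList vs) * W (toList vs)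
      lhs = begin
        lhs-det-sum (Vec.map pow vs)
          ≡⟨ Σsplit-cong xs (λ {J} {L} _ → ≡.trans (*-congˡ (lhs-det-pow vs J L)) (weight-arrange _ _ _ _ _)) ⟩
        Σsplit xs (λ J L → W (toList vs) * (weight s t (toList vs) k J L * T t 1ℚ J L))
          ≡⟨ ≡.trans (Σsplit-* xs _ _) (*-comm _ _) ⟩
        lhs-sum s t (toList vs) k xs * W (toList vs)
          ≡⟨ *-congʳ (≡.trans (cong (λ m → lhs-sum s t (toList vs) m xs) (sym (≡.trans (ℕₚ.+-identityʳ _) (Vecₚ.length-toList vs))))
               (source-identity t t≢0 xs u s (toList vs) 0 (≡.trans st (*-congˡ (pow-length vs)))
                 (uv , All.map (λ n e → All.head n (sym e)) v∉ , All.map All.tail v∉))) ⟩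
        rhs-sum t xs (toList vs) * W (toList vs) ∎

-- Complete homogeneous functions from power sums

-- The convolution in Newton's identity, with a movable starting index because the recursion
-- advances it.
conv : (ℕ → ℚ) → (ℕ → ℚ) → ℕ → ℕ → ℚ
conv p g s zero    = p s * g 0
conv p g s (suc j) = p s * g (suc j) + conv p g (suc s) j

opaque
  unfolding _+_

  hom : (ℕ → ℚ) → ℕ → ℚ
  hom p j = Defs.headℚ (Defs.hList p j)

  nat : ℕ → ℚ
  nat = Defs.ℕ→ℚ

  hom-0 : ∀ p → hom p 0 ≡ 1ℚ
  hom-0 p = refl

  nat-suc : ∀ j → nat (suc j) ≡ 1ℚ + nat j
  nat-suc j = refl

  nat-1 : nat 1 ≡ 1ℚ
  nat-1 = refl

  0≤nat : ∀ j → 0ℚ Q.≤ nat j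
  0<nat : ∀ j → 0ℚ Q.< nat (suc j)
  0≤nat zero    = Qₚ.≤-refl
  0≤nat (suc j) = Qₚ.<⇒≤ (0<nat j)
  0<nat j = Qₚ.+-mono-<-≤ {0ℚ} {1ℚ} {0ℚ} {nat j} (Q.*<* (ℤ.+<+ (ℕ.s≤s ℕ.z≤n))) (0≤nat j)

  nat≢0 : ∀ j → nat (suc j) ≢ 0ℚ
  nat≢0 j e = Qₚ.<⇒≢ (0<nat j) (sym e)

  dot-conv : ∀ p p′ s j → Defs.dot p s (Defs.hList p′ j) ≡ conv p (hom p′) s j
  dot-conv p p′ s zero    = +-idʳ _
  dot-conv p p′ s (suc j) = cong (p s * hom p′ (suc j) +_) (dot-conv p p′ (suc s) j)

  newton : ∀ p j → nat (suc j) * hom p (suc j) ≡ conv p (hom p) 1 j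
  newton p j = ≡.trans (sym (*-assoc (nat (suc j)) (inv (nat (suc j))) (Defs.dot p 1 (Defs.hList p j))))
    (≡.trans (cong (_* Defs.dot p 1 (Defs.hList p j)) (inv-inverseʳ (nat≢0 j))) (≡.trans (*-idˡ _) (dot-conv p p 1 j)))

  step₀ : ∀ p z → (p + z) * 1ℚ ≡ p * 1ℚ + z * 1ℚ
  step₀ = solve-∀ ringℚ
  conv-split : ∀ p z g a b → (p + z) * g + (a + b) ≡ (p * g + a) + (z * g + b)
  conv-split = solve-∀ ringℚ
  conv-pull₂ : ∀ z w g a → (z * w) * g + z * a ≡ z * (w * g + a)
  conv-pull₂ = solve-∀ ringℚ
  conv-step₀ : ∀ p h z p′ → p * (h + z * 1ℚ) + p′ * 1ℚ ≡ (p * h + p′ * 1ℚ) + z * (p * 1ℚ)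
  conv-step₀ = solve-∀ ringℚ
  conv-step₁ : ∀ p h z h′ a b → p * (h + z * h′) + (a + z * b) ≡ (p * h + a) + z * (p * h′ + b)
  conv-step₁ = solve-∀ ringℚ
  hom-step₁ : ∀ a z b h c → (a + z * b) + (z * 1ℚ * h + z * c) ≡ a + z * (h + (b + c))
  hom-step₁ = solve-∀ ringℚ
  hom-step₂ : ∀ n h z h′ → (1ℚ + n) * h + z * (h′ + n * h′) ≡ (1ℚ + n) * (h + z * h′)
  hom-step₂ = solve-∀ ringℚ

conv-+ : ∀ {p p′} z g s j → (∀ i → p′ (suc i) ≡ p (suc i) + pow z (suc i)) →
  conv p′ g (suc s) j ≡ conv p g (suc s) j + conv (pow z) g (suc s) j
conv-+ z g s zero    e = ≡.trans (*-congʳ (e s)) (*-distribʳ _ _ _)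
conv-+ z g s (suc j) e = ≡.trans (cong₂ _+_ (*-congʳ (e s)) (conv-+ z g (suc s) j e)) (conv-split _ _ _ _ _)

conv-pow : ∀ z g s j → conv (pow z) g (suc s) j ≡ z * conv (pow z) g s j
conv-pow z g s zero    = *-assoc _ _ _
conv-pow z g s (suc j) = ≡.trans (+-congˡ (conv-pow z g (suc s) j)) (conv-pull₂ _ _ _ _)

module _ {p p′ : ℕ → ℚ} (z : ℚ) (p′≡ : ∀ i → p′ (suc i) ≡ p (suc i) + pow z (suc i)) where

  -- Adding the letter `z` divides the generating function Σ h_j u^j by 1 - z u. `HomStep` is the
  -- coefficientwise form; `ConvStep` is its convolution with `p`, through which Newton's identity
  -- reaches the next degree.
  HomStep ConvStep : ℕ → Set
  HomStep  j = hom p′ (suc j) ≡ hom p (suc j) + z * hom p′ j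
  ConvStep j = ∀ s → conv p (hom p′) s (suc j) ≡ conv p (hom p) s (suc j) + z * conv p (hom p′) s j

  hom-step-0 : HomStep 0
  hom-step-0 = *-cancelˡ (nat≢0 0) (begin
    nat 1 * hom p′ 1                        ≡⟨ newton p′ 0 ⟩
    p′ 1 * hom p′ 0                         ≡⟨ cong₂ _*_ (p′≡ 0) (hom-0 p′) ⟩
    (p 1 + z * 1ℚ) * 1ℚ                     ≡⟨ step₀ _ _ ⟩
    p 1 * 1ℚ + z * 1ℚ * 1ℚ                  ≡⟨ cong₂ _+_ (*-congˡ (sym (hom-0 p))) (≡.trans (*-idʳ _) (*-congˡ (sym (hom-0 p′)))) ⟩
    p 1 * hom p 0 + z * hom p′ 0            ≡⟨ cong₂ _+_ (sym (newton p 0)) (≡.trans (sym (*-idˡ _)) (*-congʳ (sym nat-1))) ⟩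
    nat 1 * hom p 1 + nat 1 * (z * hom p′ 0) ≡⟨ sym (*-distribˡ _ _ _) ⟩
    nat 1 * (hom p 1 + z * hom p′ 0)        ∎)
    where open ≡-Reasoning

  conv-step : ∀ j → HomStep j → (∀ i → suc i ≡ j → ConvStep i) → ConvStep j
  conv-step zero    h c s = ≡.trans (cong₂ (λ a b → p s * a + p (suc s) * b) (≡.trans h (+-congˡ (*-congˡ (hom-0 p′)))) (hom-0 p′))
    (≡.trans (conv-step₀ _ _ _ _) (cong₂ (λ a b → p s * hom p 1 + p (suc s) * a + z * (p s * b)) (sym (hom-0 p)) (sym (hom-0 p′))))
  conv-step (suc j) h c s = ≡.trans (cong₂ (λ a b → p s * a + b) h (c j refl (suc s))) (conv-step₁ _ _ _ _ _ _)

  -- Pulling one `z` out of the convolution with the powers of `z` lowers its start to 1; together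
  -- with the convolution with `p` it becomes Newton's identity for `p′` one degree lower.
  hom-step-suc : ∀ j → ConvStep j → HomStep (suc j)
  hom-step-suc j c = *-cancelˡ (nat≢0 (suc j)) (begin
    nat (2 ℕ.+ j) * hom p′ (2 ℕ.+ j)
      ≡⟨ newton p′ (suc j) ⟩
    conv p′ (hom p′) 1 (suc j)
      ≡⟨ conv-+ z (hom p′) 0 (suc j) p′≡ ⟩
    conv p (hom p′) 1 (suc j) + (z * 1ℚ * hom p′ (suc j) + conv (pow z) (hom p′) 2 j)
      ≡⟨ cong₂ (λ a b → a + (z * 1ℚ * hom p′ (suc j) + b)) (c 1) (conv-pow z (hom p′) 1 j) ⟩
    (conv p (hom p) 1 (suc j) + z * conv p (hom p′) 1 j) + (z * 1ℚ * hom p′ (suc j) + z * conv (pow z) (hom p′) 1 j)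
      ≡⟨ hom-step₁ _ _ _ _ _ ⟩
    conv p (hom p) 1 (suc j) + z * (hom p′ (suc j) + (conv p (hom p′) 1 j + conv (pow z) (hom p′) 1 j))
      ≡⟨ cong₂ (λ a b → a + z * (hom p′ (suc j) + b)) (≡.trans (sym (newton p (suc j))) (*-congʳ (nat-suc (suc j))))
           (≡.trans (sym (conv-+ z (hom p′) 0 j p′≡)) (sym (newton p′ j))) ⟩
    (1ℚ + nat (suc j)) * hom p (2 ℕ.+ j) + z * (hom p′ (suc j) + nat (suc j) * hom p′ (suc j))
      ≡⟨ ≡.trans (hom-step₂ _ _ _ _) (*-congʳ (sym (nat-suc (suc j)))) ⟩
    nat (2 ℕ.+ j) * (hom p (2 ℕ.+ j) + z * hom p′ (suc j)) ∎)
    where open ≡-Reasoning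

  hom-steps : ∀ j → HomStep j × ConvStep j
  hom-steps zero    = hom-step-0 , conv-step 0 hom-step-0 (λ i ())
  hom-steps (suc j) = let h = hom-step-suc j (proj₂ (hom-steps j)) in
    h , conv-step (suc j) h (λ { .j refl → proj₂ (hom-steps j) })

hom-cong : ∀ {p p′} → (∀ i → p (suc i) ≡ p′ (suc i)) → ∀ j → hom p j ≡ hom p′ j
hom-cong {p} {p′} e j = proj₁ (both j)
  where
  Agree : ℕ → Set
  Agree j = hom p j ≡ hom p′ j × (∀ s → conv p (hom p) (suc s) j ≡ conv p′ (hom p′) (suc s) j)
  both : ∀ j → Agree j
  both zero    = h , λ s → cong₂ _*_ (e s) h
    where
    h : hom p 0 ≡ hom p′ 0
    h = ≡.trans (hom-0 p) (sym (hom-0 p′))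
  both (suc j) = h , λ s → cong₂ _+_ (cong₂ _*_ (e s) h) (proj₂ (both j) (suc s))
    where
    h : hom p (suc j) ≡ hom p′ (suc j)
    h = *-cancelˡ (nat≢0 j) (≡.trans (newton p j) (≡.trans (proj₂ (both j) 0) (sym (newton p′ j))))

-- Integer indices and removal of letters

opaque
  unfolding hom

  homℤ : (ℕ → ℚ) → ℤ.ℤ → ℚ
  homℤ = Defs.S

  homℤ-+ : ∀ p j → homℤ p (ℤ.+ j) ≡ hom p j
  homℤ-+ p j = refl

  homℤ-- : ∀ p j → homℤ p ℤ.-[1+ j ] ≡ 0ℚ
  homℤ-- p j = refl

  1-z0 : ∀ z → 1ℚ ≡ 1ℚ - z * 0ℚ
  1-z0 = solve-∀ ringℚ
  0-z0 : ∀ z → 0ℚ ≡ 0ℚ - z * 0ℚ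
  0-z0 = solve-∀ ringℚ
  move-- : ∀ a b → a ≡ (a + b) - b
  move-- = solve-∀ ringℚ
  psum-shuffle : ∀ p w r → p + (w + r) ≡ (p + w) + r
  psum-shuffle = solve-∀ ringℚ

homℤ-cong : ∀ {p p′} → (∀ i → p (suc i) ≡ p′ (suc i)) → ∀ m → homℤ p m ≡ homℤ p′ m
homℤ-cong {p} {p′} e (ℤ.+ j)      = ≡.trans (homℤ-+ p j) (≡.trans (hom-cong e j) (sym (homℤ-+ p′ j)))
homℤ-cong {p} {p′} e ℤ.-[1+ j ] = ≡.trans (homℤ-- p j) (sym (homℤ-- p′ j))

homℤ-step : ∀ {p p′} z → (∀ i → p′ (suc i) ≡ p (suc i) + pow z (suc i)) → ∀ m →
  homℤ p (ℤ.suc m) ≡ homℤ p′ (ℤ.suc m) - z * homℤ p′ m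
homℤ-step {p} {p′} z e (ℤ.+ j) = begin
  homℤ p (ℤ.+ suc j)                                   ≡⟨ homℤ-+ p (suc j) ⟩
  hom p (suc j)                                        ≡⟨ move-- _ _ ⟩
  (hom p (suc j) + z * hom p′ j) - z * hom p′ j        ≡⟨ cong₂ (λ a b → a - z * b) (≡.trans (sym (proj₁ (hom-steps z e j))) (sym (homℤ-+ p′ (suc j)))) (sym (homℤ-+ p′ j)) ⟩
  homℤ p′ (ℤ.+ suc j) - z * homℤ p′ (ℤ.+ j)            ∎
  where open ≡-Reasoning
homℤ-step {p} {p′} z e ℤ.-[1+ zero ] = ≡.trans (≡.trans (homℤ-+ p 0) (hom-0 p)) (≡.trans (1-z0 z)
  (cong₂ (λ a b → a - z * b) (sym (≡.trans (homℤ-+ p′ 0) (hom-0 p′))) (sym (homℤ-- p′ 0))))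
homℤ-step {p} {p′} z e ℤ.-[1+ suc j ] = ≡.trans (homℤ-- p j) (≡.trans (0-z0 z)
  (cong₂ (λ a b → a - z * b) (sym (homℤ-- p′ j)) (sym (homℤ-- p′ (suc j)))))

psum : List ℚ → ℕ → ℚ
psum []       i = 0ℚ
psum (x ∷ xs) i = pow x i + psum xs i

-- Removing the letters zs from an alphabet.
homℤ-apply : ∀ zs {p pG} → (∀ i → pG (suc i) ≡ p (suc i) + psum zs (suc i)) → ∀ m →
  homℤ p (m ℤ.+ ℤ.+ length zs) ≡ apply (λ a → homℤ pG (m ℤ.+ ℤ.+ a)) zs
homℤ-apply []       e m = homℤ-cong (λ i → sym (≡.trans (e i) (+-idʳ _))) _
homℤ-apply (z ∷ zs) {p} {pG} e m = begin
  homℤ p (m ℤ.+ ℤ.+ suc (length zs))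
    ≡⟨ cong (homℤ p) (m+suc (length zs)) ⟩
  homℤ p (ℤ.suc (m ℤ.+ ℤ.+ length zs))
    ≡⟨ homℤ-step z (λ _ → refl) (m ℤ.+ ℤ.+ length zs) ⟩
  homℤ p₁ (ℤ.suc (m ℤ.+ ℤ.+ length zs)) - z * homℤ p₁ (m ℤ.+ ℤ.+ length zs)
    ≡⟨ cong₂ (λ a b → a - z * b)
         (≡.trans (cong (homℤ p₁) (sym (ℤₚ.+-assoc (ℤ.+ 1) m _))) (≡.trans (homℤ-apply zs e₁ (ℤ.suc m))
           (apply-cong zs (λ a → cong (homℤ pG) (≡.trans (ℤₚ.+-assoc (ℤ.+ 1) m (ℤ.+ a)) (sym (m+suc a)))))))
         (homℤ-apply zs e₁ m) ⟩
  apply (λ a → homℤ pG (m ℤ.+ ℤ.+ a)) (z ∷ zs) ∎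
  where
  open ≡-Reasoning
  p₁ : ℕ → ℚ
  p₁ i = p i + pow z i
  e₁ : ∀ i → pG (suc i) ≡ p₁ (suc i) + psum zs (suc i)
  e₁ i = ≡.trans (e i) (psum-shuffle _ _ _)
  m+suc : ∀ a → m ℤ.+ ℤ.+ suc a ≡ ℤ.suc (m ℤ.+ ℤ.+ a)
  m+suc a = ≡.trans (sym (ℤₚ.+-assoc m (ℤ.+ 1) (ℤ.+ a))) (≡.trans (cong (ℤ._+ ℤ.+ a) (ℤₚ.+-comm m (ℤ.+ 1))) (ℤₚ.+-assoc (ℤ.+ 1) m (ℤ.+ a)))

-- Sums restricted by indicators

ind : Bool → ℚ → ℚ
ind true  a = a
ind false a = 0ℚ

ind-* : ∀ b c a → c * ind b a ≡ ind b (c * a)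
ind-* true  c a = refl
ind-* false c a = *-zeroʳ c

ind-*ʳ : ∀ b c a → ind b a * c ≡ ind b (a * c)
ind-*ʳ true  c a = refl
ind-*ʳ false c a = *-zeroˡ c

ind-0 : ∀ b → ind b 0ℚ ≡ 0ℚ
ind-0 true  = refl
ind-0 false = refl

ind-comm : ∀ b c a → ind b (ind c a) ≡ ind c (ind b a)
ind-comm true  c a = refl
ind-comm false c a = sym (ind-0 c)

ind-cong : ∀ b {a a′} → (b ≡ true → a ≡ a′) → ind b a ≡ ind b a′
ind-cong true  e = e refl
ind-cong false e = refl

Σsub-ind : ∀ n b f → Σsub n (λ S → ind b (f S)) ≡ ind b (Σsub n f)
Σsub-ind n true  f = refl
Σsub-ind n false f = Σsub-0 n

Σf-ind : ∀ n b f → Σf n (λ i → ind b (f i)) ≡ ind b (Σf n f)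
Σf-ind n true  f = refl
Σf-ind n false f = Σf-0 n (λ _ → refl)

Σf-pick : ∀ k m (f : ℕ → ℚ) → m ℕ.≤ k → Σf (suc k) (λ l → ind (m ℕ.≡ᵇ toℕ l) (f (toℕ l))) ≡ f m
Σf-pick k zero f le = ≡.trans (Σf-suc k _) (≡.trans (+-congˡ (Σf-0 k (λ _ → refl))) (+-idʳ _))
Σf-pick (suc k) (suc m) f (ℕ.s≤s le) = ≡.trans (Σf-suc (suc k) _) (≡.trans (+-idˡ _) (Σf-pick k m (f ∘ suc) le))

Σsub-empty : ∀ n (f : Subset n → ℚ) → Σsub n (λ S → ind (∣ S ∣ ℕ.≡ᵇ 0) (f S)) ≡ f ⊥
Σsub-empty zero    f = refl
Σsub-empty (suc n) f = ≡.trans (cong₂ _+_ (Σsub-empty n (λ S → f (outside ∷ S))) (Σsub-0 n)) (+-idʳ _)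

≡ᵇ-sound : ∀ m n → (m ℕ.≡ᵇ n) ≡ true → m ≡ n
≡ᵇ-sound m n e = ℕₚ.≡ᵇ⇒≡ m n (subst T′ (sym e) tt)
  where
  open import Data.Bool using () renaming (T to T′)

-- Pairs of nested subsets as ternary splittings

between : ∀ {n} → Subset n → Subset n → Vec ℚ n → List ℚ
between []            []            []       = []
between (inside  ∷ I) (outside ∷ J) (x ∷ xs) = x ∷ between I J xs
between (inside  ∷ I) (inside  ∷ J) (x ∷ xs) = between I J xs
between (outside ∷ I) (_       ∷ J) (x ∷ xs) = between I J xs

Split-between : ∀ {n} (I J : Subset n) (xs : Vec ℚ n) → (J Defs.⊆ᵇ I) ≡ true →
  Split (members J xs) (between I J xs) (members I xs)
Split-between []            []            []       e = []
Split-between (inside  ∷ I) (outside ∷ J) (x ∷ xs) e = right (Split-between I J xs e)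
Split-between (inside  ∷ I) (inside  ∷ J) (x ∷ xs) e = left (Split-between I J xs e)
Split-between (outside ∷ I) (outside ∷ J) (x ∷ xs) e = Split-between I J xs e

Split-outside : ∀ {n} (I J : Subset n) (xs : Vec ℚ n) → (J Defs.⊆ᵇ I) ≡ true →
  Split (between I J xs) (nonmembers I xs) (nonmembers J xs)
Split-outside []            []            []       e = []
Split-outside (inside  ∷ I) (outside ∷ J) (x ∷ xs) e = left (Split-outside I J xs e)
Split-outside (inside  ∷ I) (inside  ∷ J) (x ∷ xs) e = Split-outside I J xs e
Split-outside (outside ∷ I) (outside ∷ J) (x ∷ xs) e = right (Split-outside I J xs e)

opaque
  unfolding _+_

  ternary-shuffle : ∀ a b c → (a + 0ℚ) + (b + c) ≡ c + (b + a)
  ternary-shuffle = solve-∀ ringℚ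

-- Each variable lies in `J`, in `I` but not `J`, or outside `I`; the fourth combination is killed
-- by the indicator. The order of summation is reversed, so that the sum over `I` becomes the inner
-- one.
ternary : ∀ {n} (xs : Vec ℚ n) (f : List ℚ → List ℚ → List ℚ → List ℚ → ℚ) →
  Σsub n (λ I → Σsub n (λ J → ind (J Defs.⊆ᵇ I) (f (members J xs) (nonmembers J xs) (between I J xs) (nonmembers I xs))))
  ≡ Σsplit (toList xs) (λ J R → Σsplit R (λ K L → f J R K L))
ternary []       f = refl
ternary {suc n} (x ∷ xs) f = ≡.trans
  (cong₂ _+_
    (≡.trans (Σsub-+ n _ _) (cong₂ _+_ (ternary xs (λ J R K L → f J (x ∷ R) K (x ∷ L))) (≡.trans (Σsub-cong n (λ _ → Σsub-0 n)) (Σsub-0 n))))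
    (≡.trans (Σsub-+ n _ _) (cong₂ _+_ (ternary xs (λ J R K L → f J (x ∷ R) (x ∷ K) L)) (ternary xs (λ J R K L → f (x ∷ J) R K L)))))
  (≡.trans (ternary-shuffle _ _ _) (+-congˡ (sym (Σsplit-+ (toList xs) _ _))))

length-members : ∀ {n} (S : Subset n) (xs : Vec ℚ n) → ∣ S ∣ ≡ length (members S xs)
length-members []            []       = refl
length-members (inside  ∷ S) (x ∷ xs) = cong suc (length-members S xs)
length-members (outside ∷ S) (x ∷ xs) = length-members S xs

⊥⊆ : ∀ {n} (I : Subset n) → (⊥ Defs.⊆ᵇ I) ≡ true
⊥⊆ []      = refl
⊥⊆ (_ ∷ I) = ⊥⊆ I

members-⊥ : ∀ {n} (xs : Vec ℚ n) → members ⊥ xs ≡ []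
members-⊥ []       = refl
members-⊥ (x ∷ xs) = members-⊥ xs

nonmembers-⊥ : ∀ {n} (xs : Vec ℚ n) → nonmembers ⊥ xs ≡ toList xs
nonmembers-⊥ []       = refl
nonmembers-⊥ (x ∷ xs) = cong (x ∷_) (nonmembers-⊥ xs)

isIn-lookup : ∀ {n} (S : Subset n) i → Defs.isIn S i ≡ lookup S i
isIn-lookup S i with lookup S i
... | inside  = refl
... | outside = refl

-- Translation of the given definitions into the opaque operations

opaque
  unfolding _+_ Σf det hom homℤ

  pow≡ : ∀ a n → a Defs.^ℚ n ≡ pow a n
  pow≡ a zero    = refl
  pow≡ a (suc n) = cong (a *_) (pow≡ a n)

  Σ≡ : ∀ m f → (Defs.Σ[ m ] f) ≡ Σf m f
  Σ≡ m f = ≡.trans (cong Defs.sumL (Listₚ.map-tabulate (λ i → i) f)) (go m f)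
    where
    go : ∀ m f → Defs.sumL (tabulate f) ≡ Σf m f
    go zero    f = refl
    go (suc m) f = cong (f zero +_) (go m (f ∘ suc))

  Π≡ : ∀ m f → (Defs.Π[ m ] f) ≡ Πf m f
  Π≡ m f = ≡.trans (cong Defs.prodL (Listₚ.map-tabulate (λ i → i) f)) (go m f)
    where
    go : ∀ m f → Defs.prodL (tabulate f) ≡ Πf m f
    go zero    f = refl
    go (suc m) f = cong (f zero *_) (go m (f ∘ suc))

  sgn≡ : ∀ {m} (c : Fin m) → (- 1ℚ) Defs.^ℚ toℕ c ≡ sgn c
  sgn≡ zero    = refl
  sgn≡ (suc c) = cong (- 1ℚ *_) (sgn≡ c)

  det≡ : ∀ k A → Defs.det k A ≡ det k A
  det≡ zero    A = refl
  det≡ (suc k) A = ≡.trans (Σ≡ (suc k) (λ c → ((- 1ℚ) Defs.^ℚ toℕ c) * A zero c * Defs.det k (minor c A)))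
    (Σf-cong (suc k) {λ c → ((- 1ℚ) Defs.^ℚ toℕ c) * A zero c * Defs.det k (minor c A)} (λ c → cong₂ (λ a b → a * A zero c * b) (sgn≡ c) (det≡ k (minor c A))))

  S≡ : ∀ p m → Defs.S p m ≡ homℤ p m
  S≡ p m = refl

  sumL-++ : ∀ as bs → Defs.sumL (as ++ bs) ≡ Defs.sumL as + Defs.sumL bs
  sumL-++ []       bs = sym (+-idˡ _)
  sumL-++ (a ∷ as) bs = ≡.trans (cong (a +_) (sumL-++ as bs)) (sym (+-assoc a (Defs.sumL as) (Defs.sumL bs)))

  Σsub≡ : ∀ n f → Defs.sumL (map f (Defs.subsets n)) ≡ Σsub n f
  Σsub≡ zero    f = +-idʳ _
  Σsub≡ (suc n) f = ≡.trans (cong Defs.sumL (Listₚ.map-++ f (map (outside ∷_) (Defs.subsets n)) _)) (≡.trans (sumL-++ (map f (map (outside ∷_) (Defs.subsets n))) _)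
    (cong₂ _+_ (≡.trans (cong Defs.sumL (sym (Listₚ.map-∘ (Defs.subsets n)))) (Σsub≡ n (f ∘ (outside ∷_))))
               (≡.trans (cong Defs.sumL (sym (Listₚ.map-∘ (Defs.subsets n)))) (Σsub≡ n (f ∘ (inside ∷_))))))

  sumL-filter : ∀ {X : Set} (b : X → Bool) (f : X → ℚ) xs → Defs.sumL (map f (filterᵇ b xs)) ≡ Defs.sumL (map (λ x → ind (b x) (f x)) xs)
  sumL-filter b f []       = refl
  sumL-filter b f (x ∷ xs) with b x
  ... | true  = cong (f x +_) (sumL-filter b f xs)
  ... | false = ≡.trans (sumL-filter b f xs) (sym (+-idˡ _))

  M-suc : ∀ {n} q t (I : Subset n) l F x → Defs.M q t I (suc l) F x ≡
    pow t (Defs.choose2 (suc l)) * Σsub n (λ J → ind (∣ J ∣ ℕ.≡ᵇ suc l) (ind (J Defs.⊆ᵇ I)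
      (Defs.ΠΠ (Defs.isIn J) (λ j → Defs.isIn I j ∧ not (Defs.isIn J j)) (λ i j → (t * x i - x j) * inv (x i - x j)) * F (Defs.ΘS q J x))))
  M-suc {n} q t I l F x = cong₂ _*_ (pow≡ t (Defs.choose2 (suc l)))
    (≡.trans (sumL-filter (λ J → J Defs.⊆ᵇ I) _ (Defs.subsetsOfSize n (suc l))) (≡.trans (sumL-filter (λ J → ∣ J ∣ ℕ.≡ᵇ suc l) _ (Defs.subsets n)) (Σsub≡ n _)))

  B≡ : ∀ n q t k F x → Defs.B n q t k F x ≡ Σsub n (λ I → ind (∣ I ∣ ℕ.≡ᵇ k)
    (Σf (suc k) (λ l → pow (- t) (toℕ l) * Defs.xPow I x * Defs.RIct t I x * inv (Defs.RIc I x) * Defs.M q t I (toℕ l) F x)))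
  B≡ n q t k F x = ≡.trans (sumL-filter (λ I → ∣ I ∣ ℕ.≡ᵇ k) _ (Defs.subsets n)) (≡.trans (Σsub≡ n _)
    (Σsub-cong n (λ I → cong (ind (∣ I ∣ ℕ.≡ᵇ k)) (≡.trans (Σ≡ (suc k) (term I)) (Σf-cong (suc k) {term I} (λ l →
      cong (λ a → a * Defs.xPow I x * Defs.RIct t I x * inv (Defs.RIc I x) * Defs.M q t I (toℕ l) F x) (pow≡ (- t) (toℕ l))))))))
    where
    term : Subset n → Fin (suc k) → ℚ
    term I l = ((- t) Defs.^ℚ toℕ l) * Defs.xPow I x * Defs.RIct t I x * inv (Defs.RIc I x) * Defs.M q t I (toℕ l) F x

  xPow≡ : ∀ {n} (I : Subset n) x → Defs.xPow I x ≡ Πf n (λ i → if Defs.isIn I i then x i else 1ℚ)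
  xPow≡ {n} I x = Π≡ n (λ i → if Defs.isIn I i then x i else 1ℚ)

  ΠΠ≡ : ∀ {n} A B (g : Fin n → Fin n → ℚ) → Defs.ΠΠ A B g ≡ Πf n (λ i → if A i then Πf n (λ j → if B j then g i j else 1ℚ) else 1ℚ)
  ΠΠ≡ {n} A B g = ≡.trans (Π≡ n (λ i → if A i then Defs.Π[ n ] (λ j → if B j then g i j else 1ℚ) else 1ℚ))
    (Πf-cong n (λ i → cong (λ e → if A i then e else 1ℚ) (Π≡ n (λ j → if B j then g i j else 1ℚ))))

  RIct≡ : ∀ {n} t (I : Subset n) x → Defs.RIct t I x ≡ Defs.ΠΠ (Defs.isIn I) (λ j → not (Defs.isIn I j)) (λ i j → x i - x j * inv t)
  RIct≡ t I x = refl

  RIc≡ : ∀ {n} (I : Subset n) x → Defs.RIc I x ≡ Defs.ΠΠ (Defs.isIn I) (λ j → not (Defs.isIn I j)) (λ i j → x i - x j)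
  RIc≡ I x = refl

  pX≡ : ∀ {n} (x : Fin n → ℚ) i → Defs.pX x i ≡ Σf n (λ m → pow (x m) i)
  pX≡ {n} x i = ≡.trans (Σ≡ n (λ m → x m Defs.^ℚ i)) (Σf-cong n {λ m → x m Defs.^ℚ i} (λ m → pow≡ (x m) i))

  pXtq≡ : ∀ {n} q t (x : Fin n → ℚ) i → Defs.pXtq q t x i ≡ Defs.pX x i * (pow t i - 1ℚ) * inv (pow q i - 1ℚ)
  pXtq≡ q t x i = cong₂ (λ a b → Defs.pX x i * (a - 1ℚ) * inv (b - 1ℚ)) (pow≡ t i) (pow≡ q i)

  pXtqXt≡ : ∀ {n} q t (x : Fin n → ℚ) i → Defs.pXtqXt q t x i ≡ Defs.pXtq q t x i + Defs.pX x i * (pow t i - 1ℚ)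
  pXtqXt≡ q t x i = cong (λ a → Defs.pXtq q t x i + Defs.pX x i * (a - 1ℚ)) (pow≡ t i)

  ΘS≡ : ∀ {n} q (J : Subset n) x i → Defs.ΘS q J x i ≡ (if lookup J i then q * x i else x i)
  ΘS≡ q J x i = cong (λ b → if b then q * x i else x i) (isIn-lookup J i)

  RHS≡ : ∀ n k q t lam x → Defs.RHS n k q t lam x ≡
    det k (λ r c → homℤ (Defs.pXtq q t x) (Defs.idx lam r c 1) - pow t (k ℕ.∸ suc (toℕ c)) * homℤ (Defs.pXtqXt q t x) (Defs.idx lam r c 1))
  RHS≡ n k q t lam x = ≡.trans (det≡ k _) (det-cong k (λ r c →
    cong (λ a → homℤ (Defs.pXtq q t x) (Defs.idx lam r c 1) - a * homℤ (Defs.pXtqXt q t x) (Defs.idx lam r c 1)) (pow≡ t (k ℕ.∸ suc (toℕ c)))))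

opaque
  unfolding _+_

  -- The i-th power sums behind `roots`: a and b belong to the shifted and unshifted variables, Q =
  -- q^i, τ = t^i, and d is the inverse of Q - 1.
  theta-alphabet : ∀ a b τ Q d → (Q - 1ℚ) * d ≡ 1ℚ →
    (a + b) * (τ - 1ℚ) * d + τ * (a + b) ≡ (Q * a + b) * (τ - 1ℚ) * d + (a + τ * b)
  theta-alphabet a b τ Q d e = ≡.trans (lhs a b τ Q d) (≡.trans (cong (λ u → (Q * a + b) * (τ - 1ℚ) * d + (τ * (a + b) - a * (τ - 1ℚ) * u)) e) (rhs a b τ Q d))
    where
    lhs : ∀ a b τ Q d → (a + b) * (τ - 1ℚ) * d + τ * (a + b) ≡ (Q * a + b) * (τ - 1ℚ) * d + (τ * (a + b) - a * (τ - 1ℚ) * ((Q - 1ℚ) * d))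
    lhs = solve-∀ ringℚ
    rhs : ∀ a b τ Q d → (Q * a + b) * (τ - 1ℚ) * d + (τ * (a + b) - a * (τ - 1ℚ) * 1ℚ) ≡ (Q * a + b) * (τ - 1ℚ) * d + (a + τ * b)
    rhs = solve-∀ ringℚ
  shifted-alphabet : ∀ P a τ → P + τ * a ≡ (P + a * (τ - 1ℚ)) + a
  shifted-alphabet = solve-∀ ringℚ
  psum-left : ∀ Q a s r → Q * a + (Q * s + r) ≡ Q * (a + s) + r
  psum-left = solve-∀ ringℚ
  psum-right : ∀ Q a s r → a + (Q * s + r) ≡ Q * s + (a + r)
  psum-right = solve-∀ ringℚ
  flip-τ : ∀ i j τ v → (i - j * τ) * v ≡ (1ℚ * i - τ * j) * v
  flip-τ = solve-∀ ringℚ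
  pull-τ : ∀ i j t τ v → τ * t ≡ 1ℚ → (1ℚ * i - τ * j) * v ≡ τ * ((t * i - 1ℚ * j) * v)
  pull-τ i j t τ v e = ≡.trans (cong (λ u → (u * i - τ * j) * v) (sym e)) (go i j t τ v)
    where
    go : ∀ i j t τ v → (τ * t * i - τ * j) * v ≡ τ * ((t * i - 1ℚ * j) * v)
    go = solve-∀ ringℚ
  κ-coefficient : ∀ t A P C c D → (- t * A) * (P * C) * (c * D) ≡ - (t * c) * P * (A * C * D)
  κ-coefficient = solve-∀ ringℚ
  triv-coefficient : 1ℚ * 1ℚ * 1ℚ ≡ 1ℚ
  triv-coefficient = refl
  gather-l : ∀ A X R Ri C S → A * X * R * Ri * (C * S) ≡ (X * (R * Ri)) * ((A * C) * S)
  gather-l = solve-∀ ringℚ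
  gather-term : ∀ PJ PK D TL TK A TJK v →
    ((PJ * PK) * ((D * TL) * TK)) * (A * (TJK * v)) ≡ ((A * D) * (TJK * TL) * v) * ((PJ * PK) * TK)
  gather-term = solve-∀ ringℚ
  final-arrange : ∀ κ T v e → (κ * T * v) * e ≡ (κ * e * T) * v
  final-arrange = solve-∀ ringℚ
  st-arrange : ∀ t a b c → t * a * (b * c) ≡ t * ((a * b) * c)
  st-arrange = solve-∀ ringℚ
  pow-inv-step : ∀ τ a t b → (τ * a) * (t * b) ≡ (τ * t) * (a * b)
  pow-inv-step = solve-∀ ringℚ
  E-term : ∀ x J K T → x * J * K * T ≡ x * (J * K * T)
  E-term = solve-∀ ringℚ
  mono-zero : 1ℚ * 1ℚ ≡ 1ℚ
  mono-zero = refl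
  mono-suc : ∀ x K → 1ℚ * (x * K) ≡ x * (1ℚ * K)
  mono-suc = solve-∀ ringℚ

-- Products and power sums over subsets

Πf-members : ∀ {n} (S : Subset n) x (h : ℚ → ℚ) → Πf n (λ i → if Defs.isIn S i then h (x i) else 1ℚ) ≡ Πl h (members S (Vec.tabulate x))
Πf-members S x h = ≡.trans (Πf-cong _ (λ i → cong (λ b → if b then h (x i) else 1ℚ) (isIn-lookup S i))) (go S x)
  where
  go : ∀ {n} (S : Subset n) x → Πf n (λ i → if lookup S i then h (x i) else 1ℚ) ≡ Πl h (members S (Vec.tabulate x))
  go []            x = refl
  go (inside  ∷ S) x = *-congˡ (go S (x ∘ suc))
  go (outside ∷ S) x = ≡.trans (*-idˡ _) (go S (x ∘ suc))

Πf-nonmembers : ∀ {n} (S : Subset n) x (h : ℚ → ℚ) → Πf n (λ i → if not (Defs.isIn S i) then h (x i) else 1ℚ) ≡ Πl h (nonmembers S (Vec.tabulate x))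
Πf-nonmembers S x h = ≡.trans (Πf-cong _ (λ i → cong (λ b → if not b then h (x i) else 1ℚ) (isIn-lookup S i))) (go S x)
  where
  go : ∀ {n} (S : Subset n) x → Πf n (λ i → if not (lookup S i) then h (x i) else 1ℚ) ≡ Πl h (nonmembers S (Vec.tabulate x))
  go []            x = refl
  go (inside  ∷ S) x = ≡.trans (*-idˡ _) (go S (x ∘ suc))
  go (outside ∷ S) x = *-congˡ (go S (x ∘ suc))

Πf-between : ∀ {n} (I J : Subset n) x (h : ℚ → ℚ) →
  Πf n (λ i → if Defs.isIn I i ∧ not (Defs.isIn J i) then h (x i) else 1ℚ) ≡ Πl h (between I J (Vec.tabulate x))
Πf-between I J x h = ≡.trans (Πf-cong _ (λ i → cong₂ (λ a b → if a ∧ not b then h (x i) else 1ℚ) (isIn-lookup I i) (isIn-lookup J i))) (go I J x)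
  where
  go : ∀ {n} (I J : Subset n) x → Πf n (λ i → if lookup I i ∧ not (lookup J i) then h (x i) else 1ℚ) ≡ Πl h (between I J (Vec.tabulate x))
  go []            []            x = refl
  go (inside  ∷ I) (inside  ∷ J) x = ≡.trans (*-idˡ _) (go I J (x ∘ suc))
  go (inside  ∷ I) (outside ∷ J) x = *-congˡ (go I J (x ∘ suc))
  go (outside ∷ I) (_       ∷ J) x = ≡.trans (*-idˡ _) (go I J (x ∘ suc))

xPow-members : ∀ {n} (I : Subset n) x → Defs.xPow I x ≡ Πl (λ a → a) (members I (Vec.tabulate x))
xPow-members I x = ≡.trans (xPow≡ I x) (Πf-members I x (λ a → a))

ΠΠ-members : ∀ {n} (S : Subset n) x (B : Fin n → Bool) (g : ℚ → ℚ → ℚ) (ys : List ℚ) →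
  (∀ h → Πf n (λ i → if B i then h (x i) else 1ℚ) ≡ Πl h ys) →
  Defs.ΠΠ (Defs.isIn S) B (λ i j → g (x i) (x j)) ≡ Πl (λ a → Πl (g a) ys) (members S (Vec.tabulate x))
ΠΠ-members S x B g ys e = ≡.trans (ΠΠ≡ (Defs.isIn S) B (λ i j → g (x i) (x j)))
  (≡.trans (Πf-cong _ (λ i → cong (λ u → if Defs.isIn S i then u else 1ℚ) (e (g (x i))))) (Πf-members S x (λ a → Πl (g a) ys)))

pow-* : ∀ a b i → pow (a * b) i ≡ pow a i * pow b i
pow-* a b zero    = sym (*-idˡ 1ℚ)
pow-* a b (suc i) = ≡.trans (*-congˡ (pow-* a b i)) (*-interchange _ _ _ _)

pow-+ : ∀ a m n → pow a (m ℕ.+ n) ≡ pow a m * pow a n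
pow-+ a zero    n = sym (*-idˡ _)
pow-+ a (suc m) n = ≡.trans (*-congˡ (pow-+ a m n)) (sym (*-assoc _ _ _))

pX-psum : ∀ {n} (x : Fin n → ℚ) i → Defs.pX x i ≡ psum (toList (Vec.tabulate x)) i
pX-psum x i = ≡.trans (pX≡ x i) (go x)
  where
  go : ∀ {n} (x : Fin n → ℚ) → Σf n (λ m → pow (x m) i) ≡ psum (toList (Vec.tabulate x)) i
  go {zero}  x = Σf-zero _
  go {suc n} x = ≡.trans (Σf-suc n _) (+-congˡ (go (x ∘ suc)))

pX-Θ : ∀ {n} q (J : Subset n) x i →
  Defs.pX (Defs.ΘS q J x) i ≡ pow q i * psum (members J (Vec.tabulate x)) i + psum (nonmembers J (Vec.tabulate x)) i
pX-Θ q J x i = ≡.trans (pX≡ (Defs.ΘS q J x) i) (≡.trans (Σf-cong _ (λ m → cong (λ a → pow a i) (ΘS≡ q J x m))) (go J x))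
  where
  go : ∀ {n} (J : Subset n) x → Σf n (λ m → pow (if lookup J m then q * x m else x m) i) ≡
    pow q i * psum (members J (Vec.tabulate x)) i + psum (nonmembers J (Vec.tabulate x)) i
  go []            x = ≡.trans (Σf-zero _) (sym (≡.trans (+-idʳ _) (*-zeroʳ _)))
  go (inside  ∷ J) x = ≡.trans (Σf-suc _ _) (≡.trans (cong₂ _+_ (pow-* q (x zero) i) (go J (x ∘ suc))) (psum-left _ _ _ _))
  go (outside ∷ J) x = ≡.trans (Σf-suc _ _) (≡.trans (+-congˡ (go J (x ∘ suc))) (psum-right _ _ _ _))

psum-++ : ∀ J L i → psum (J ++ L) i ≡ psum J i + psum L i
psum-++ []      L i = sym (+-idˡ _)
psum-++ (x ∷ J) L i = ≡.trans (+-congˡ (psum-++ J L i)) (sym (+-assoc _ _ _))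

psum-scale : ∀ t L i → psum (map (t *_) L) i ≡ pow t i * psum L i
psum-scale t []      i = sym (*-zeroʳ _)
psum-scale t (x ∷ L) i = ≡.trans (cong₂ _+_ (pow-* t x i) (psum-scale t L i)) (sym (*-distribˡ _ _ _))

psum-Split : ∀ {J L xs} → Split J L xs → ∀ i → psum xs i ≡ psum J i + psum L i
psum-Split []        i = sym (+-idˡ _)
psum-Split (left s)  i = ≡.trans (+-congˡ (psum-Split s i)) (sym (+-assoc _ _ _))
psum-Split (right s) i = ≡.trans (+-congˡ (psum-Split s i)) (≡.trans (sym (+-assoc _ _ _)) (≡.trans (+-congʳ (+-comm _ _)) (+-assoc _ _ _)))

inv-* : ∀ {a b} → a ≢ 0ℚ → b ≢ 0ℚ → inv (a * b) ≡ inv a * inv b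
inv-* {a} {b} a≢0 b≢0 = *-cancelˡ (*-≢0 a≢0 b≢0) (≡.trans (inv-inverseʳ (*-≢0 a≢0 b≢0))
  (sym (≡.trans (*-interchange _ _ _ _) (≡.trans (cong₂ _*_ (inv-inverseʳ a≢0) (inv-inverseʳ b≢0)) (*-idˡ 1ℚ)))))

inv-Πl : ∀ {h} xs → All (λ x → h x ≢ 0ℚ) xs → inv (Πl h xs) ≡ Πl (λ x → inv (h x)) xs
inv-Πl []       []       = ≡.trans (sym (*-idˡ _)) (inv-inverseʳ (λ ()))
inv-Πl (x ∷ xs) (n ∷ ns) = ≡.trans (inv-* n (Πl-≢0 xs ns)) (*-congˡ (inv-Πl xs ns))

Split-disjoint : ∀ {J L xs} → Split J L xs → Unique xs → All (λ i → All (i ≢_) L) J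
Split-disjoint []        u        = []
Split-disjoint (left s)  (x∉ ∷ u) = proj₂ (Split-All s x∉) ∷ Split-disjoint s u
Split-disjoint (right s) (x∉ ∷ u) = All.zipWith (λ (n , m) → (λ e → n (sym e)) ∷ m) (proj₁ (Split-All s x∉) , Split-disjoint s u)

-- The quotient of the two products R in `B`, with `τ` for 1/t; disjointness of the parts allows
-- inversion factor by factor.
ratio : ∀ τ J L → All (λ i → All (i ≢_) L) J →
  Πl (λ i → Πl (λ j → i - j * τ) L) J * inv (Πl (λ i → Πl (λ j → i - j) L) J) ≡ T 1ℚ τ J L
ratio τ J L d = ≡.trans (*-congˡ (inv-Πl J (All.map (λ n → Πl-≢0 L (All.map x-y≢0 n)) d)))
  (≡.trans (sym (Πl-* _ _ J)) (Πl-cong J (All.map (λ {i} n → ≡.trans (*-congˡ (inv-Πl L (All.map x-y≢0 n)))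
    (≡.trans (sym (Πl-* _ _ L)) (Πl-cong′ L (λ j → flip-τ i j τ (inv (i - j)))))) d)))

-- Brings the factors of `B` between `J` and the complement of `I` to the form of those in the
-- Macdonald operator. The price τ^(|J||L|) is τ^|L| per element of `J` and goes into `s`.
T-rescale : ∀ t τ → τ * t ≡ 1ℚ → ∀ J L → T 1ℚ τ J L ≡ Πl (λ _ → Πl (λ _ → τ) L) J * T t 1ℚ J L
T-rescale t τ e J L = ≡.trans (Πl-cong′ J (λ i → ≡.trans (Πl-cong′ L (λ j → pull-τ i j t τ (inv (i - j)) e)) (Πl-* (λ _ → τ) _ L))) (Πl-* _ _ J)

T-Splitʳ : ∀ a b J {K L R} → Split K L R → T a b J R ≡ T a b J K * T a b J L
T-Splitʳ a b J s = ≡.trans (Πl-cong′ J (λ i → Split-Πl _ s)) (Πl-* _ _ J)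

κ-pow : ∀ t c J → pow (- t) (length J) * pow t (Defs.choose2 (length J)) * Πl (λ _ → c) J ≡ κ (t * c) t J
κ-pow t c []      = triv-coefficient
κ-pow t c (x ∷ J) = ≡.trans (*-congʳ (*-congˡ (≡.trans (pow-+ t (length J) _) (*-congʳ (sym (Πl-const t J))))))
  (≡.trans (κ-coefficient _ _ _ _ _ _) (*-congˡ (κ-pow t c J)))

pow-inv : ∀ t τ → τ * t ≡ 1ℚ → ∀ m → pow τ m * pow t m ≡ 1ℚ
pow-inv t τ e zero    = *-idˡ 1ℚ
pow-inv t τ e (suc m) = ≡.trans (pow-inv-step _ _ _ _) (≡.trans (cong₂ _*_ e (pow-inv t τ e m)) (*-idˡ 1ℚ))

mono-E : ∀ K k → ind (length K ℕ.≡ᵇ k) (1ℚ * Πl (λ a → a) K) ≡ E K [] k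
mono-E []      zero    = mono-zero
mono-E []      (suc k) = refl
mono-E (x ∷ K) zero    = sym (*-zeroʳ x)
mono-E (x ∷ K) (suc k) = ≡.trans (cong (ind (length K ℕ.≡ᵇ k)) (mono-suc x _)) (≡.trans (sym (ind-* (length K ℕ.≡ᵇ k) x _)) (*-congˡ (mono-E K k)))

-- An element of `J` contributes its factor and raises the size by one, which is the recursion of
-- `E`; for empty `J` the sum is the Hall-Littlewood formula.
sum-over-K : ∀ τ R → Unique R → ∀ J k →
  Σsplit R (λ K L → ind (length J ℕ.+ length K ℕ.≡ᵇ k) ((Πl (λ a → a) J * Πl (λ a → a) K) * T 1ℚ τ K L)) ≡ E J R k
sum-over-K τ R u [] k = ≡.trans (Σsplit-cong R (λ {K} {L} _ →
  ≡.trans (sym (ind-*ʳ (length K ℕ.≡ᵇ k) (T 1ℚ τ K L) _)) (*-congʳ (mono-E K k)))) (hall-littlewood τ R u k)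
sum-over-K τ R u (x ∷ J) zero    = ≡.trans (Σsplit-0 R) (sym (*-zeroʳ x))
sum-over-K τ R u (x ∷ J) (suc k) = ≡.trans (Σsplit-cong R (λ {K} {L} _ →
  ≡.trans (cong (ind (length J ℕ.+ length K ℕ.≡ᵇ k)) (E-term x _ _ _)) (sym (ind-* (length J ℕ.+ length K ℕ.≡ᵇ k) x _))))
  (≡.trans (Σsplit-* R x _) (*-congˡ (sum-over-K τ R u J k)))

-- The theorem at a given point

opaque
  ℤ-shift : ∀ a n c → (a ℤ.- n ℤ.+ c) ℤ.+ n ≡ a ℤ.+ c ℤ.+ ℤ.+ 0
  ℤ-shift = solveℤ-∀
  ℤ-shift₁ : ∀ a n c → (a ℤ.- n ℤ.+ (ℤ.+ 1 ℤ.+ c)) ℤ.+ n ≡ a ℤ.+ c ℤ.+ ℤ.+ 1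
  ℤ-shift₁ = solveℤ-∀

module Assembly (n k : ℕ) (k≤n : k ℕ.≤ n) (lam : Fin k → ℕ) (q t : ℚ) (x : Fin n → ℚ)
  (distinct : ∀ (i j : Fin n) → i ≢ j → x i ≢ x j)
  (q≢1 : ∀ (m : ℕ) → q Defs.^ℚ suc m ≢ 1ℚ) (t≢0 : t ≢ 0ℚ) where

  xv : Vec ℚ n
  xv = Vec.tabulate x

  xs : List ℚ
  xs = toList xv

  unique-xs : Unique xs
  unique-xs = go x distinct
    where
    fresh-head : ∀ {n} a (x : Fin n → ℚ) → (∀ i → a ≢ x i) → All (a ≢_) (toList (Vec.tabulate x))
    fresh-head {zero}  a x h = []
    fresh-head {suc n} a x h = h zero ∷ fresh-head a (x ∘ suc) (h ∘ suc)
    go : ∀ {n} (x : Fin n → ℚ) → (∀ i j → i ≢ j → x i ≢ x j) → Unique (toList (Vec.tabulate x))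
    go {zero}  x d = []
    go {suc n} x d = fresh-head (x zero) (x ∘ suc) (λ i → d zero (suc i) (λ ())) ∷ go (x ∘ suc) (λ i j i≢j → d (suc i) (suc j) (i≢j ∘ Finₚ.suc-injective))

  τ s : ℚ
  τ = inv t
  -- The `t` comes from (-t)^l in `B`; the rest is one `τ` for each of the n - k variables outside
  -- `I`, by `T-rescale`.
  s = t * pow τ (n ℕ.∸ k)

  τt : τ * t ≡ 1ℚ
  τt = inv-inverseˡ t≢0

  length-xs : length xs ≡ n
  length-xs = Vecₚ.length-toList xv

  st : s * Πl (λ _ → t) xs ≡ t * pow t k
  st = ≡.trans (*-congˡ (≡.trans (Πl-const t xs) (≡.trans (cong (pow t) (≡.trans length-xs (sym (ℕₚ.m∸n+n≡m k≤n)))) (pow-+ t (n ℕ.∸ k) k))))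
    (≡.trans (st-arrange _ _ _ _) (*-congˡ (≡.trans (*-congʳ (pow-inv t τ τt (n ℕ.∸ k))) (*-idˡ _))))

  alphabet : ℕ → ℚ
  alphabet i = Defs.pXtq q t x i + psum (map (t *_) xs) i

  offset : Fin k → ℤ.ℤ
  offset r = ℤ.+ lam r ℤ.- ℤ.+ toℕ r

  -- Removing n letters applies a polynomial of degree n, so the moments begin n below the index of
  -- the determinant entry.
  γ : Fin k → ℕ → ℚ
  γ r a = homℤ alphabet ((offset r ℤ.- ℤ.+ n) ℤ.+ ℤ.+ a)

  γs : Vec (ℕ → ℚ) k
  γs = Vec.tabulate γ

  entry : ∀ {p} zs → length zs ≡ n → (∀ i → alphabet (suc i) ≡ p (suc i) + psum zs (suc i)) → ∀ r d →
    homℤ p (((offset r ℤ.- ℤ.+ n) ℤ.+ ℤ.+ d) ℤ.+ ℤ.+ n) ≡ apply (shift d (lookup γs r)) zs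
  entry {p} zs len e r d = ≡.trans (cong (λ l → homℤ p (((offset r ℤ.- ℤ.+ n) ℤ.+ ℤ.+ d) ℤ.+ ℤ.+ l)) (sym len))
    (≡.trans (homℤ-apply zs e ((offset r ℤ.- ℤ.+ n) ℤ.+ ℤ.+ d)) (apply-cong zs (λ a →
      ≡.trans (cong (homℤ alphabet) (ℤₚ.+-assoc (offset r ℤ.- ℤ.+ n) (ℤ.+ d) (ℤ.+ a)))
        (cong (λ g → g (d ℕ.+ a)) (sym (Vecₚ.lookup∘tabulate γ r))))))

  entry₀ : ∀ {p} zs → length zs ≡ n → (∀ i → alphabet (suc i) ≡ p (suc i) + psum zs (suc i)) → ∀ r c →
    homℤ p (Defs.idx lam r c 0) ≡ apply (shift (toℕ c) (lookup γs r)) zs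
  entry₀ {p} zs len e r c = ≡.trans (cong (homℤ p) (sym (ℤ-shift (offset r) (ℤ.+ n) (ℤ.+ toℕ c)))) (entry zs len e r (toℕ c))

  entry₁ : ∀ {p} zs → length zs ≡ n → (∀ i → alphabet (suc i) ≡ p (suc i) + psum zs (suc i)) → ∀ r c →
    homℤ p (Defs.idx lam r c 1) ≡ apply (shift (suc (toℕ c)) (lookup γs r)) zs
  entry₁ {p} zs len e r c = ≡.trans (cong (homℤ p) (sym (ℤ-shift₁ (offset r) (ℤ.+ n) (ℤ.+ toℕ c)))) (entry zs len e r (suc (toℕ c)))

  length-tx : length (map (t *_) xs) ≡ n
  length-tx = ≡.trans (Listₚ.length-map (t *_) xs) length-xs

  alphabet-XtqXt : ∀ i → alphabet i ≡ Defs.pXtqXt q t x i + psum xs i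
  alphabet-XtqXt i = ≡.trans (+-congˡ (psum-scale t xs i)) (≡.trans (shifted-alphabet _ _ _)
    (+-congʳ (sym (≡.trans (pXtqXt≡ q t x i) (+-congˡ (*-congʳ (pX-psum x i)))))))

  rhs : Defs.RHS n k q t lam x ≡ det k (λ r c → rhs-entry t xs c (lookup γs r))
  rhs = ≡.trans (RHS≡ n k q t lam x) (det-cong k (λ r c → cong₂ (λ a b → a - pow t (k ℕ.∸ suc (toℕ c)) * b)
    (entry₁ (map (t *_) xs) length-tx (λ _ → refl) r c) (entry₁ xs length-xs (alphabet-XtqXt ∘ suc) r c)))

  -- The Macdonald operator of index 0 evaluates at `x` itself, which agrees with `ΘS q ⊥ x` only
  -- pointwise; hence a separate evaluation.
  value-∅ : Defs.SλXtq n k q t lam x ≡ lhs-det t γs [] xs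
  value-∅ = ≡.trans (det≡ k _) (det-cong k (λ r c → ≡.trans (S≡ _ _) (entry₀ (map (t *_) xs) length-tx (λ _ → refl) r c)))

  module _ (J : Subset n) where

    Jl Rl : List ℚ
    Jl = members J xv
    Rl = nonmembers J xv

    alphabet-Θ : ∀ i → alphabet (suc i) ≡ Defs.pXtq q t (Defs.ΘS q J x) (suc i) + psum (roots t Jl Rl) (suc i)
    alphabet-Θ i = ≡.trans
      (cong₂ _+_ (≡.trans (pXtq≡ q t x (suc i)) (*-congʳ (*-congʳ (≡.trans (pX-psum x (suc i)) ps)))) (≡.trans (psum-scale t xs (suc i)) (*-congˡ ps)))
      (≡.trans (theta-alphabet _ _ _ _ _ (inv-inverseʳ (x-y≢0 (λ e → q≢1 i (≡.trans (pow≡ q (suc i)) e)))))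
        (sym (cong₂ _+_ (≡.trans (pXtq≡ q t (Defs.ΘS q J x) (suc i)) (*-congʳ (*-congʳ (pX-Θ q J x (suc i)))))
                        (≡.trans (psum-++ Jl (map (t *_) Rl) (suc i)) (+-congˡ (psum-scale t Rl (suc i)))))))
      where
      ps : psum xs (suc i) ≡ psum Jl (suc i) + psum Rl (suc i)
      ps = psum-Split (Split-subset J xv) (suc i)

    length-roots : length (roots t Jl Rl) ≡ n
    length-roots = ≡.trans (Listₚ.length-++ Jl) (≡.trans (cong (length Jl ℕ.+_) (Listₚ.length-map (t *_) Rl))
      (≡.trans (Split-length (Split-subset J xv)) length-xs))

    value : Defs.SλXtq n k q t lam (Defs.ΘS q J x) ≡ lhs-det t γs Jl Rl
    value = ≡.trans (det≡ k _) (det-cong k (λ r c → ≡.trans (S≡ _ _) (entry₀ (roots t Jl Rl) length-roots alphabet-Θ r c)))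

  F : Defs.Fun n
  F = Defs.SλXtq n k q t lam

  macdonald-term : Subset n → Subset n → ℚ
  macdonald-term I J = T t 1ℚ (members J xv) (between I J xv) * lhs-det t γs (members J xv) (nonmembers J xv)

  -- The identity operator fits the general pattern at `l = 0`: the only subset of size 0 is `⊥`,
  -- and its product is empty.
  M≡ : ∀ I l → Defs.M q t I l F x ≡ pow t (Defs.choose2 l) * Σsub n (λ J → ind (∣ J ∣ ℕ.≡ᵇ l) (ind (J Defs.⊆ᵇ I) (macdonald-term I J)))
  M≡ I zero = sym (≡.trans (*-idˡ _) (≡.trans (Σsub-empty n (λ J → ind (J Defs.⊆ᵇ I) (macdonald-term I J)))
    (≡.trans (cong (λ b → ind b (macdonald-term I ⊥)) (⊥⊆ I))
      (≡.trans (cong₂ (λ J R → T t 1ℚ J (between I ⊥ xv) * lhs-det t γs J R) (members-⊥ xv) (nonmembers-⊥ xv))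
        (≡.trans (*-idˡ _) (sym value-∅))))))
  M≡ I (suc l) = ≡.trans (M-suc q t I l F x) (*-congˡ (Σsub-cong n (λ J → cong (ind (∣ J ∣ ℕ.≡ᵇ suc l)) (cong (ind (J Defs.⊆ᵇ I))
    (cong₂ _*_
      (≡.trans (ΠΠ-members J x (λ j → Defs.isIn I j ∧ not (Defs.isIn J j)) (λ a b → (t * a - b) * inv (a - b)) (between I J xv) (Πf-between I J x))
        (Πl-cong′ (members J xv) (λ a → Πl-cong′ (between I J xv) (λ b → cong (λ u → (t * a - u) * inv (a - b)) (sym (*-idˡ b))))))
      (value J))))))

  prefactor : ∀ I → Defs.xPow I x * (Defs.RIct t I x * inv (Defs.RIc I x)) ≡ Πl (λ a → a) (members I xv) * T 1ℚ τ (members I xv) (nonmembers I xv)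
  prefactor I = cong₂ _*_ (xPow-members I x) (≡.trans
    (cong₂ (λ a b → a * inv b)
      (≡.trans (RIct≡ t I x) (ΠΠ-members I x (λ j → not (Defs.isIn I j)) (λ a b → a - b * τ) (nonmembers I xv) (Πf-nonmembers I x)))
      (≡.trans (RIc≡ I x) (ΠΠ-members I x (λ j → not (Defs.isIn I j)) (λ a b → a - b) (nonmembers I xv) (Πf-nonmembers I x))))
    (ratio τ (members I xv) (nonmembers I xv) (Split-disjoint (Split-subset I xv) unique-xs)))

  -- The condition |I| = k is written as |J| + |K| = k, a form that survives the passage to ternary
  -- splittings.
  summand : List ℚ → List ℚ → List ℚ → List ℚ → ℚ
  summand J R K L = ind (length J ℕ.+ length K ℕ.≡ᵇ k)
    ((κ s t J * T t 1ℚ J R * lhs-det t γs J R) * ((Πl (λ a → a) J * Πl (λ a → a) K) * T 1ℚ τ K L))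

  A : ℕ → ℚ
  A l = pow (- t) l * pow t (Defs.choose2 l)

  inner-sum : ∀ I → (∣ I ∣ ℕ.≡ᵇ k) ≡ true →
    Σf (suc k) (λ l → pow (- t) (toℕ l) * Defs.xPow I x * Defs.RIct t I x * inv (Defs.RIc I x) * Defs.M q t I (toℕ l) F x)
    ≡ Σsub n (λ J → ind (J Defs.⊆ᵇ I) (summand (members J xv) (nonmembers J xv) (between I J xv) (nonmembers I xv)))
  inner-sum I ∣I∣≡k = begin
    Σf (suc k) (λ l → pow (- t) (toℕ l) * Defs.xPow I x * Defs.RIct t I x * inv (Defs.RIc I x) * Defs.M q t I (toℕ l) F x)
      ≡⟨ Σf-cong (suc k) (λ l → ≡.trans (*-congˡ (M≡ I (toℕ l))) (gather-l _ _ _ _ _ _)) ⟩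
    Σf (suc k) (λ l → P * (A (toℕ l) * Σsub n (λ J → ind (∣ J ∣ ℕ.≡ᵇ toℕ l) (ind (J Defs.⊆ᵇ I) (macdonald-term I J)))))
      ≡⟨ ≡.trans (Σf-* (suc k) P _) (*-congˡ (≡.trans (Σf-cong (suc k) (λ l → sym (Σsub-* n (A (toℕ l)) _))) (sym (Σsub-Σf n (suc k) _)))) ⟩
    P * Σsub n (λ J → Σf (suc k) (λ l → A (toℕ l) * ind (∣ J ∣ ℕ.≡ᵇ toℕ l) (ind (J Defs.⊆ᵇ I) (macdonald-term I J))))
      ≡⟨ sym (Σsub-* n P _) ⟩
    Σsub n (λ J → P * Σf (suc k) (λ l → A (toℕ l) * ind (∣ J ∣ ℕ.≡ᵇ toℕ l) (ind (J Defs.⊆ᵇ I) (macdonald-term I J))))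
      ≡⟨ Σsub-cong n (λ J → ≡.trans (*-congˡ (collapse J)) (≡.trans (ind-* (J Defs.⊆ᵇ I) P _) (ind-cong (J Defs.⊆ᵇ I) (term J)))) ⟩
    Σsub n (λ J → ind (J Defs.⊆ᵇ I) (summand (members J xv) (nonmembers J xv) (between I J xv) (nonmembers I xv))) ∎
    where
    open ≡-Reasoning
    P : ℚ
    P = Defs.xPow I x * (Defs.RIct t I x * inv (Defs.RIc I x))
    sizes : ∀ J → (J Defs.⊆ᵇ I) ≡ true → length (members J xv) ℕ.+ length (between I J xv) ≡ k
    sizes J J⊆I = ≡.trans (Split-length (Split-between I J xv J⊆I)) (≡.trans (sym (length-members I xv)) (≡ᵇ-sound ∣ I ∣ k ∣I∣≡k))
    -- A subset `J` of `I` has at most k elements, so exactly one `l` in the range accounts for it.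
    collapse : ∀ J → Σf (suc k) (λ l → A (toℕ l) * ind (∣ J ∣ ℕ.≡ᵇ toℕ l) (ind (J Defs.⊆ᵇ I) (macdonald-term I J)))
      ≡ ind (J Defs.⊆ᵇ I) (A (length (members J xv)) * macdonald-term I J)
    collapse J = ≡.trans
      (Σf-cong (suc k) (λ l → ≡.trans (ind-* (∣ J ∣ ℕ.≡ᵇ toℕ l) (A (toℕ l)) _)
        (≡.trans (cong (ind (∣ J ∣ ℕ.≡ᵇ toℕ l)) (ind-* (J Defs.⊆ᵇ I) (A (toℕ l)) _)) (ind-comm (∣ J ∣ ℕ.≡ᵇ toℕ l) (J Defs.⊆ᵇ I) _))))
      (≡.trans (Σf-ind (suc k) (J Defs.⊆ᵇ I) _) (ind-cong (J Defs.⊆ᵇ I) (λ J⊆I →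
        ≡.trans (Σf-pick k ∣ J ∣ (λ l → A l * macdonald-term I J)
          (subst (ℕ._≤ k) (sym (length-members J xv)) (subst (length (members J xv) ℕ.≤_) (sizes J J⊆I) (ℕₚ.m≤m+n _ _))))
        (cong (λ l → A l * macdonald-term I J) (length-members J xv)))))
    ind-true : ∀ {b a} → b ≡ true → a ≡ ind b a
    ind-true refl = refl
    -- The Macdonald operator pairs `J` with the rest of `I`, the rescaled quotient pairs `J` with
    -- the complement of `I`; together they form `T t 1ℚ` between `J` and its complement.
    term : ∀ J → (J Defs.⊆ᵇ I) ≡ true → P * (A (length (members J xv)) * macdonald-term I J) ≡
      summand (members J xv) (nonmembers J xv) (between I J xv) (nonmembers I xv)
    term J J⊆I = begin
      P * (A (length Jl′) * (T t 1ℚ Jl′ K * val))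
        ≡⟨ *-congʳ (≡.trans (prefactor I) (cong₂ _*_ (Split-Πl (λ a → a) sp) (≡.trans (Split-Πl _ sp) (*-congʳ (T-rescale t τ τt Jl′ L))))) ⟩
      ((Πl (λ a → a) Jl′ * Πl (λ a → a) K) * ((Πl (λ _ → Πl (λ _ → τ) L) Jl′ * T t 1ℚ Jl′ L) * T 1ℚ τ K L)) * (A (length Jl′) * (T t 1ℚ Jl′ K * val))
        ≡⟨ gather-term _ _ _ _ _ _ _ _ ⟩
      ((A (length Jl′) * Πl (λ _ → Πl (λ _ → τ) L) Jl′) * (T t 1ℚ Jl′ K * T t 1ℚ Jl′ L) * val) * ((Πl (λ a → a) Jl′ * Πl (λ a → a) K) * T 1ℚ τ K L)
        ≡⟨ *-congʳ (*-congʳ (cong₂ _*_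
             (≡.trans (κ-pow t _ Jl′) (cong (λ c → κ (t * c) t Jl′) (≡.trans (Πl-const τ L) (cong (pow τ) length-L))))
             (sym (T-Splitʳ t 1ℚ Jl′ (Split-outside I J xv J⊆I))))) ⟩
      (κ s t Jl′ * T t 1ℚ Jl′ R * val) * ((Πl (λ a → a) Jl′ * Πl (λ a → a) K) * T 1ℚ τ K L)
        ≡⟨ ind-true (≡.trans (cong (ℕ._≡ᵇ k) (sizes J J⊆I)) (≡ᵇ-refl k)) ⟩
      summand Jl′ R K L ∎
      where
      Jl′ R K L : List ℚ
      Jl′ = members J xv
      R   = nonmembers J xv
      K   = between I J xv
      L   = nonmembers I xv
      val : ℚ
      val = lhs-det t γs Jl′ R
      sp : Split Jl′ K (members I xv)
      sp = Split-between I J xv J⊆I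
      ≡ᵇ-refl : ∀ m → (m ℕ.≡ᵇ m) ≡ true
      ≡ᵇ-refl zero    = refl
      ≡ᵇ-refl (suc m) = ≡ᵇ-refl m
      length-L : length L ≡ n ℕ.∸ k
      length-L = ≡.trans (sym (ℕₚ.m+n∸m≡n k (length L))) (cong (ℕ._∸ k)
        (≡.trans (cong (ℕ._+ length L) (sym (≡.trans (sym (length-members I xv)) (≡ᵇ-sound ∣ I ∣ k ∣I∣≡k))))
          (≡.trans (Split-length (Split-subset I xv)) length-xs)))

  ternary-sum : Σsub n (λ I → Σsub n (λ J → ind (J Defs.⊆ᵇ I) (summand (members J xv) (nonmembers J xv) (between I J xv) (nonmembers I xv))))
    ≡ lhs-det-sum t t≢0 s xs unique-xs st γs
  ternary-sum = ≡.trans (ternary xv summand) (Σsplit-cong xs (λ {J} {R} sp →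
    ≡.trans (Σsplit-cong R (λ {K} {L} _ → sym (ind-* (length J ℕ.+ length K ℕ.≡ᵇ k) (κ s t J * T t 1ℚ J R * lhs-det t γs J R) _)))
      (≡.trans (Σsplit-* R _ _) (≡.trans (*-congˡ (sum-over-K τ R (unique-right sp unique-xs) J k)) (final-arrange _ _ _ _)))))
    where
    unique-right : ∀ {J R xs} → Split J R xs → Unique xs → Unique R
    unique-right []        u        = []
    unique-right (left s)  (_ ∷ u)  = unique-right s u
    unique-right (right s) (x∉ ∷ u) = proj₂ (Split-All s x∉) ∷ unique-right s u

  absorb : ∀ I → ind (∣ I ∣ ℕ.≡ᵇ k) (Σsub n (λ J → ind (J Defs.⊆ᵇ I) (summand (members J xv) (nonmembers J xv) (between I J xv) (nonmembers I xv))))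
    ≡ Σsub n (λ J → ind (J Defs.⊆ᵇ I) (summand (members J xv) (nonmembers J xv) (between I J xv) (nonmembers I xv)))
  absorb I = ≡.trans (sym (Σsub-ind n (∣ I ∣ ℕ.≡ᵇ k) _)) (Σsub-cong n (λ J →
    ≡.trans (ind-comm (∣ I ∣ ℕ.≡ᵇ k) (J Defs.⊆ᵇ I) _) (ind-cong (J Defs.⊆ᵇ I) (λ J⊆I →
      ≡.trans (ind-≡ (cong (ℕ._≡ᵇ k) (≡.trans (length-members I xv) (sym (Split-length (Split-between I J xv J⊆I))))))
        (ind-idem (length (members J xv) ℕ.+ length (between I J xv) ℕ.≡ᵇ k))))))
    where
    ind-≡ : ∀ {b c a} → b ≡ c → ind b a ≡ ind c a
    ind-≡ refl = refl
    ind-idem : ∀ b {a} → ind b (ind b a) ≡ ind b a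
    ind-idem true  = refl
    ind-idem false = refl

  theorem : Defs.B n q t k F x ≡ Defs.RHS n k q t lam x
  theorem = begin
    Defs.B n q t k F x
      ≡⟨ B≡ n q t k F x ⟩
    Σsub n (λ I → ind (∣ I ∣ ℕ.≡ᵇ k) (Σf (suc k) (λ l → pow (- t) (toℕ l) * Defs.xPow I x * Defs.RIct t I x * inv (Defs.RIc I x) * Defs.M q t I (toℕ l) F x)))
      ≡⟨ Σsub-cong n (λ I → ≡.trans (ind-cong (∣ I ∣ ℕ.≡ᵇ k) (inner-sum I)) (absorb I)) ⟩
    Σsub n (λ I → Σsub n (λ J → ind (J Defs.⊆ᵇ I) (summand (members J xv) (nonmembers J xv) (between I J xv) (nonmembers I xv))))
      ≡⟨ ternary-sum ⟩
    lhs-det-sum t t≢0 s xs unique-xs st γs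
      ≡⟨ functional-identity t t≢0 s xs unique-xs st γs ⟩
    det k (λ r c → rhs-entry t xs c (lookup γs r))
      ≡⟨ sym rhs ⟩
    Defs.RHS n k q t lam x ∎
    where open ≡-Reasoning

theorem4p2 : (n k : ℕ) → 1 ≤ k → k ≤ n →
    (lam : Fin k → ℕ) → IsPartition lam →
    (q t : ℚ) → (x : Fin n → ℚ) →
    (∀ (i j : Fin n) → i ≢ j → x i ≢ x j) →
    (∀ (m : ℕ) → q ^ℚ suc m ≢ 1ℚ) →
    t ≢ 0ℚ →
    B n q t k (SλXtq n k q t lam) x ≡ RHS n k q t lam x
theorem4p2 n k _ k≤n lam _ q t x distinct q≢1 t≢0 = Assembly.theorem n k k≤n lam q t x distinct q≢1 t≢0
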